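{- For every integer $n\geq 3$, the augmented saltire graphs ${AS}_{n,n}$ and ${AS}_{n,n+1}$ are claw-contractible-free and their chromatic symmetric functions are not $e$-positive.
   Context: All graphs are finite and simple. For a graph $G$ with vertex set $V=\{v_1,\dots,v_N\}$, the chromatic symmetric function is $X_G=\sum_\kappa x_{\kappa(v_1)}\cdots x_{\kappa(v_N)}$, summed over all proper colourings $\kappa:V\to\{1,2,\dots\}$. The elementary symmetric functions are $e_i=\sum_{j_1<\cdots<j_i}x_{j_1}\cdots x_{j_i}$ and $e_\lambda=e_{\lambda_1}\cdots e_{\lambda_\ell}$; they form a basis of the symmetric functions. A symmetric function is $e$-positive if it is a non-negative linear combination of the $e_\lambda$. The claw is $K_{1,3}$. A graph $G$ contracts to the claw if there is a subset $S$ of its edges such that contracting the edges of $S$ and replacing multiple edges by single edges yields the claw; $G$ is claw-contractible-free if it does not contract to the claw. For $a\geq 2$, $b\geq 3$, the augmented saltire graph ${AS}_{a,b}$ is the graph on vertices $v_1,\dots,v_{a+b}$ with edges $v_iv_{i+1}$ for $1\leq i\leq a+b-1$, together with $v_{a+b}v_1$, $v_1v_{a+1}$, $v_2v_{a+2}$ and $v_1v_{a+2}$. -}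

module Defs where

open import Data.Bool using (Bool; true; false; _∧_; _∨_; not; if_then_else_; T)
open import Data.Nat using (ℕ; zero; suc; _+_; _≡ᵇ_; _≤_)
open import Data.Fin using (Fin; toℕ)
open import Data.List using (List; []; _∷_; _++_; map; concatMap; allFin; filterᵇ; length; lookup; foldr)
open import Data.List.Relation.Unary.All using (All)
open import Data.List.Relation.Unary.Linked using (Linked)
open import Data.Vec as Vec using (Vec)
open import Data.Product using (Σ; _×_; _,_; proj₁; proj₂; ∃)
open import Data.Sum using (_⊎_)
open import Data.Integer using (+_)
open import Data.Rational as ℚ using (ℚ; 0ℚ; _/_)
open import Relation.Binary.PropositionalEquality using (_≡_; _≢_)
open import Function.Bundles using (_⇔_)
open import Relation.Nullary using (¬_)

-- Finite simple graphs on vertex set Fin N, adjacency as a Boolean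
-- relation.  (Graphs built below are symmetric and loopless by construction.)

record Graph : Set where
  field
    N   : ℕ
    adj : Fin N → Fin N → Bool
open Graph public

all : ∀ {A : Set} → (A → Bool) → List A → Bool
all p = foldr (λ x b → p x ∧ b) true

finEq : ∀ {k} → Fin k → Fin k → Bool
finEq u v = toℕ u ≡ᵇ toℕ v

mkGraph : (N : ℕ) → (ℕ → ℕ → Bool) → Graph
mkGraph N e = record
  { N = N
  ; adj = λ u v → not (finEq u v) ∧
                  (e (suc (toℕ u)) (suc (toℕ v)) ∨ e (suc (toℕ v)) (suc (toℕ u))) }

-- Augmented saltire graph AS_{a,b}: vertices v_1..v_{a+b} (v_i = index i-1),
-- edges v_i v_{i+1}, v_{a+b} v_1, v_1 v_{a+1}, v_2 v_{a+2}, v_1 v_{a+2}.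
ASedge : ℕ → ℕ → ℕ → ℕ → Bool
ASedge a b i j =
     (j ≡ᵇ suc i)
  ∨ ((i ≡ᵇ a + b) ∧ (j ≡ᵇ 1))
  ∨ ((i ≡ᵇ 1) ∧ (j ≡ᵇ a + 1))
  ∨ ((i ≡ᵇ 2) ∧ (j ≡ᵇ a + 2))
  ∨ ((i ≡ᵇ 1) ∧ (j ≡ᵇ a + 2))

AS : ℕ → ℕ → Graph
AS a b = mkGraph (a + b) (ASedge a b)

-- Chromatic symmetric function, via its monomial coefficients.
-- For an exponent vector α = (α₁,…,α_k), the coefficient of
-- x₁^α₁ ⋯ x_k^α_k in X_G is the number of proper colourings
-- κ : V → {1..k} with |κ⁻¹(i)| = α_i.

allFuns : (N k : ℕ) → List (Vec (Fin k) N)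
allFuns zero    k = Vec.[] ∷ []
allFuns (suc N) k = concatMap (λ c → map (c Vec.∷_) (allFuns N k)) (allFin k)

properᵇ : (G : Graph) → ∀ {k} → Vec (Fin k) (N G) → Bool
properᵇ G κ = all (λ u → all (λ v → not (adj G u v) ∨ not (finEq (Vec.lookup κ u) (Vec.lookup κ v)))
                             (allFin (N G))) (allFin (N G))

countᵇ : ∀ {n} → (Fin n → Bool) → ℕ
countᵇ {n} p = length (filterᵇ p (allFin n))

fibresᵇ : ∀ {M} (α : List ℕ) → Vec (Fin (length α)) M → Bool
fibresᵇ α κ = all (λ i → countᵇ (λ u → finEq (Vec.lookup κ u) i) ≡ᵇ lookup α i) (allFin (length α))

coefX : Graph → List ℕ → ℕ
coefX G α = length (filterᵇ (λ κ → properᵇ G κ ∧ fibresᵇ α κ) (allFuns (N G) (length α)))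

-- Elementary symmetric functions, via monomial coefficients.
-- choices m α : the list of α − 1_S over all m-subsets S of {1..k}
-- with 1_S ≤ α (these are the terms of e_m matching x^α).

choices : ℕ → List ℕ → List (List ℕ)
choices zero    α       = α ∷ []
choices (suc m) []      = []
choices (suc m) (a ∷ α) = map (a ∷_) (choices (suc m) α) ++ rest a
  where
  rest : ℕ → List (List ℕ)
  rest zero     = []
  rest (suc a') = map (a' ∷_) (choices m α)

sumℕ : List ℕ → ℕ
sumℕ = foldr _+_ 0

coefE : List ℕ → List ℕ → ℕ
coefE []      α = if all (_≡ᵇ 0) α then 1 else 0
coefE (m ∷ μ) α = sumℕ (map (coefE μ) (choices m α))

IsPartition : List ℕ → Set
IsPartition μ = All (1 ≤_) μ × Linked (λ x y → y ≤ x) μ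

toℚ : ℕ → ℚ
toℚ n = + n / 1

combCoef : List (List ℕ × ℚ) → List ℕ → ℚ
combCoef L α = foldr (λ p acc → proj₂ p ℚ.* toℚ (coefE (proj₁ p) α) ℚ.+ acc) 0ℚ L

-- X_G is e-positive: X_G = Σ c_λ e_λ with all c_λ ≥ 0 (equality of
-- symmetric functions = equality of every monomial coefficient).
EPositive : Graph → Set
EPositive G = Σ (List (List ℕ × ℚ)) λ L →
    All (λ p → IsPartition (proj₁ p) × (0ℚ ℚ.≤ proj₂ p)) L
  × (∀ (α : List ℕ) → toℚ (coefX G α) ≡ combCoef L α)

data Reach {n : ℕ} (S : Fin n → Fin n → Bool) : Fin n → Fin n → Set where
  here : ∀ {u} → Reach S u u
  step : ∀ {u v w} → (T (S u v) ⊎ T (S v u)) → Reach S v w → Reach S u w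

isCentre : Fin 4 → Bool
isCentre j = toℕ j ≡ᵇ 0

clawAdj : Fin 4 → Fin 4 → Set
clawAdj j j' = T ((isCentre j ∧ not (isCentre j')) ∨ (isCentre j' ∧ not (isCentre j)))

-- G contracts to the claw: some edge set S whose contraction (components of
-- (V,S) become vertices; loops deleted, multiple edges merged) is the claw.
-- c labels each component by the claw vertex it becomes.
ContractsToClaw : Graph → Set
ContractsToClaw G =
  Σ (Fin (N G) → Fin (N G) → Bool) λ S →
  Σ (Fin (N G) → Fin 4) λ c →
      (∀ u v → T (S u v) → T (adj G u v))
    × (∀ j → ∃ λ u → c u ≡ j)
    × (∀ u v → T (S u v) → c u ≡ c v)
    × (∀ u v → c u ≡ c v → Reach S u v)
    × (∀ j j' → j ≢ j' →
         ((Σ (Fin (N G)) λ u → Σ (Fin (N G)) λ v →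
             c u ≡ j × c v ≡ j' × T (adj G u v)) ⇔ clawAdj j j'))

ClawContractibleFree : Graph → Set
ClawContractibleFree G = ¬ ContractsToClaw G

{-# OPTIONS --safe #-}
module Submission where

-- An e-positive X satisfies φ(X) ≥ 0 for each linear functional φ that is non-negative on every e_μ.
-- Put N = a + b with b ∈ {a, a+1} and work in N variables. We use a functional L on polynomials
-- of degree N that kills the ideal (p₁, …, p_{a-1}) and, up to the sign (-1)^N, is zero on e_N and
-- positive on e_b e_a. By Newton's identities it kills e₁, …, e_{a-1}, hence every other e_μ of
-- degree N, because such a μ has a part smaller than a. Applied to the sum over proper
-- colourings of AS_{a,b}, the relations p₁ = … = p_{a-1} = 0 collapse the two long arcs of the
-- cycle: only the colours of v₁, v₂, v_{a+1}, v_{a+2} remain to be summed over, and (-1)^N L(X)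
-- is a negative multiple of L(p_N) > 0.

open import Defs
open import Data.Nat using (ℕ; suc; _≤_)
open import Data.Product using (_×_)
open import Relation.Nullary using (¬_)

open import Data.Bool using (Bool; true; false; T; _∧_; _∨_; not; if_then_else_)
open import Data.Bool.Properties using (T-∧; T-∨; ∧-assoc)
open import Data.Empty using (⊥; ⊥-elim)
open import Data.Fin as Fin using (Fin; zero; suc; toℕ; fromℕ; fromℕ<; _↑ʳ_)
open import Data.Fin.Properties using (toℕ-injective; toℕ-fromℕ; toℕ-fromℕ<; toℕ-↑ʳ; toℕ<n)
open import Data.Integer as ℤ using (ℤ; 0ℤ; 1ℤ; _+_; _*_; -_; _-_; -[1+_]) renaming (+_ to pos)
import Data.Integer.Properties as ℤₚ
open import Data.Integer.Tactic.RingSolver using (solve-∀)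
open import Data.List as List using (List; []; _∷_; length; map; concatMap; foldr; tabulate; allFin; filterᵇ; _++_)
open import Data.List.Properties using (map-++; map-∘)
open import Data.List.Relation.Unary.All as All using (All; []; _∷_)
import Data.List.Relation.Unary.All.Properties as Allₚ
open import Data.List.Relation.Unary.Linked using (_∷_)
open import Data.Nat as ℕ using (zero; _<_; z≤n; s≤s; _≡ᵇ_; _<ᵇ_; _!)
import Data.Nat.Properties as ℕₚ
open import Data.Nat.Tactic.RingSolver using () renaming (solve-∀ to ℕ-solve-∀)
open import Data.Product using (Σ; _,_; proj₁; proj₂)
open import Data.Rational as ℚ using (ℚ; mkℚ; 0ℚ)
import Data.Rational.Properties as ℚₚ
open import Data.Rational.Solver using (module +-*-Solver)
open import Data.Rational.Unnormalised as ℚᵘ using (mkℚᵘ; *≡*)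
import Data.Rational.Unnormalised.Properties as ℚᵘₚ
open import Data.Sum as Sum using (_⊎_; inj₁; inj₂)
open import Data.Unit using (tt)
open import Data.Vec as Vec using (Vec; []; _∷_; toList; lookup)
open import Data.Vec.Properties using (lookup-++ʳ)
open import Function using (_∘_; id; Equivalence)
open import Relation.Binary.Definitions using (tri<; tri≈; tri>)
open import Relation.Binary.PropositionalEquality using (_≡_; _≢_; refl; sym; trans; cong; cong₂; subst; subst₂; module ≡-Reasoning)
open import Relation.Nullary using (yes; no)
open import Algebra.Properties.Semiring.Sum ℤₚ.+-*-semiring using (sum-cong-≗; ∑-distrib-+; ∑-comm; *-distribˡ-sum) renaming (sum to ∑)

open ≡-Reasoning
open Equivalence using (to; from)

-- Modulo p₁, ..., p_{a-1} only two numbers are left in degree N: x = L(p_N) and y = L(p_a p_b),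
-- because three power sums of index at least a already exceed degree N ≤ 2a + 1. Newton's
-- identities express L(e_N) through x and y, and the requirement L(e_N) = 0 becomes y = a x for b =
-- a, and a b x = N y for b = a + 1. These are the relations built into the functional. It then sees
-- nothing but the coefficient of e_b e_a, and the proof amounts to showing that this coefficient of
-- X is negative. The sum over colourings is again a combination of x and y. Eliminating y leaves,
-- up to the sign (-1)^N, the value -(a-1)(a-2) x for b = a, and -a(a-1)(a-2) x / N for b = a + 1.
-- Both are zero at a = 2, so strict negativity starts at n = 3.

private
  variable
    K K₁ K₂ : ℕ

-- Sums and linear functionals on monomials

sgn : ℕ → ℤ
sgn zero    = 1ℤ
sgn (suc n) = - sgn n

∑-zero : (f : Fin K → ℤ) → (∀ c → f c ≡ 0ℤ) → ∑ f ≡ 0ℤ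
∑-zero {zero}  f h = refl
∑-zero {suc K} f h = cong₂ _+_ (h zero) (∑-zero (f ∘ suc) (h ∘ suc))

∑-distrib-- : (f g : Fin K → ℤ) → ∑ (λ c → f c - g c) ≡ ∑ f - ∑ g
∑-distrib-- {zero}  f g = refl
∑-distrib-- {suc K} f g = begin
  f zero - g zero + ∑ (λ c → f (suc c) - g (suc c))  ≡⟨ cong (λ z → f zero - g zero + z) (∑-distrib-- (f ∘ suc) (g ∘ suc)) ⟩
  f zero - g zero + (∑ (f ∘ suc) - ∑ (g ∘ suc))      ≡⟨ lem (f zero) (g zero) _ _ ⟩
  f zero + ∑ (f ∘ suc) - (g zero + ∑ (g ∘ suc))      ∎
  where
  lem : ∀ a b c d → a - b + (c - d) ≡ a + c - (b + d)
  lem = solve-∀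

antidiagonal : ℕ → (ℕ → ℕ → ℤ) → ℤ
antidiagonal zero    h = h 0 0
antidiagonal (suc r) h = h 0 (suc r) + antidiagonal r (λ i j → h (suc i) j)

antidiagonal-cong : ∀ r {h h′ : ℕ → ℕ → ℤ} → (∀ i j → i ℕ.+ j ≡ r → h i j ≡ h′ i j) → antidiagonal r h ≡ antidiagonal r h′
antidiagonal-cong zero    e = e 0 0 refl
antidiagonal-cong (suc r) e = cong₂ _+_ (e 0 (suc r) refl) (antidiagonal-cong r (λ i j p → e (suc i) j (cong suc p)))

antidiagonal-zero : ∀ r {h : ℕ → ℕ → ℤ} → (∀ i j → i ℕ.+ j ≡ r → h i j ≡ 0ℤ) → antidiagonal r h ≡ 0ℤ
antidiagonal-zero zero    e = e 0 0 refl
antidiagonal-zero (suc r) e = cong₂ _+_ (e 0 (suc r) refl) (antidiagonal-zero r (λ i j p → e (suc i) j (cong suc p)))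

antidiagonal-+ : ∀ r (h h′ : ℕ → ℕ → ℤ) → antidiagonal r (λ i j → h i j + h′ i j) ≡ antidiagonal r h + antidiagonal r h′
antidiagonal-+ zero    h h′ = refl
antidiagonal-+ (suc r) h h′ = begin
  h 0 (suc r) + h′ 0 (suc r) + antidiagonal r (λ i j → h (suc i) j + h′ (suc i) j)  ≡⟨ cong (λ z → h 0 (suc r) + h′ 0 (suc r) + z) (antidiagonal-+ r (λ i j → h (suc i) j) (λ i j → h′ (suc i) j)) ⟩
  h 0 (suc r) + h′ 0 (suc r) + (antidiagonal r _ + antidiagonal r _)                        ≡⟨ lem (h 0 (suc r)) (h′ 0 (suc r)) _ _ ⟩
  antidiagonal (suc r) h + antidiagonal (suc r) h′                                          ∎
  where
  lem : ∀ a b c d → a + b + (c + d) ≡ a + c + (b + d)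
  lem = solve-∀

antidiagonal-* : ∀ r k (h : ℕ → ℕ → ℤ) → antidiagonal r (λ i j → k * h i j) ≡ k * antidiagonal r h
antidiagonal-* zero    k h = refl
antidiagonal-* (suc r) k h = trans (cong (λ z → k * h 0 (suc r) + z) (antidiagonal-* r k (λ i j → h (suc i) j))) (sym (ℤₚ.*-distribˡ-+ k (h 0 (suc r)) _))

antidiagonal-const : ∀ r k → antidiagonal r (λ _ _ → k) ≡ (pos (suc r)) * k
antidiagonal-const zero    k = sym (ℤₚ.*-identityˡ k)
antidiagonal-const (suc r) k = trans (cong (k +_) (antidiagonal-const r k)) (sym (ℤₚ.suc-* (pos (suc r)) k))

antidiagonal-∑ : ∀ r (h : Fin K → ℕ → ℕ → ℤ) → ∑ (λ c → antidiagonal r (h c)) ≡ antidiagonal r (λ i j → ∑ (λ c → h c i j))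
antidiagonal-∑ zero    h = refl
antidiagonal-∑ (suc r) h = trans (∑-distrib-+ (λ c → h c 0 (suc r)) (λ c → antidiagonal r (λ i j → h c (suc i) j)))
  (cong (λ z → ∑ (λ c → h c 0 (suc r)) + z) (antidiagonal-∑ r (λ c i j → h c (suc i) j)))

antidiagonal-swap : ∀ r s (h : ℕ → ℕ → ℕ → ℕ → ℤ) →
            antidiagonal r (λ i j → antidiagonal s (h i j)) ≡ antidiagonal s (λ k l → antidiagonal r (λ i j → h i j k l))
antidiagonal-swap zero    s h = refl
antidiagonal-swap (suc r) s h = trans (cong (λ z → antidiagonal s (h 0 (suc r)) + z) (antidiagonal-swap r s (λ i j → h (suc i) j)))
  (sym (antidiagonal-+ s (h 0 (suc r)) (λ k l → antidiagonal r (λ i j → h (suc i) j k l))))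

antidiagonal-last : ∀ r (h : ℕ → ℕ → ℤ) → antidiagonal (suc r) h ≡ antidiagonal r (λ i j → h i (suc j)) + h (suc r) 0
antidiagonal-last zero    h = refl
antidiagonal-last (suc r) h = trans (cong (λ z → h 0 (suc (suc r)) + z) (antidiagonal-last r (λ i j → h (suc i) j)))
  (sym (ℤₚ.+-assoc (h 0 (suc (suc r))) (antidiagonal r (λ i j → h (suc i) (suc j))) (h (suc (suc r)) 0)))

antidiagonal-flip : ∀ r (h : ℕ → ℕ → ℤ) → antidiagonal r (λ i j → h j i) ≡ antidiagonal r h
antidiagonal-flip zero    h = refl
antidiagonal-flip (suc r) h = begin
  h (suc r) 0 + antidiagonal r (λ i j → h j (suc i))  ≡⟨ cong (λ z → h (suc r) 0 + z) (antidiagonal-flip r (λ i j → h i (suc j))) ⟩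
  h (suc r) 0 + antidiagonal r (λ i j → h i (suc j))  ≡⟨ ℤₚ.+-comm (h (suc r) 0) _ ⟩
  antidiagonal r (λ i j → h i (suc j)) + h (suc r) 0  ≡⟨ antidiagonal-last r h ⟨
  antidiagonal (suc r) h                              ∎

antidiagonal-single : ∀ i₀ j₀ (h : ℕ → ℕ → ℤ) → (∀ i j → i ℕ.+ j ≡ i₀ ℕ.+ j₀ → i ≢ i₀ → h i j ≡ 0ℤ) →
              antidiagonal (i₀ ℕ.+ j₀) h ≡ h i₀ j₀
antidiagonal-single zero zero h z = refl
antidiagonal-single zero (suc j₀) h z =
  trans (cong (h 0 (suc j₀) +_) (antidiagonal-zero j₀ λ i j p → z (suc i) j (cong suc p) λ ())) (ℤₚ.+-identityʳ _)
antidiagonal-single (suc i₀) j₀ h z =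
  trans (cong₂ _+_ (z 0 (suc (i₀ ℕ.+ j₀)) refl λ ())
                   (antidiagonal-single i₀ j₀ _ λ i j p q → z (suc i) j (cong suc p) (q ∘ ℕₚ.suc-injective)))
        (ℤₚ.+-identityˡ _)

-- For b = a + 1 two neighbouring terms survive where b = a leaves a single one.
antidiagonal-double : ∀ i₀ j₀ (h : ℕ → ℕ → ℤ) →
              (∀ i j → i ℕ.+ j ≡ suc (i₀ ℕ.+ j₀) → i ≢ i₀ → i ≢ suc i₀ → h i j ≡ 0ℤ) →
              antidiagonal (suc (i₀ ℕ.+ j₀)) h ≡ h i₀ (suc j₀) + h (suc i₀) j₀
antidiagonal-double zero j₀ h z = cong (h 0 (suc j₀) +_) (antidiagonal-single 0 j₀ _ λ i j p q →
  z (suc i) j (cong suc p) (λ ()) (q ∘ ℕₚ.suc-injective))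
antidiagonal-double (suc i₀) j₀ h z =
  trans (cong₂ _+_ (z 0 (suc (suc (i₀ ℕ.+ j₀))) refl (λ ()) (λ ()))
                   (antidiagonal-double i₀ j₀ _ λ i j p q q′ → z (suc i) j (cong suc p) (q ∘ ℕₚ.suc-injective) (q′ ∘ ℕₚ.suc-injective)))
        (ℤₚ.+-identityˡ _)

𝟙 : Bool → ℤ
𝟙 b = if b then 1ℤ else 0ℤ

eq ne : Fin K → Fin K → ℤ
eq c d = 𝟙 (finEq c d)
ne c d = 1ℤ - eq c d

eq-sym : (c d : Fin K) → eq c d ≡ eq d c
eq-sym zero    zero    = refl
eq-sym zero    (suc d) = refl
eq-sym (suc c) zero    = refl
eq-sym (suc c) (suc d) = eq-sym c d

ne-sym : (c d : Fin K) → ne c d ≡ ne d c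
ne-sym c d = cong (λ z → 1ℤ - z) (eq-sym c d)

∑-eq : (d : Fin K) (f : Fin K → ℤ) → ∑ (λ y → eq d y * f y) ≡ f d
∑-eq {suc K} zero f = begin
  1ℤ * f zero + ∑ (λ y → 0ℤ * f (suc y))  ≡⟨ cong₂ _+_ (ℤₚ.*-identityˡ (f zero)) (∑-zero (λ y → 0ℤ * f (suc y)) λ y → ℤₚ.*-zeroˡ (f (suc y))) ⟩
  f zero + 0ℤ                             ≡⟨ ℤₚ.+-identityʳ _ ⟩
  f zero                                  ∎
∑-eq (suc d) f = trans (cong₂ _+_ (ℤₚ.*-zeroˡ (f zero)) (∑-eq d (f ∘ suc))) (ℤₚ.+-identityˡ _)

∑-ne : (d : Fin K) (f : Fin K → ℤ) → ∑ (λ y → ne d y * f y) ≡ ∑ f - f d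
∑-ne d f = begin
  ∑ (λ y → ne d y * f y)          ≡⟨ sum-cong-≗ (λ y → lem (eq d y) (f y)) ⟩
  ∑ (λ y → f y - eq d y * f y)    ≡⟨ ∑-distrib-- f _ ⟩
  ∑ f - ∑ (λ y → eq d y * f y)    ≡⟨ cong (λ z → ∑ f - z) (∑-eq d f) ⟩
  ∑ f - f d                       ∎
  where
  lem : ∀ e x → (1ℤ - e) * x ≡ x - e * x
  lem = solve-∀

-- Exponent vectors stand for monomials, so this is multiplication by x_c^i.
add : ℕ → Fin K → Vec ℕ K → Vec ℕ K
add i zero    (n ∷ m) = (i ℕ.+ n) ∷ m
add i (suc c) (n ∷ m) = n ∷ add i c m

add-comm : ∀ i j (c d : Fin K) m → add i c (add j d m) ≡ add j d (add i c m)
add-comm i j zero    zero    (n ∷ m) = cong (_∷ m) (ℕ-lem)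
  where
  ℕ-lem : i ℕ.+ (j ℕ.+ n) ≡ j ℕ.+ (i ℕ.+ n)
  ℕ-lem = trans (sym (ℕₚ.+-assoc i j n)) (trans (cong (ℕ._+ n) (ℕₚ.+-comm i j)) (ℕₚ.+-assoc j i n))
add-comm i j zero    (suc d) (n ∷ m) = refl
add-comm i j (suc c) zero    (n ∷ m) = refl
add-comm i j (suc c) (suc d) (n ∷ m) = cong (n ∷_) (add-comm i j c d m)

add-+ : ∀ i j (c : Fin K) m → add i c (add j c m) ≡ add (i ℕ.+ j) c m
add-+ i j zero    (n ∷ m) = cong (_∷ m) (sym (ℕₚ.+-assoc i j n))
add-+ i j (suc c) (n ∷ m) = cong (n ∷_) (add-+ i j c m)

add-0 : (c : Fin K) → ∀ m → add 0 c m ≡ m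
add-0 zero    (n ∷ m) = refl
add-0 (suc c) (n ∷ m) = cong (n ∷_) (add-0 c m)

-- A linear functional on the polynomials in K variables, encoded by its values on monomials.
Func : ℕ → Set
Func K = Vec ℕ K → ℤ

-- Multiplication by the power sum p_i, dualised: L ↦ L(p_i · _).
ps : ℕ → Func K → Func K
ps i L m = ∑ λ c → L (add i c m)

ps-cong : ∀ i {L L′ : Func K} → (∀ m → L m ≡ L′ m) → ∀ m → ps i L m ≡ ps i L′ m
ps-cong i e m = sum-cong-≗ λ c → e (add i c m)

ps-comm : ∀ i j (L : Func K) m → ps i (ps j L) m ≡ ps j (ps i L) m
ps-comm i j L m = trans (∑-comm (λ c d → L (add j d (add i c m))))
  (sum-cong-≗ λ d → sum-cong-≗ λ c → cong L (add-comm j i d c m))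

-- L annihilates the ideal generated by p₁, …, p_{a-1}.
Kill : ℕ → Func K → Set
Kill a L = ∀ i → 1 ≤ i → i < a → ∀ m → ps i L m ≡ 0ℤ

Kill-add : ∀ {a} {L : Func K} → Kill a L → ∀ j d → Kill a (L ∘ add j d)
Kill-add {L = L} k j d i p q m =
  trans (sum-cong-≗ λ c → cong L (add-comm j i d c m)) (k i p q (add j d m))

Kill-ps : ∀ {a} {L : Func K} → Kill a L → ∀ j → Kill a (ps j L)
Kill-ps {L = L} k j i p q m = trans (ps-comm i j L m)
  (∑-zero (λ c → ps i L (add j c m)) λ c → k i p q (add j c m))

Kill-* : ∀ {a} {L : Func K} x → Kill a L → Kill a (λ m → x * L m)
Kill-* {L = L} x k i p q m =
  trans (sym (*-distribˡ-sum x (λ c → L (add i c m)))) (trans (cong (x *_) (k i p q m)) (ℤₚ.*-zeroʳ x))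

-- Functionals on products of elementary symmetric functions

-- Multiplication by the elementary symmetric function e_m, dualised.
es : ℕ → Func K → Func K
es zero    L γ       = L γ
es (suc m) L []      = 0ℤ
es (suc m) L (n ∷ γ) = es (suc m) (L ∘ (n ∷_)) γ + es m (L ∘ (suc n ∷_)) γ

-- The dual of multiplication by the monomial symmetric function m_(i,1^m), for i ≥ 2
-- (and of (m+1) e_(m+1) for i = 1): the sum of L (γ + 1_S + i x_c) over |S| = m and c ∉ S.
hook : ℕ → ℕ → Func K → Func K
hook m       i L []      = 0ℤ
hook zero    i L (n ∷ γ) = L ((i ℕ.+ n) ∷ γ) + hook zero i (L ∘ (n ∷_)) γ
hook (suc m) i L (n ∷ γ) =
  es (suc m) (L ∘ ((i ℕ.+ n) ∷_)) γ + (hook (suc m) i (L ∘ (n ∷_)) γ + hook m i (L ∘ (suc n ∷_)) γ)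

es-zero : ∀ m {L : Func K} → (∀ γ → L γ ≡ 0ℤ) → ∀ γ → es m L γ ≡ 0ℤ
es-zero zero    e γ       = e γ
es-zero (suc m) e []      = refl
es-zero (suc m) e (n ∷ γ) = cong₂ _+_ (es-zero (suc m) (e ∘ (n ∷_)) γ) (es-zero m (e ∘ (suc n ∷_)) γ)

interchange : ∀ a b c d → (a + b) + (c + d) ≡ (a + c) + (b + d)
interchange = solve-∀

es-+ : ∀ m (L L′ : Func K) γ → es m (λ γ → L γ + L′ γ) γ ≡ es m L γ + es m L′ γ
es-+ zero    L L′ γ       = refl
es-+ (suc m) L L′ []      = refl
es-+ (suc m) L L′ (n ∷ γ) = trans
  (cong₂ _+_ (es-+ (suc m) (L ∘ (n ∷_)) (L′ ∘ (n ∷_)) γ) (es-+ m (L ∘ (suc n ∷_)) (L′ ∘ (suc n ∷_)) γ))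
  (interchange (es (suc m) (L ∘ (n ∷_)) γ) (es (suc m) (L′ ∘ (n ∷_)) γ) _ _)

hook-zero : ∀ i (L : Func K) γ → hook 0 i L γ ≡ ps i L γ
hook-zero i L []      = refl
hook-zero i L (n ∷ γ) = cong (λ z → L ((i ℕ.+ n) ∷ γ) + z) (hook-zero i (L ∘ (n ∷_)) γ)

-- Multiply the sum over sets S by the sum over c. Either c lies outside S, which gives the first
-- term, or c lies in S and its exponent 1 grows to i + 1, which leaves the other m elements of S
-- for the second.
es-ps : ∀ m i (L : Func K) γ → es (suc m) (ps i L) γ ≡ hook (suc m) i L γ + hook m (suc i) L γ
es-ps m i L [] = refl
es-ps zero i L (n ∷ γ) = begin
  es 1 (ps i L ∘ (n ∷_)) γ + ps i L (suc n ∷ γ)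
    ≡⟨ cong (λ z → z + ps i L (suc n ∷ γ))
        (trans (es-+ 1 (L ∘ ((i ℕ.+ n) ∷_)) (ps i (L ∘ (n ∷_))) γ) (cong (λ z → es 1 (L ∘ ((i ℕ.+ n) ∷_)) γ + z) (es-ps 0 i (L ∘ (n ∷_)) γ))) ⟩
  A + (B + C) + (L ((i ℕ.+ suc n) ∷ γ) + ps i (L ∘ (suc n ∷_)) γ)
    ≡⟨ cong₂ (λ x y → A + (B + C) + (L (x ∷ γ) + y)) (ℕₚ.+-suc i n) (sym (hook-zero i (L ∘ (suc n ∷_)) γ)) ⟩
  A + (B + C) + (L (suc (i ℕ.+ n) ∷ γ) + hook 0 i (L ∘ (suc n ∷_)) γ)
    ≡⟨ lem A B C (L (suc (i ℕ.+ n) ∷ γ)) _ ⟩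
  hook 1 i L (n ∷ γ) + hook 0 (suc i) L (n ∷ γ) ∎
  where
  A = es 1 (L ∘ ((i ℕ.+ n) ∷_)) γ
  B = hook 1 i (L ∘ (n ∷_)) γ
  C = hook 0 (suc i) (L ∘ (n ∷_)) γ
  lem : ∀ a b c d e → a + (b + c) + (d + e) ≡ a + (b + e) + (d + c)
  lem = solve-∀
es-ps (suc m) i L (n ∷ γ) = begin
  es (suc (suc m)) (ps i L ∘ (n ∷_)) γ + es (suc m) (ps i L ∘ (suc n ∷_)) γ
    ≡⟨ cong₂ _+_
        (trans (es-+ (suc (suc m)) (L ∘ ((i ℕ.+ n) ∷_)) (ps i (L ∘ (n ∷_))) γ) (cong (λ z → A + z) (es-ps (suc m) i (L ∘ (n ∷_)) γ)))
        (trans (es-+ (suc m) (L ∘ ((i ℕ.+ suc n) ∷_)) (ps i (L ∘ (suc n ∷_))) γ) (cong (λ z → es (suc m) (L ∘ ((i ℕ.+ suc n) ∷_)) γ + z) (es-ps m i (L ∘ (suc n ∷_)) γ))) ⟩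
  A + (B + C) + (es (suc m) (L ∘ ((i ℕ.+ suc n) ∷_)) γ + (D + E))
    ≡⟨ cong (λ x → A + (B + C) + (es (suc m) (L ∘ (x ∷_)) γ + (D + E))) (ℕₚ.+-suc i n) ⟩
  A + (B + C) + (es (suc m) (L ∘ (suc (i ℕ.+ n) ∷_)) γ + (D + E))
    ≡⟨ lem A B C (es (suc m) (L ∘ (suc (i ℕ.+ n) ∷_)) γ) D E ⟩
  hook (suc (suc m)) i L (n ∷ γ) + hook (suc m) (suc i) L (n ∷ γ) ∎
  where
  A = es (suc (suc m)) (L ∘ ((i ℕ.+ n) ∷_)) γ
  B = hook (suc (suc m)) i (L ∘ (n ∷_)) γ
  C = hook (suc m) (suc i) (L ∘ (n ∷_)) γ
  D = hook (suc m) i (L ∘ (suc n ∷_)) γ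
  E = hook m (suc i) (L ∘ (suc n ∷_)) γ
  lem : ∀ a b c f d e → a + (b + c) + (f + (d + e)) ≡ a + (b + d) + (f + (c + e))
  lem = solve-∀

-- Each of the m + 1 elements of S can be the marked one.
es-hook : ∀ m (L : Func K) γ → pos (suc m) * es (suc m) L γ ≡ hook m 1 L γ
es-hook m L [] = ℤₚ.*-zeroʳ (pos (suc m))
es-hook zero L (n ∷ γ) = begin
  1ℤ * (es 1 (L ∘ (n ∷_)) γ + L (suc n ∷ γ))     ≡⟨ lem (es 1 (L ∘ (n ∷_)) γ) _ ⟩
  L (suc n ∷ γ) + 1ℤ * es 1 (L ∘ (n ∷_)) γ       ≡⟨ cong (λ z → L (suc n ∷ γ) + z) (es-hook 0 (L ∘ (n ∷_)) γ) ⟩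
  hook 0 1 L (n ∷ γ)                             ∎
  where
  lem : ∀ a b → 1ℤ * (a + b) ≡ b + 1ℤ * a
  lem = solve-∀
es-hook (suc m) L (n ∷ γ) = begin
  pos (suc (suc m)) * (A + B)                ≡⟨ lem (pos (suc m)) A B ⟩
  B + (pos (suc (suc m)) * A + pos (suc m) * B)
    ≡⟨ cong (λ z → B + z) (cong₂ _+_ (es-hook (suc m) (L ∘ (n ∷_)) γ) (es-hook m (L ∘ (suc n ∷_)) γ)) ⟩
  hook (suc m) 1 L (n ∷ γ)                   ∎
  where
  A = es (suc (suc m)) (L ∘ (n ∷_)) γ
  B = es (suc m) (L ∘ (suc n ∷_)) γ
  lem : ∀ m a b → (1ℤ + m) * (a + b) ≡ b + ((1ℤ + m) * a + m * b)
  lem = solve-∀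

es-ps-comm : ∀ m i (L : Func K) γ → es m (ps i L) γ ≡ ps i (es m L) γ
es-ps-comm zero    i L γ  = refl
es-ps-comm (suc m) i L [] = refl
es-ps-comm (suc m) i L (n ∷ γ) = begin
  es (suc m) (ps i L ∘ (n ∷_)) γ + es m (ps i L ∘ (suc n ∷_)) γ
    ≡⟨ cong₂ _+_
        (trans (es-+ (suc m) (L ∘ ((i ℕ.+ n) ∷_)) (ps i (L ∘ (n ∷_))) γ) (cong (λ z → A + z) (es-ps-comm (suc m) i (L ∘ (n ∷_)) γ)))
        (trans (es-+ m (L ∘ ((i ℕ.+ suc n) ∷_)) (ps i (L ∘ (suc n ∷_))) γ) (cong (λ z → es m (L ∘ ((i ℕ.+ suc n) ∷_)) γ + z) (es-ps-comm m i (L ∘ (suc n ∷_)) γ))) ⟩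
  A + B + (es m (L ∘ ((i ℕ.+ suc n) ∷_)) γ + C)
    ≡⟨ cong (λ x → A + B + (es m (L ∘ (x ∷_)) γ + C)) (ℕₚ.+-suc i n) ⟩
  A + B + (es m (L ∘ (suc (i ℕ.+ n) ∷_)) γ + C)
    ≡⟨ interchange A B _ C ⟩
  A + es m (L ∘ (suc (i ℕ.+ n) ∷_)) γ + (B + C)
    ≡⟨ cong (λ z → A + es m (L ∘ (suc (i ℕ.+ n) ∷_)) γ + z)
        (∑-distrib-+ (λ c → es (suc m) (L ∘ (n ∷_)) (add i c γ)) (λ c → es m (L ∘ (suc n ∷_)) (add i c γ))) ⟨
  ps i (es (suc m) L) (n ∷ γ) ∎
  where
  A = es (suc m) (L ∘ ((i ℕ.+ n) ∷_)) γ
  B = ps i (es (suc m) (L ∘ (n ∷_))) γ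
  C = ps i (es m (L ∘ (suc n ∷_))) γ

Kill-es : ∀ {a} {L : Func K} → Kill a L → ∀ m → Kill a (es m L)
Kill-es {L = L} k m i p q γ = trans (sym (es-ps-comm m i L γ)) (es-zero m (k i p q) γ)

hook-step : ∀ m i (L : Func K) γ → es (suc m) (ps i L) γ ≡ 0ℤ → hook (suc m) i L γ ≡ - hook m (suc i) L γ
hook-step m i L γ e = begin
  hook (suc m) i L γ                                            ≡⟨ lem (hook (suc m) i L γ) (hook m (suc i) L γ) ⟩
  hook (suc m) i L γ + hook m (suc i) L γ - hook m (suc i) L γ  ≡⟨ cong (λ z → z - hook m (suc i) L γ) (trans (sym (es-ps m i L γ)) e) ⟩
  0ℤ - hook m (suc i) L γ                                       ≡⟨ ℤₚ.+-identityˡ _ ⟩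
  - hook m (suc i) L γ                                          ∎
  where
  lem : ∀ x y → x ≡ x + y - y
  lem = solve-∀

-- Newton's identity with its product terms discarded: `hook-step` trades one of the m ones for a
-- unit of i until only a power sum is left. The hypothesis asks just for the vanishing of the
-- products e_(m′+1) p_(i′) met on the way, all of the same degree, so that the callers may kill
-- either factor.
hook-chain : ∀ m i (L : Func K) γ →
             (∀ m′ i′ → m′ < m → i ≤ i′ → suc m′ ℕ.+ i′ ≡ m ℕ.+ i → es (suc m′) (ps i′ L) γ ≡ 0ℤ) →
             hook m i L γ ≡ sgn m * ps (m ℕ.+ i) L γ
hook-chain zero i L γ h = trans (hook-zero i L γ) (sym (ℤₚ.*-identityˡ _))
hook-chain (suc m) i L γ h = begin
  hook (suc m) i L γ               ≡⟨ hook-step m i L γ (h m i ℕₚ.≤-refl ℕₚ.≤-refl refl) ⟩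
  - hook m (suc i) L γ             ≡⟨ cong -_ (hook-chain m (suc i) L γ λ m′ i′ p q r →
                                       h m′ i′ (ℕₚ.m<n⇒m<1+n p) (ℕₚ.<⇒≤ q) (trans r (ℕₚ.+-suc m i))) ⟩
  - (sgn m * ps (m ℕ.+ suc i) L γ) ≡⟨ cong (λ z → - (sgn m * ps z L γ)) (ℕₚ.+-suc m i) ⟩
  - (sgn m * ps (suc m ℕ.+ i) L γ) ≡⟨ ℤₚ.neg-distribˡ-* (sgn m) _ ⟩
  sgn (suc m) * ps (suc m ℕ.+ i) L γ ∎

*-cancel-zero : ∀ m {x} → pos (suc m) * x ≡ 0ℤ → x ≡ 0ℤ
*-cancel-zero m {x} e = ℤₚ.*-cancelˡ-≡ (pos (suc m)) x 0ℤ (trans e (sym (ℤₚ.*-zeroʳ (pos (suc m)))))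

es-kill : ∀ {a} {L : Func K} → Kill a L → ∀ m → suc m < a → ∀ γ → es (suc m) L γ ≡ 0ℤ
es-kill {a = a} {L} k m m<a γ = *-cancel-zero m (begin
  pos (suc m) * es (suc m) L γ ≡⟨ es-hook m L γ ⟩
  hook m 1 L γ                 ≡⟨ hook-chain m 1 L γ (λ m′ i′ p q r → es-zero (suc m′)
                                    (k i′ q (ℕₚ.≤-<-trans (subst (i′ ≤_) (trans r (ℕₚ.+-comm m 1)) (ℕₚ.m≤n+m i′ (suc m′))) m<a)) γ) ⟩
  sgn m * ps (m ℕ.+ 1) L γ     ≡⟨ cong (λ z → sgn m * z) (k (m ℕ.+ 1) (ℕₚ.m≤n+m 1 m) (subst (_< a) (ℕₚ.+-comm 1 m) m<a) γ) ⟩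
  sgn m * 0ℤ                   ≡⟨ ℤₚ.*-zeroʳ (sgn m) ⟩
  0ℤ                           ∎)

-- If p_i is not killed then i ≥ a, and the degree bound leaves only e₁ = p₁ as the other factor;
-- this one is killed because 2 ≤ a.
es-ps-kill : ∀ {a} {L : Func K} → 2 ≤ a → Kill a L → ∀ m i → 1 ≤ i → suc m ℕ.+ i ≤ suc a →
             ∀ γ → es (suc m) (ps i L) γ ≡ 0ℤ
es-ps-kill {a = a} {L} 2≤a k m i 1≤i le γ with i ℕ.<? a
... | yes i<a = es-zero (suc m) (k i 1≤i i<a) γ
... | no  i≮a = es-kill (Kill-ps {L = L} k i) m (ℕₚ.≤-trans (s≤s m<1) 2≤a) γ
  where
  m<1 : suc m ≤ 1
  m<1 = ℕₚ.+-cancelʳ-≤ a (suc m) 1 (ℕₚ.≤-trans (ℕₚ.+-monoʳ-≤ (suc m) (ℕₚ.≮⇒≥ i≮a)) le)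

-- The range goes one degree beyond a, which is what the factor e_(a+1) requires when b = a + 1.
es-power : ∀ {a} {L : Func K} → 2 ≤ a → Kill a L → ∀ b → b ≤ a →
           ∀ γ → pos (suc b) * es (suc b) L γ ≡ sgn b * ps (suc b) L γ
es-power {a = a} {L} 2≤a k b b≤a γ = begin
  pos (suc b) * es (suc b) L γ  ≡⟨ es-hook b L γ ⟩
  hook b 1 L γ                  ≡⟨ hook-chain b 1 L γ (λ m i _ 1≤i e → es-ps-kill {L = L} 2≤a k m i 1≤i
                                     (subst (_≤ suc a) (sym (trans e (ℕₚ.+-comm b 1))) (s≤s b≤a)) γ) ⟩
  sgn b * ps (b ℕ.+ 1) L γ      ≡⟨ cong (λ z → sgn b * ps z L γ) (ℕₚ.+-comm b 1) ⟩
  sgn b * ps (suc b) L γ        ∎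

-- Pairing a functional with a coefficient function

box : ∀ K → ℕ → Func K → ℤ
box zero    B f = f []
box (suc K) B f = ∑ {B} λ n → box K B (f ∘ (toℕ n ∷_))

box-cong : ∀ B {f g : Func K} → (∀ α → f α ≡ g α) → box K B f ≡ box K B g
box-cong {zero}  B e = e []
box-cong {suc K} B e = sum-cong-≗ {B} λ n → box-cong B (e ∘ (toℕ n ∷_))

box-zero : ∀ B {f : Func K} → (∀ α → f α ≡ 0ℤ) → box K B f ≡ 0ℤ
box-zero {zero}  B e = e []
box-zero {suc K} B e = ∑-zero {B} _ λ n → box-zero B (e ∘ (toℕ n ∷_))

box-+ : ∀ B (f g : Func K) → box K B (λ α → f α + g α) ≡ box K B f + box K B g
box-+ {zero}  B f g = refl
box-+ {suc K} B f g = trans (sum-cong-≗ {B} λ n → box-+ B (f ∘ (toℕ n ∷_)) (g ∘ (toℕ n ∷_)))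
  (∑-distrib-+ {B} (λ n → box K B (f ∘ (toℕ n ∷_))) (λ n → box K B (g ∘ (toℕ n ∷_))))

box-* : ∀ B x (f : Func K) → box K B (λ α → x * f α) ≡ x * box K B f
box-* {zero}  B x f = refl
box-* {suc K} B x f = trans (sum-cong-≗ {B} λ n → box-* B x (f ∘ (toℕ n ∷_)))
  (sym (*-distribˡ-sum {B} x (λ n → box K B (f ∘ (toℕ n ∷_)))))

-- Multiplication by e_m on coefficient functions. The `+ 0ℤ` mirrors the empty list that `choices`
-- appends when the exponent is zero.
emul : ℕ → (List ℕ → ℤ) → List ℕ → ℤ
emul zero    F α             = F α
emul (suc m) F []            = 0ℤ
emul (suc m) F (zero  ∷ α) = emul (suc m) (F ∘ (0 ∷_)) α + 0ℤ
emul (suc m) F (suc n ∷ α) = emul (suc m) (F ∘ (suc n ∷_)) α + emul m (F ∘ (n ∷_)) α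

sumℕ-++ : ∀ xs ys → sumℕ (xs ++ ys) ≡ sumℕ xs ℕ.+ sumℕ ys
sumℕ-++ []       ys = refl
sumℕ-++ (x ∷ xs) ys = trans (cong (x ℕ.+_) (sumℕ-++ xs ys)) (sym (ℕₚ.+-assoc x _ _))

sumℕ-choices : ∀ m (F : List ℕ → ℕ) α → pos (sumℕ (map F (choices m α))) ≡ emul m (pos ∘ F) α
sumℕ-choices zero    F α  = cong pos (ℕₚ.+-identityʳ (F α))
sumℕ-choices (suc m) F [] = refl
sumℕ-choices (suc m) F (zero ∷ α) = begin
  pos (sumℕ (map F (map (0 ∷_) (choices (suc m) α) ++ [])))
    ≡⟨ cong (pos ∘ sumℕ) (map-++ F (map (0 ∷_) (choices (suc m) α)) []) ⟩
  pos (sumℕ (map F (map (0 ∷_) (choices (suc m) α)) ++ []))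
    ≡⟨ cong pos (sumℕ-++ (map F (map (0 ∷_) (choices (suc m) α))) []) ⟩
  pos (sumℕ (map F (map (0 ∷_) (choices (suc m) α)))) + 0ℤ
    ≡⟨ cong (λ z → pos (sumℕ z) + 0ℤ) (sym (map-∘ (choices (suc m) α))) ⟩
  pos (sumℕ (map (F ∘ (0 ∷_)) (choices (suc m) α))) + 0ℤ
    ≡⟨ cong (λ z → z + 0ℤ) (sumℕ-choices (suc m) (F ∘ (0 ∷_)) α) ⟩
  emul (suc m) (pos ∘ F) (0 ∷ α) ∎
sumℕ-choices (suc m) F (suc n ∷ α) = begin
  pos (sumℕ (map F (map (suc n ∷_) (choices (suc m) α) ++ map (n ∷_) (choices m α))))
    ≡⟨ cong (pos ∘ sumℕ) (map-++ F (map (suc n ∷_) (choices (suc m) α)) (map (n ∷_) (choices m α))) ⟩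
  pos (sumℕ (map F (map (suc n ∷_) (choices (suc m) α)) ++ map F (map (n ∷_) (choices m α))))
    ≡⟨ cong pos (sumℕ-++ (map F (map (suc n ∷_) (choices (suc m) α))) _) ⟩
  pos (sumℕ (map F (map (suc n ∷_) (choices (suc m) α)))) + pos (sumℕ (map F (map (n ∷_) (choices m α))))
    ≡⟨ cong₂ (λ y z → pos (sumℕ y) + pos (sumℕ z)) (sym (map-∘ (choices (suc m) α))) (sym (map-∘ (choices m α))) ⟩
  pos (sumℕ (map (F ∘ (suc n ∷_)) (choices (suc m) α))) + pos (sumℕ (map (F ∘ (n ∷_)) (choices m α)))
    ≡⟨ cong₂ _+_ (sumℕ-choices (suc m) (F ∘ (suc n ∷_)) α) (sumℕ-choices m (F ∘ (n ∷_)) α) ⟩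
  emul (suc m) (pos ∘ F) (suc n ∷ α) ∎

∑-telescope : ∀ B (g h : ℕ → ℤ) → (∀ n → g (suc n) ≡ h n) →
              ∑ {B} (g ∘ toℕ) + g B ≡ g 0 + ∑ {B} (h ∘ toℕ)
∑-telescope zero    g h e = trans (ℤₚ.+-identityˡ (g 0)) (sym (ℤₚ.+-identityʳ (g 0)))
∑-telescope (suc B) g h e = begin
  g 0 + ∑ {B} (g ∘ suc ∘ toℕ) + g (suc B)    ≡⟨ ℤₚ.+-assoc (g 0) _ _ ⟩
  g 0 + (∑ {B} (g ∘ suc ∘ toℕ) + g (suc B))  ≡⟨ cong (λ z → g 0 + z) (∑-telescope B (g ∘ suc) (h ∘ suc) (e ∘ suc)) ⟩
  g 0 + (g 1 + ∑ {B} (h ∘ suc ∘ toℕ))        ≡⟨ cong (λ z → g 0 + (z + ∑ {B} (h ∘ suc ∘ toℕ))) (e 0) ⟩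
  g 0 + ∑ {suc B} (h ∘ toℕ)                  ∎

-- This makes the truncation to exponents below B harmless: an exponent that multiplication by e_m
-- raises to B lands where L vanishes.
Low : ℕ → Func K → Set
Low B L = ∀ γ → B ≤ Vec.sum γ → L γ ≡ 0ℤ

pair : ∀ {K} → ℕ → Func K → (List ℕ → ℤ) → ℤ
pair {K} B L F = box K B λ α → L α * F (toList α)

-- `es m` is the transpose of `emul m`. Split off the first variable: the terms that do not use it
-- match directly, and those that do match after a shift of its exponent by one.
pair-emul : ∀ B m (L : Func K) F → Low B L → pair B L (emul m F) ≡ pair B (es m L) F
pair-emul B zero L F low = refl
pair-emul {zero} B (suc m) L F low = ℤₚ.*-zeroʳ (L [])
pair-emul {suc K} B (suc m) L F low = begin
  pair B L (emul (suc m) F)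
    ≡⟨ sum-cong-≗ {B} (λ n → trans (box-cong B (split (toℕ n))) (box-+ B (λ α → L (toℕ n ∷ α) * emul (suc m) (F ∘ (toℕ n ∷_)) (toList α)) (rest (toℕ n)))) ⟩
  ∑ {B} (λ n → pair B (L ∘ (toℕ n ∷_)) (emul (suc m) (F ∘ (toℕ n ∷_))) + box K B (rest (toℕ n)))
    ≡⟨ ∑-distrib-+ {B} (λ n → pair B (L ∘ (toℕ n ∷_)) (emul (suc m) (F ∘ (toℕ n ∷_)))) (λ n → box K B (rest (toℕ n))) ⟩
  ∑ {B} (λ n → pair B (L ∘ (toℕ n ∷_)) (emul (suc m) (F ∘ (toℕ n ∷_)))) + ∑ {B} (λ n → box K B (rest (toℕ n)))
    ≡⟨ cong₂ _+_ (sum-cong-≗ {B} λ n → pair-emul B (suc m) (L ∘ (toℕ n ∷_)) (F ∘ (toℕ n ∷_)) (low-tail (toℕ n))) shift ⟩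
  ∑ {B} (λ n → pair B (es (suc m) (L ∘ (toℕ n ∷_))) (F ∘ (toℕ n ∷_))) + ∑ {B} (λ n → pair B (es m (L ∘ (suc (toℕ n) ∷_))) (F ∘ (toℕ n ∷_)))
    ≡⟨ ∑-distrib-+ {B} (λ n → pair B (es (suc m) (L ∘ (toℕ n ∷_))) (F ∘ (toℕ n ∷_))) (λ n → pair B (es m (L ∘ (suc (toℕ n) ∷_))) (F ∘ (toℕ n ∷_))) ⟨
  ∑ {B} (λ n → pair B (es (suc m) (L ∘ (toℕ n ∷_))) (F ∘ (toℕ n ∷_)) + pair B (es m (L ∘ (suc (toℕ n) ∷_))) (F ∘ (toℕ n ∷_)))
    ≡⟨ sum-cong-≗ {B} (λ n → trans
         (sym (box-+ B (λ α → es (suc m) (L ∘ (toℕ n ∷_)) α * F (toℕ n ∷ toList α)) (λ α → es m (L ∘ (suc (toℕ n) ∷_)) α * F (toℕ n ∷ toList α))))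
         (box-cong B λ α → sym (ℤₚ.*-distribʳ-+ (F (toℕ n ∷ toList α)) (es (suc m) (L ∘ (toℕ n ∷_)) α) (es m (L ∘ (suc (toℕ n) ∷_)) α)))) ⟩
  pair B (es (suc m) L) F ∎
  where
  rest : ℕ → Func K
  rest zero    α = 0ℤ
  rest (suc n) α = L (suc n ∷ α) * emul m (F ∘ (n ∷_)) (toList α)

  split : ∀ n α → L (n ∷ α) * emul (suc m) F (n ∷ toList α) ≡ L (n ∷ α) * emul (suc m) (F ∘ (n ∷_)) (toList α) + rest n α
  split zero    α = trans (ℤₚ.*-distribˡ-+ (L (0 ∷ α)) (emul (suc m) (F ∘ (0 ∷_)) (toList α)) 0ℤ)
    (cong (λ z → L (0 ∷ α) * emul (suc m) (F ∘ (0 ∷_)) (toList α) + z) (ℤₚ.*-zeroʳ (L (0 ∷ α))))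
  split (suc n) α = ℤₚ.*-distribˡ-+ (L (suc n ∷ α)) (emul (suc m) (F ∘ (suc n ∷_)) (toList α)) _

  low-tail : ∀ n → Low B (L ∘ (n ∷_))
  low-tail n γ p = low (n ∷ γ) (ℕₚ.≤-trans p (ℕₚ.m≤n+m _ n))

  rest-B : ∀ n → B ≤ n → box K B (rest n) ≡ 0ℤ
  rest-B zero    p = box-zero {K} B {rest 0} λ _ → refl
  rest-B (suc n) p = box-zero B λ α →
    trans (cong (λ z → z * emul m (F ∘ (n ∷_)) (toList α)) (low (suc n ∷ α) (ℕₚ.≤-trans p (ℕₚ.m≤m+n (suc n) _))))
          (ℤₚ.*-zeroˡ (emul m (F ∘ (n ∷_)) (toList α)))

  shift : ∑ {B} (λ n → box K B (rest (toℕ n))) ≡ ∑ {B} (λ n → pair B (es m (L ∘ (suc (toℕ n) ∷_))) (F ∘ (toℕ n ∷_)))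
  shift = begin
    ∑ {B} (λ n → box K B (rest (toℕ n)))
      ≡⟨ ℤₚ.+-identityʳ _ ⟨
    ∑ {B} (λ n → box K B (rest (toℕ n))) + 0ℤ
      ≡⟨ cong (λ z → ∑ {B} (λ n → box K B (rest (toℕ n))) + z) (rest-B B ℕₚ.≤-refl) ⟨
    ∑ {B} (λ n → box K B (rest (toℕ n))) + box K B (rest B)
      -- The shift leaves two boundary terms. At n = B the functional vanishes by its degree bound,
      -- and at n = 0 there is no factor x₁ to remove, so `rest 0` is zero.
      ≡⟨ ∑-telescope B (λ n → box K B (rest n)) (λ n → pair B (es m (L ∘ (suc n ∷_))) (F ∘ (n ∷_)))
           (λ n → pair-emul B m (L ∘ (suc n ∷_)) (F ∘ (n ∷_)) (low-tail (suc n))) ⟩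
    box K B (rest 0) + ∑ {B} (λ n → pair B (es m (L ∘ (suc (toℕ n) ∷_))) (F ∘ (toℕ n ∷_)))
      ≡⟨ cong (λ z → z + ∑ {B} (λ n → pair B (es m (L ∘ (suc (toℕ n) ∷_))) (F ∘ (toℕ n ∷_)))) (box-zero B {rest 0} λ _ → refl) ⟩
    0ℤ + ∑ {B} (λ n → pair B (es m (L ∘ (suc (toℕ n) ∷_))) (F ∘ (toℕ n ∷_)))
      ≡⟨ ℤₚ.+-identityˡ _ ⟩
    ∑ {B} (λ n → pair B (es m (L ∘ (suc (toℕ n) ∷_))) (F ∘ (toℕ n ∷_))) ∎

Supp : ℕ → Func K → Set
Supp d L = ∀ γ → Vec.sum γ ≢ d → L γ ≡ 0ℤ

-- `s` is the degree carried by the variables that the recursion has already stripped off.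
es-vanish : ∀ m s d (L : Func K) → (∀ γ → s ℕ.+ Vec.sum γ ≢ d → L γ ≡ 0ℤ) →
            ∀ γ → s ℕ.+ (m ℕ.+ Vec.sum γ) ≢ d → es m L γ ≡ 0ℤ
es-vanish zero    s d L h γ       p = h γ p
es-vanish (suc m) s d L h []      p = refl
es-vanish (suc m) s d L h (n ∷ γ) p = cong₂ _+_
  (es-vanish (suc m) (s ℕ.+ n) d (L ∘ (n ∷_)) (λ δ q → h (n ∷ δ) (q ∘ trans (ℕₚ.+-assoc s n _))) γ
    (p ∘ trans (lem₁ s (suc m) n (Vec.sum γ))))
  (es-vanish m (s ℕ.+ suc n) d (L ∘ (suc n ∷_)) (λ δ q → h (suc n ∷ δ) (q ∘ trans (ℕₚ.+-assoc s (suc n) _))) γ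
    (p ∘ trans (lem₂ s m n (Vec.sum γ))))
  where
  lem₁ : ∀ s m n t → s ℕ.+ (m ℕ.+ (n ℕ.+ t)) ≡ s ℕ.+ n ℕ.+ (m ℕ.+ t)
  lem₁ = ℕ-solve-∀
  lem₂ : ∀ s m n t → s ℕ.+ (suc m ℕ.+ (n ℕ.+ t)) ≡ s ℕ.+ suc n ℕ.+ (m ℕ.+ t)
  lem₂ = ℕ-solve-∀

es-low : ∀ B m (L : Func K) → Low B L → Low B (es m L)
es-low B zero    L low γ       p = low γ p
es-low B (suc m) L low []      p = refl
es-low B (suc m) L low (n ∷ γ) p = cong₂ _+_
  (go (suc m) n γ p) (go m (suc n) γ (ℕₚ.m≤n⇒m≤1+n p))
  where
  -- Only degrees matter: shift the bound by the fixed first exponent.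
  go : ∀ k n γ → B ≤ n ℕ.+ Vec.sum γ → es k (L ∘ (n ∷_)) γ ≡ 0ℤ
  go k n γ p = es-low (B ℕ.∸ n) k (L ∘ (n ∷_)) (λ δ q → low (n ∷ δ) (ℕₚ.≤-trans (ℕₚ.m≤n+m∸n B n) (ℕₚ.+-monoʳ-≤ n q))) γ
    (ℕₚ.m≤n+o⇒m∸n≤o B n p)

esAll : List ℕ → Func K → Func K
esAll []      L = L
esAll (m ∷ μ) L = esAll μ (es m L)

zeros : ∀ {K} → Vec ℕ K
zeros = Vec.replicate _ 0

pair-one : ∀ B (L : Func K) → pair (suc B) L (λ α → pos (coefE [] α)) ≡ L zeros
pair-one {zero}  B L = ℤₚ.*-identityʳ (L [])
pair-one {suc K} B L = trans
  (cong₂ _+_ (pair-one B (L ∘ (0 ∷_))) (∑-zero {B} _ λ n → box-zero (suc B) λ α → ℤₚ.*-zeroʳ (L (suc (toℕ n) ∷ α))))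
  (ℤₚ.+-identityʳ (L zeros))

pair-coefE : ∀ B μ (L : Func K) → Low (suc B) L → pair (suc B) L (pos ∘ coefE μ) ≡ esAll μ L zeros
pair-coefE B []      L low = pair-one B L
pair-coefE B (m ∷ μ) L low = begin
  pair (suc B) L (pos ∘ coefE (m ∷ μ))          ≡⟨ box-cong (suc B) (λ α → cong (λ z → L α * z) (sumℕ-choices m (coefE μ) (toList α))) ⟩
  pair (suc B) L (emul m (pos ∘ coefE μ))       ≡⟨ pair-emul (suc B) m L (pos ∘ coefE μ) low ⟩
  pair (suc B) (es m L) (pos ∘ coefE μ)         ≡⟨ pair-coefE B μ (es m L) (es-low (suc B) m L low) ⟩
  esAll (m ∷ μ) L zeros                         ∎

-- Signs of the functional on products of elementary symmetric functions

sgn-+ : ∀ m n → sgn (m ℕ.+ n) ≡ sgn m * sgn n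
sgn-+ zero    n = sym (ℤₚ.*-identityˡ (sgn n))
sgn-+ (suc m) n = trans (cong -_ (sgn-+ m n)) (ℤₚ.neg-distribˡ-* (sgn m) (sgn n))

sgn-square : ∀ n → sgn n * sgn n ≡ 1ℤ
sgn-square zero    = refl
sgn-square (suc n) = trans (lem (sgn n)) (sgn-square n)
  where
  lem : ∀ s → - s * - s ≡ s * s
  lem = solve-∀

sum-zeros : ∀ K → Vec.sum (zeros {K}) ≡ 0
sum-zeros zero    = refl
sum-zeros (suc K) = sum-zeros K

esAll-zero : ∀ μ {L : Func K} → (∀ γ → L γ ≡ 0ℤ) → ∀ γ → esAll μ L γ ≡ 0ℤ
esAll-zero []      e = e
esAll-zero (m ∷ μ) e = esAll-zero μ (es-zero m e)

esAll-vanish : ∀ μ s d (L : Func K) → (∀ γ → s ℕ.+ Vec.sum γ ≢ d → L γ ≡ 0ℤ) →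
               s ℕ.+ sumℕ μ ≢ d → esAll μ L zeros ≡ 0ℤ
esAll-vanish {K} [] s d L h p = h zeros (p ∘ trans (cong (s ℕ.+_) (sym (sum-zeros K))))
esAll-vanish (m ∷ μ) s d L h p = esAll-vanish μ (s ℕ.+ m) d (es m L)
  (λ γ q → es-vanish m s d L h γ (q ∘ trans (ℕₚ.+-assoc s m _)))
  (p ∘ trans (sym (ℕₚ.+-assoc s m (sumℕ μ))))

es-killed : ∀ {a} {L : Func K} → Kill a L → ∀ m → 1 ≤ m → m < a → ∀ γ → es m L γ ≡ 0ℤ
es-killed k (suc m) _ p = es-kill k m p

-- A chain stopped early: as long as the marked exponent is below a, the discarded product contains
-- a killed power sum, whatever its elementary factor is.
hook-descend : ∀ {a} {L : Func K} → Kill a L → ∀ j m i γ → 1 ≤ i → j ℕ.+ i ≤ a →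
               hook (j ℕ.+ m) i L γ ≡ sgn j * hook m (j ℕ.+ i) L γ
hook-descend k zero m i γ _ _ = sym (ℤₚ.*-identityˡ _)
hook-descend {a = a} {L} k (suc j) m i γ 1≤i le = begin
  hook (suc (j ℕ.+ m)) i L γ          ≡⟨ hook-step (j ℕ.+ m) i L γ
                                           (es-zero (suc (j ℕ.+ m)) (k i 1≤i (ℕₚ.≤-trans (s≤s (ℕₚ.m≤n+m i j)) le)) γ) ⟩
  - hook (j ℕ.+ m) (suc i) L γ        ≡⟨ cong -_ (hook-descend k j m (suc i) γ (s≤s z≤n) (subst (_≤ a) (sym (ℕₚ.+-suc j i)) le)) ⟩
  - (sgn j * hook m (j ℕ.+ suc i) L γ) ≡⟨ cong (λ z → - (sgn j * hook m z L γ)) (ℕₚ.+-suc j i) ⟩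
  - (sgn j * hook m (suc j ℕ.+ i) L γ) ≡⟨ ℤₚ.neg-distribˡ-* (sgn j) _ ⟩
  sgn (suc j) * hook m (suc j ℕ.+ i) L γ ∎

-- Here the elementary factors, of degree at most a, are the killed ones, so the marked exponent i
-- may be arbitrary.
hook-small : ∀ {a} {L : Func K} → Kill (suc a) L → ∀ i γ → hook a i L γ ≡ sgn a * ps (a ℕ.+ i) L γ
hook-small {a = a} {L} k i γ = hook-chain a i L γ λ m i′ m<a _ _ → es-kill (Kill-ps {L = L} k i′) m (s≤s m<a) γ

-- In this module `suc a` is the parameter a of the graph.
module _ (a : ℕ) (1≤a : 1 ≤ a) (L : Func K) (kill : Kill (suc a) L) where

  private
    2≤ : 2 ≤ suc a
    2≤ = s≤s 1≤a

  hook-top : ∀ b → pos (suc a ℕ.+ b) * es (suc a ℕ.+ b) L zeros ≡ sgn a * hook b (suc a) L zeros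
  hook-top b = begin
    pos (suc a ℕ.+ b) * es (suc a ℕ.+ b) L zeros  ≡⟨ es-hook (a ℕ.+ b) L zeros ⟩
    hook (a ℕ.+ b) 1 L zeros                      ≡⟨ hook-descend kill a b 1 zeros (s≤s z≤n) (ℕₚ.≤-reflexive (ℕₚ.+-comm a 1)) ⟩
    sgn a * hook b (a ℕ.+ 1) L zeros              ≡⟨ cong (λ z → sgn a * hook b z L zeros) (ℕₚ.+-comm a 1) ⟩
    sgn a * hook b (suc a) L zeros                ∎

  es-es : ∀ b → b ≤ suc a → pos (suc a) * pos (suc b) * es (suc a) (es (suc b) L) zeros
                          ≡ sgn a * sgn b * ps (suc a) (ps (suc b) L) zeros
  es-es b b≤ = begin
    A * B * es (suc a) (es (suc b) L) zeros         ≡⟨ lem₁ A B _ ⟩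
    B * (A * es (suc a) (es (suc b) L) zeros)       ≡⟨ cong (λ z → B * z) (es-power 2≤ (Kill-es kill (suc b)) a (ℕₚ.n≤1+n a) zeros) ⟩
    B * (sgn a * ps (suc a) (es (suc b) L) zeros)   ≡⟨ cong (λ z → B * (sgn a * z)) (sym (es-ps-comm (suc b) (suc a) L zeros)) ⟩
    B * (sgn a * es (suc b) (ps (suc a) L) zeros)   ≡⟨ lem₂ B (sgn a) _ ⟩
    sgn a * (B * es (suc b) (ps (suc a) L) zeros)   ≡⟨ cong (λ z → sgn a * z) (es-power 2≤ (Kill-ps {L = L} kill (suc a)) b b≤ zeros) ⟩
    sgn a * (sgn b * ps (suc b) (ps (suc a) L) zeros) ≡⟨ cong (λ z → sgn a * (sgn b * z)) (ps-comm (suc b) (suc a) L zeros) ⟩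
    sgn a * (sgn b * ps (suc a) (ps (suc b) L) zeros) ≡⟨ ℤₚ.*-assoc (sgn a) (sgn b) _ ⟨
    sgn a * sgn b * ps (suc a) (ps (suc b) L) zeros ∎
    where
    A = pos (suc a)
    B = pos (suc b)
    lem₁ : ∀ a b c → a * b * c ≡ b * (a * c)
    lem₁ = solve-∀
    lem₂ : ∀ a b c → a * (b * c) ≡ b * (a * c)
    lem₂ = solve-∀

  -- With A = `suc a`, expand e_A p_A into the hook of `hook-top` and one that `hook-small`
  -- evaluates. The result is deg · A · L(e_(2A)) = L(p_A p_A) - A L(p_(2A)), which is where the
  -- hypothesis comes from.
  es-top-even : ps (suc a) (ps (suc a) L) zeros ≡ pos (suc a) * ps (suc a ℕ.+ suc a) L zeros →
                es (suc a ℕ.+ suc a) L zeros ≡ 0ℤ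
  es-top-even rel = *-cancel-zero a (*-cancel-zero (a ℕ.+ suc a) (begin
    deg * (A * es (suc a ℕ.+ suc a) L zeros)      ≡⟨ lem₁ deg A _ ⟩
    A * (deg * es (suc a ℕ.+ suc a) L zeros)      ≡⟨ cong (λ z → A * z) (hook-top (suc a)) ⟩
    A * (s * hook (suc a) (suc a) L zeros)      ≡⟨ lem₂ A s (hook (suc a) (suc a) L zeros) (hook a (suc (suc a)) L zeros) ⟩
    s * (A * (hook (suc a) (suc a) L zeros + hook a (suc (suc a)) L zeros) - A * hook a (suc (suc a)) L zeros)
      ≡⟨ cong₂ (λ u v → s * (A * u - A * v)) (sym (es-ps a (suc a) L zeros))
               (trans (hook-small kill (suc (suc a)) zeros) (cong (λ z → s * ps z L zeros) (ℕₚ.+-suc a (suc a)))) ⟩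
    s * (A * es (suc a) (ps (suc a) L) zeros - A * (s * X))
      ≡⟨ cong (λ z → s * (z - A * (s * X))) (trans (es-power 2≤ (Kill-ps {L = L} kill (suc a)) a (ℕₚ.n≤1+n a) zeros) (cong (λ z → s * z) rel)) ⟩
    s * (s * (A * X) - A * (s * X))             ≡⟨ lem₃ s A X ⟩
    0ℤ                                          ∎))
    where
    A = pos (suc a)
    deg = pos (suc a ℕ.+ suc a)
    X = ps (suc a ℕ.+ suc a) L zeros
    s = sgn a
    lem₁ : ∀ a b c → a * (b * c) ≡ b * (a * c)
    lem₁ = solve-∀
    lem₂ : ∀ a s h k → a * (s * h) ≡ s * (a * (h + k) - a * k)
    lem₂ = solve-∀
    lem₃ : ∀ s a x → s * (s * (a * x) - a * (s * x)) ≡ 0ℤ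
    lem₃ = solve-∀

  -- With A = `suc a` and B = A + 1, the expansions of e_B p_A and e_A p_B share the hook `H₂`,
  -- which is eliminated between them. What remains is deg · A · B · L(e_deg) = A B L(p_deg) - deg
  -- L(p_A p_B).
  es-top-odd : pos (suc a) * pos (suc (suc a)) * ps (suc a ℕ.+ suc (suc a)) L zeros
                 ≡ pos (suc a ℕ.+ suc (suc a)) * ps (suc a) (ps (suc (suc a)) L) zeros →
               es (suc a ℕ.+ suc (suc a)) L zeros ≡ 0ℤ
  es-top-odd rel = *-cancel-zero a (*-cancel-zero (suc a) (*-cancel-zero (a ℕ.+ suc (suc a)) (begin
    deg * (B * (A * es (suc a ℕ.+ suc (suc a)) L zeros)) ≡⟨ lem₁ deg A B _ ⟩
    A * B * (deg * es (suc a ℕ.+ suc (suc a)) L zeros)   ≡⟨ cong (λ z → A * B * z) (hook-top (suc (suc a))) ⟩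
    A * B * (s * H₁)                                   ≡⟨ lem₂ A B s H₁ H₂ H₃ ⟩
    -- `H₁` is rewritten as (`H₁` + `H₂`) - (`H₂` + `H₃`) + `H₃`, whose three pieces are all known.
    s * (A * (B * (H₁ + H₂)) - B * (A * (H₂ + H₃)) + A * B * H₃)
      ≡⟨ cong₂ (λ u v → s * (A * (B * u) - B * (A * v) + A * B * H₃)) (sym (es-ps (suc a) (suc a) L zeros)) (sym (es-ps a (suc (suc a)) L zeros)) ⟩
    s * (A * (B * es (suc (suc a)) (ps (suc a) L) zeros) - B * (A * es (suc a) (ps (suc (suc a)) L) zeros) + A * B * H₃)
      ≡⟨ cong₂ (λ u v → s * (A * u - B * v + A * B * H₃))
           (trans (es-power 2≤ (Kill-ps {L = L} kill (suc a)) (suc a) ℕₚ.≤-refl zeros) (cong (λ z → - s * z) (ps-comm (suc (suc a)) (suc a) L zeros)))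
           (es-power 2≤ (Kill-ps {L = L} kill (suc (suc a))) a (ℕₚ.n≤1+n a) zeros) ⟩
    s * (A * (- s * Y) - B * (s * Y) + A * B * H₃)
      ≡⟨ cong (λ z → s * (A * (- s * Y) - B * (s * Y) + A * B * z))
           (trans (hook-small kill (suc (suc (suc a))) zeros) (cong (λ z → s * ps z L zeros) (ℕₚ.+-suc a (suc (suc a))))) ⟩
    s * (A * (- s * Y) - B * (s * Y) + A * B * (s * X)) ≡⟨ lem₃ s A B Y X ⟩
    s * s * (A * B * X - (A + B) * Y)                  ≡⟨ cong (λ z → s * s * (z - (A + B) * Y)) rel ⟩
    s * s * (deg * Y - deg * Y)                            ≡⟨ lem₄ s (deg * Y) ⟩
    0ℤ                                                 ∎)))
    where
    A = pos (suc a)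
    B = pos (suc (suc a))
    deg = pos (suc a ℕ.+ suc (suc a))
    H₁ = hook (suc (suc a)) (suc a) L zeros
    H₂ = hook (suc a) (suc (suc a)) L zeros
    H₃ = hook a (suc (suc (suc a))) L zeros
    X = ps (suc a ℕ.+ suc (suc a)) L zeros
    Y = ps (suc a) (ps (suc (suc a)) L) zeros
    s = sgn a
    lem₁ : ∀ n a b c → n * (b * (a * c)) ≡ a * b * (n * c)
    lem₁ = solve-∀
    lem₂ : ∀ a b s h k l → a * b * (s * h) ≡ s * (a * (b * (h + k)) - b * (a * (k + l)) + a * b * l)
    lem₂ = solve-∀
    lem₃ : ∀ s a b y x → s * (a * (- s * y) - b * (s * y) + a * b * (s * x)) ≡ s * s * (a * b * x - (a + b) * y)
    lem₃ = solve-∀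
    lem₄ : ∀ s z → s * s * (z - z) ≡ 0ℤ
    lem₄ = solve-∀

  -- Only partitions of deg matter, and a part below `suc a` is killed. Since deg ≤ 2 · `suc a` + 1
  -- is less than 3 · `suc a`, the only other partitions are (deg), where L is zero by assumption,
  -- and (`suc b`, `suc a`), where `es-es` turns the value into a positive multiple of L(p_a p_b)
  -- once the sign is included.
  esAll-nonneg : ∀ b → a ≤ b → b ≤ suc a → Supp (suc a ℕ.+ suc b) L →
                 es (suc a ℕ.+ suc b) L zeros ≡ 0ℤ → 0ℤ ℤ.≤ ps (suc a) (ps (suc b) L) zeros →
                 ∀ μ → IsPartition μ → 0ℤ ℤ.≤ sgn (suc a ℕ.+ suc b) * esAll μ L zeros
  esAll-nonneg b a≤b b≤ supp top Y≥0 μ part = go μ part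
    where
    deg = suc a ℕ.+ suc b

    from-zero : ∀ {z} → z ≡ 0ℤ → 0ℤ ℤ.≤ sgn deg * z
    from-zero refl = ℤₚ.≤-reflexive (sym (ℤₚ.*-zeroʳ (sgn deg)))

    vanish : ∀ μ → sumℕ μ ≢ deg → 0ℤ ℤ.≤ sgn deg * esAll μ L zeros
    vanish μ p = from-zero (esAll-vanish μ 0 deg L supp p)

    main : 0ℤ ℤ.≤ sgn deg * es (suc a) (es (suc b) L) zeros
    main = ℤₚ.*-cancelˡ-≤-pos _ _ (pos (suc a)) (ℤₚ.*-cancelˡ-≤-pos _ _ (pos (suc b))
      (subst (ℤ._≤ B * (A * (sgn deg * V))) (sym (trans (cong (λ z → B * z) (ℤₚ.*-zeroʳ A)) (ℤₚ.*-zeroʳ B)))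
        (subst (0ℤ ℤ.≤_) (sym eqn) Y≥0)))
      where
      A = pos (suc a)
      B = pos (suc b)
      V = es (suc a) (es (suc b) L) zeros
      Y = ps (suc a) (ps (suc b) L) zeros
      lem₁ : ∀ a b n v → b * (a * (n * v)) ≡ n * (a * b * v)
      lem₁ = solve-∀
      lem₂ : ∀ s t y → - s * - t * (s * t * y) ≡ s * s * (t * t) * y
      lem₂ = solve-∀
      eqn : B * (A * (sgn deg * V)) ≡ Y
      eqn = begin
        B * (A * (sgn deg * V))                       ≡⟨ lem₁ A B (sgn deg) V ⟩
        sgn deg * (A * B * V)                         ≡⟨ cong₂ _*_ (sgn-+ (suc a) (suc b)) (es-es b b≤) ⟩
        - sgn a * - sgn b * (sgn a * sgn b * Y)     ≡⟨ lem₂ (sgn a) (sgn b) Y ⟩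
        sgn a * sgn a * (sgn b * sgn b) * Y         ≡⟨ cong₂ (λ u v → u * v * Y) (sgn-square a) (sgn-square b) ⟩
        1ℤ * 1ℤ * Y                                 ≡⟨ ℤₚ.*-identityˡ Y ⟩
        Y                                           ∎

    go : ∀ μ → IsPartition μ → 0ℤ ℤ.≤ sgn deg * esAll μ L zeros
    go [] _ = vanish [] λ ()
    go (m ∷ []) _ with m ℕ.≟ deg
    ... | yes refl = from-zero top
    ... | no  m≢deg  = vanish (m ∷ []) (m≢deg ∘ trans (sym (ℕₚ.+-identityʳ m)))
    go (m₁ ∷ m₂ ∷ []) ((_ ∷ 1≤m₂ ∷ []) , (m₂≤m₁ ∷ _)) with m₂ ℕ.<? suc a | m₁ ℕ.+ m₂ ℕ.≟ deg
    ... | yes m₂<a | _ = from-zero (es-killed (Kill-es kill m₁) m₂ 1≤m₂ m₂<a zeros)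
    ... | no _ | no sum≢deg = vanish (m₁ ∷ m₂ ∷ []) (sum≢deg ∘ trans (cong (m₁ ℕ.+_) (sym (ℕₚ.+-identityʳ m₂))))
    ... | no m₂≮a | yes sum≡deg with m₂ ℕ.≟ suc a
    ...   | yes refl = subst (λ z → 0ℤ ℤ.≤ sgn deg * es (suc a) (es z L) zeros)
                         (ℕₚ.+-cancelˡ-≡ (suc a) (suc b) m₁ (trans (sym sum≡deg) (ℕₚ.+-comm m₁ (suc a)))) main
    -- Both parts are now at least `suc a` + 1, so their sum exceeds deg.
    ...   | no m₂≢a = ⊥-elim (ℕₚ.n≮n deg (ℕₚ.≤-trans (s≤s (ℕₚ.+-monoʳ-≤ (suc a) (s≤s b≤)))
                        (ℕₚ.≤-trans (ℕₚ.+-mono-≤ (ℕₚ.≤-trans big m₂≤m₁) big) (ℕₚ.≤-reflexive sum≡deg))))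
      where
      big : suc (suc a) ≤ m₂
      big = ℕₚ.≤∧≢⇒< (ℕₚ.≮⇒≥ m₂≮a) (m₂≢a ∘ sym)
    go (m₁ ∷ m₂ ∷ m₃ ∷ μ) ((_ ∷ _ ∷ 1≤m₃ ∷ _) , (m₂≤m₁ ∷ m₃≤m₂ ∷ _)) with m₃ ℕ.<? suc a
    ... | yes m₃<a = from-zero (esAll-zero μ (es-killed (Kill-es (Kill-es kill m₁) m₂) m₃ 1≤m₃ m₃<a) zeros)
    ... | no  m₃≮a = vanish (m₁ ∷ m₂ ∷ m₃ ∷ μ) (ℕₚ.>⇒≢ (ℕₚ.≤-trans
                       (subst (suc deg ≤_) (ℕₚ.+-assoc (suc a) (suc a) (suc a)) bound)
                       (ℕₚ.+-mono-≤ m₁≥ (ℕₚ.+-mono-≤ m₂≥ (ℕₚ.≤-trans m₃≥ (ℕₚ.m≤m+n m₃ (sumℕ μ)))))))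
      where
      m₃≥ = ℕₚ.≮⇒≥ m₃≮a
      m₂≥ = ℕₚ.≤-trans m₃≥ m₃≤m₂
      m₁≥ = ℕₚ.≤-trans m₂≥ m₂≤m₁
      bound : suc deg ≤ suc a ℕ.+ suc a ℕ.+ suc a
      bound = ℕₚ.≤-trans (ℕₚ.≤-reflexive (lem a b)) (ℕₚ.+-mono-≤ (ℕₚ.+-monoʳ-≤ (suc a) (b≤)) 2≤)
        where
        lem : ∀ a b → suc (suc a ℕ.+ suc b) ≡ suc a ℕ.+ b ℕ.+ 2
        lem = ℕ-solve-∀

-- The sum over proper colourings of AS_{a,b}

Kill-antidiagonal : ∀ {a} r {L : ℕ → ℕ → Func K} → (∀ i j → Kill a (L i j)) → Kill a (λ m → antidiagonal r (λ i j → L i j m))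
Kill-antidiagonal r {L} k i p q m = trans (antidiagonal-∑ r (λ c i′ j → L i′ j (add i c m)))
  (antidiagonal-zero r λ i′ j _ → k i′ j i p q m)

walk : ℕ → Fin K → (Fin K → Func K) → Func K
walk zero    d f m = f d m
walk (suc r) d f m = ∑ λ y → ne d y * walk r y f (add 1 y m)

walk-cong : ∀ r (d : Fin K) {f g : Fin K → Func K} → (∀ y m → f y m ≡ g y m) → ∀ m → walk r d f m ≡ walk r d g m
walk-cong zero    d e m = e d m
walk-cong (suc r) d e m = sum-cong-≗ λ y → cong (λ z → ne d y * z) (walk-cong r y e (add 1 y m))

-- The r inner vertices of an arc whose end colours d and e are fixed; the ends do not contribute to
-- the monomial.
path : ℕ → Fin K → Fin K → Func K → Func K
path r d e f = walk r d (λ y m → ne y e * f m)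

-- Modulo the ideal an arc contributes (-1)^r (h_r(x_d, x_e) - [d = e] x_d^r), with h_r the complete
-- homogeneous polynomial. In the induction the first inner colour y first runs over all colours:
-- the powers of y up to r + 1 < a sum to zero and only the correction at y = e survives.
-- Subtracting the forbidden y = d supplies the other terms of h_(r+1).
path-eval : ∀ {a} r (d e : Fin K) {f : Func K} → Kill a f → r < a → ∀ m →
            path r d e f m ≡ sgn r * (antidiagonal r (λ i j → f (add i d (add j e m))) - eq d e * f (add r d m))
path-eval zero d e {f} k _ m = begin
  (1ℤ - eq d e) * f m                          ≡⟨ lem (eq d e) (f m) ⟩
  1ℤ * (f m - eq d e * f m)                    ≡⟨ cong₂ (λ u v → 1ℤ * (f u - eq d e * f v))
                                                    (sym (trans (add-0 d (add 0 e m)) (add-0 e m))) (sym (add-0 d m)) ⟩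
  1ℤ * (f (add 0 d (add 0 e m)) - eq d e * f (add 0 d m)) ∎
  where
  lem : ∀ δ x → (1ℤ - δ) * x ≡ 1ℤ * (x - δ * x)
  lem = solve-∀
path-eval {a = a} (suc r) d e {f} k r<a m = begin
  ∑ (λ y → ne d y * path r y e f (add 1 y m))                     ≡⟨ ∑-ne d (λ y → path r y e f (add 1 y m)) ⟩
  ∑ (λ y → path r y e f (add 1 y m)) - path r d e f (add 1 d m)   ≡⟨ cong₂ _-_ (trans (sum-cong-≗ expand) sum-eval) (expand d) ⟩
  sgn r * (0ℤ - E) - sgn r * (D - eq d e * F)                     ≡⟨ lem (sgn r) E D (eq d e * F) ⟩
  - sgn r * (E + D - eq d e * F)                                  ≡⟨ cong (λ z → - sgn r * (f z + D - eq d e * F)) (sym (add-0 d (add (suc r) e m))) ⟩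
  sgn (suc r) * (antidiagonal (suc r) (λ i j → f (add i d (add j e m))) - eq d e * F) ∎
  where
  E = f (add (suc r) e m)
  D = antidiagonal r (λ i j → f (add (suc i) d (add j e m)))
  F = f (add (suc r) d m)
  lem : ∀ s e d x → s * (0ℤ - e) - s * (d - x) ≡ - s * (e + d - x)
  lem = solve-∀
  merge : ∀ y i j → add i y (add j e (add 1 y m)) ≡ add (suc i) y (add j e m)
  merge y i j = trans (cong (add i y) (add-comm j 1 e y m))
    (trans (add-+ i 1 y (add j e m)) (cong (λ n → add n y (add j e m)) (ℕₚ.+-comm i 1)))
  expand : ∀ y → path r y e f (add 1 y m) ≡ sgn r * (antidiagonal r (λ i j → f (add (suc i) y (add j e m))) - eq y e * f (add (suc r) y m))
  expand y = trans (path-eval r y e k (ℕₚ.<⇒≤ r<a) (add 1 y m))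
    (cong₂ (λ u v → sgn r * (u - eq y e * f v)) (antidiagonal-cong r λ i j _ → cong f (merge y i j))
      (trans (add-+ r 1 y m) (cong (λ n → add n y m) (ℕₚ.+-comm r 1))))
  sum-eval : ∑ (λ y → sgn r * (antidiagonal r (λ i j → f (add (suc i) y (add j e m))) - eq y e * f (add (suc r) y m))) ≡ sgn r * (0ℤ - E)
  sum-eval = begin
    ∑ (λ y → sgn r * (g y - h y))   ≡⟨ *-distribˡ-sum (sgn r) (λ y → g y - h y) ⟨
    sgn r * ∑ (λ y → g y - h y)     ≡⟨ cong (λ z → sgn r * z) (∑-distrib-- g h) ⟩
    sgn r * (∑ g - ∑ h)             ≡⟨ cong₂ (λ u v → sgn r * (u - v))
                                        (trans (antidiagonal-∑ r (λ y i j → f (add (suc i) y (add j e m))))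
                                          (antidiagonal-zero r λ i j p → k (suc i) (s≤s z≤n) (ℕₚ.≤-<-trans (s≤s (subst (i ≤_) p (ℕₚ.m≤m+n i j))) r<a) (add j e m)))
                                        (trans (sum-cong-≗ λ y → cong (λ z → z * f (add (suc r) y m)) (eq-sym y e))
                                          (∑-eq e (λ y → f (add (suc r) y m)))) ⟩
    sgn r * (0ℤ - E)                ∎
    where
    g h : Fin _ → ℤ
    g y = antidiagonal r (λ i j → f (add (suc i) y (add j e m)))
    h y = eq y e * f (add (suc r) y m)

ne-cases : (c f : Fin K) → ne c f ≡ 0ℤ ⊎ (ne c f ≡ 1ℤ × eq f c ≡ 0ℤ)
ne-cases zero    zero    = inj₁ refl
ne-cases zero    (suc f) = inj₂ (refl , refl)
ne-cases (suc c) zero    = inj₂ (refl , refl)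
ne-cases (suc c) (suc f) = ne-cases c f

ne-idem : (c f : Fin K) → ne c f * ne c f ≡ ne c f
ne-idem zero    zero    = refl
ne-idem zero    (suc f) = refl
ne-idem (suc c) zero    = refl
ne-idem (suc c) (suc f) = ne-idem c f

∑-* : ∀ x (f : Fin K → ℤ) → ∑ (λ c → x * f c) ≡ x * ∑ f
∑-* x f = sym (*-distribˡ-sum x f)

-- The four special vertices span all their edges except possibly v₂v_{a+1}. So once v₁ and v_{a+2}
-- have colours c ≠ f, the colours of v₂ and v_{a+1} must each avoid both, and they interact only
-- through the arc between them.
avoid : Fin K → Fin K → Fin K → ℤ
avoid c f z = ne c z * ne z f

module _ (r : ℕ) where

  private
    a : ℕ
    a = suc (suc r)

  module _ {Φ : Func K} (kill : Kill a Φ) {c f : Fin K} (c≠f : ne c f ≡ 1ℤ) where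

    ∑-avoid : ∀ g → ∑ (λ z → avoid c f z * g z) ≡ ∑ g - g c - g f
    ∑-avoid g = begin
      ∑ (λ z → ne c z * ne z f * g z)           ≡⟨ sum-cong-≗ (λ z → ℤₚ.*-assoc (ne c z) (ne z f) (g z)) ⟩
      ∑ (λ z → ne c z * (ne z f * g z))         ≡⟨ ∑-ne c (λ z → ne z f * g z) ⟩
      ∑ (λ z → ne z f * g z) - ne c f * g c     ≡⟨ cong₂ _-_ (trans (sum-cong-≗ λ z → cong (λ y → y * g z) (ne-sym z f)) (∑-ne f g))
                                                             (cong (λ z → z * g c) c≠f) ⟩
      ∑ g - g f - 1ℤ * g c                      ≡⟨ lem (∑ g) (g f) (g c) ⟩
      ∑ g - g c - g f                           ∎
      where
      lem : ∀ s x y → s - x - 1ℤ * y ≡ s - y - x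
      lem = solve-∀

    ∑-avoid-kill : ∀ {Ψ : Func K} → Kill a Ψ → ∀ i → 1 ≤ i → i < a → ∀ m →
                   ∑ (λ z → avoid c f z * Ψ (add i z m)) ≡ - (Ψ (add i c m) + Ψ (add i f m))
    ∑-avoid-kill {Ψ} k i p q m = begin
      ∑ (λ z → avoid c f z * Ψ (add i z m))                ≡⟨ ∑-avoid (λ z → Ψ (add i z m)) ⟩
      ps i Ψ m - Ψ (add i c m) - Ψ (add i f m)         ≡⟨ cong (λ z → z - Ψ (add i c m) - Ψ (add i f m)) (k i p q m) ⟩
      0ℤ - Ψ (add i c m) - Ψ (add i f m)               ≡⟨ lem (Ψ (add i c m)) (Ψ (add i f m)) ⟩
      - (Ψ (add i c m) + Ψ (add i f m))                ∎
      where
      lem : ∀ x y → 0ℤ - x - y ≡ - (x + y)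
      lem = solve-∀

    avoid-idem : ∀ z → avoid c f z * avoid c f z ≡ avoid c f z
    avoid-idem z = trans (lem (ne c z) (ne z f)) (cong₂ _*_ (ne-idem c z) (ne-idem z f))
      where
      lem : ∀ x y → x * y * (x * y) ≡ x * x * (y * y)
      lem = solve-∀

    module _ (m : Vec ℕ K) where

      private
        P : ℕ → ℕ → Fin K → Fin K → ℤ
        P i j d e = Φ (add (suc i) d (add (suc j) e m))

        -- Both exponents are below a, so each sum over the colours other than c and f is minus its
        -- values at c and f. The right-hand side is the expansion of (x_c^(i+1) + x_f^(i+1))
        -- (x_c^(j+1) + x_f^(j+1)).
        pair-sum : ∀ i j → i ℕ.+ j ≡ r → ∑ (λ d → avoid c f d * ∑ (λ e → avoid c f e * P i j d e)) ≡
                   Φ (add a c m) + Φ (add a f m) + (P i j c f + P j i c f)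
        pair-sum i j eq-r = begin
          ∑ (λ d → avoid c f d * ∑ (λ e → avoid c f e * P i j d e))
            ≡⟨ sum-cong-≗ (λ d → cong (λ z → avoid c f d * z) (∑-avoid-kill {Φ ∘ add (suc i) d} (Kill-add {L = Φ} kill (suc i) d) (suc j) (s≤s z≤n) j<a m)) ⟩
          ∑ (λ d → avoid c f d * - (P i j d c + P i j d f))
            ≡⟨ sum-cong-≗ (λ d → lem₁ (avoid c f d) (P i j d c) (P i j d f)) ⟩
          ∑ (λ d → - 1ℤ * (avoid c f d * P i j d c + avoid c f d * P i j d f))
            ≡⟨ trans (∑-* (- 1ℤ) (λ d → avoid c f d * P i j d c + avoid c f d * P i j d f))
                (cong (λ z → - 1ℤ * z) (∑-distrib-+ (λ d → avoid c f d * P i j d c) (λ d → avoid c f d * P i j d f))) ⟩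
          - 1ℤ * (∑ (λ d → avoid c f d * P i j d c) + ∑ (λ d → avoid c f d * P i j d f))
            ≡⟨ cong₂ (λ u v → - 1ℤ * (u + v)) (∑-avoid-kill {Φ} kill (suc i) (s≤s z≤n) i<a (add (suc j) c m))
                                              (∑-avoid-kill {Φ} kill (suc i) (s≤s z≤n) i<a (add (suc j) f m)) ⟩
          - 1ℤ * (- (P i j c c + P i j f c) + - (P i j c f + P i j f f))
            ≡⟨ lem₂ (P i j c c) (P i j f c) (P i j c f) (P i j f f) ⟩
          P i j c c + P i j f f + (P i j c f + P i j f c)
            ≡⟨ cong₂ (λ u v → u + v + (P i j c f + P i j f c)) (diag c) (diag f) ⟩
          Φ (add a c m) + Φ (add a f m) + (P i j c f + P i j f c)
            ≡⟨ cong (λ z → Φ (add a c m) + Φ (add a f m) + (P i j c f + Φ z)) (add-comm (suc i) (suc j) f c m) ⟩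
          Φ (add a c m) + Φ (add a f m) + (P i j c f + P j i c f) ∎
          where
          i<a : suc i < a
          i<a = s≤s (s≤s (subst (i ≤_) eq-r (ℕₚ.m≤m+n i j)))
          j<a : suc j < a
          j<a = s≤s (s≤s (subst (j ≤_) eq-r (ℕₚ.m≤n+m j i)))
          diag : ∀ z → P i j z z ≡ Φ (add a z m)
          diag z = cong Φ (trans (add-+ (suc i) (suc j) z m)
            (cong (λ n → add n z m) (trans (cong suc (ℕₚ.+-suc i j)) (cong (λ n → suc (suc n)) eq-r))))
          lem₁ : ∀ x y z → x * - (y + z) ≡ - 1ℤ * (x * y + x * z)
          lem₁ = solve-∀
          lem₂ : ∀ x y z w → - 1ℤ * (- (x + y) + - (z + w)) ≡ x + w + (z + y)
          lem₂ = solve-∀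

        path-term : ∀ d e → path r d e (Φ ∘ add 1 e) (add 1 d m) ≡
                    sgn r * (antidiagonal r (λ i j → P i j d e) - eq d e * Φ (add 1 e (add (suc r) d m)))
        path-term d e = trans (path-eval r d e (Kill-add {L = Φ} kill 1 e) (s≤s (ℕₚ.n≤1+n r)) (add 1 d m))
          (cong₂ (λ u v → sgn r * (u - eq d e * Φ (add 1 e v)))
            (antidiagonal-cong r λ i j _ → cong Φ (begin
              add 1 e (add i d (add j e (add 1 d m)))  ≡⟨ cong (add 1 e ∘ add i d) (add-comm j 1 e d m) ⟩
              add 1 e (add i d (add 1 d (add j e m)))  ≡⟨ cong (add 1 e) (add-+ i 1 d (add j e m)) ⟩
              add 1 e (add (i ℕ.+ 1) d (add j e m))    ≡⟨ cong (λ n → add 1 e (add n d (add j e m))) (ℕₚ.+-comm i 1) ⟩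
              add 1 e (add (suc i) d (add j e m))      ≡⟨ add-comm 1 (suc i) e d (add j e m) ⟩
              add (suc i) d (add 1 e (add j e m))      ≡⟨ cong (add (suc i) d) (add-+ 1 j e m) ⟩
              add (suc i) d (add (suc j) e m)          ∎))
            (trans (add-+ r 1 d m) (cong (λ n → add n d m) (ℕₚ.+-comm r 1))))

      -- The r + 1 pairs (i, j) give r + 1 copies of x_c^a + x_f^a. The correction for d = e is
      -- -(p_a - x_c^a - x_f^a): it adds the last copy, for a total of a = r + 2, and leaves p_a,
      -- which is not killed.
      inner-eval : ∑ (λ d → ∑ λ e → avoid c f d * avoid c f e * path r d e (Φ ∘ add 1 e) (add 1 d m)) ≡
                   sgn r * (pos a * (Φ (add a c m) + Φ (add a f m))
                            + pos 2 * antidiagonal r (λ i j → Φ (add (suc i) c (add (suc j) f m))) - ps a Φ m)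
      inner-eval = begin
        ∑ (λ d → ∑ λ e → avoid c f d * avoid c f e * path r d e (Φ ∘ add 1 e) (add 1 d m))
          ≡⟨ sum-cong-≗ (λ d → trans (sum-cong-≗ (λ e → trans (cong (λ z → avoid c f d * avoid c f e * z) (path-term d e))
               (lem₁ (avoid c f d) (avoid c f e) (sgn r) (A d e) (eq d e) (B d e))))
               (trans (∑-* (sgn r * avoid c f d) (λ e → avoid c f e * A d e - eq d e * (avoid c f e * B d e)))
                 (trans (ℤₚ.*-assoc (sgn r) (avoid c f d) _) (cong (λ z → sgn r * (avoid c f d * z)) (trans (∑-distrib-- (λ e → avoid c f e * A d e) (λ e → eq d e * (avoid c f e * B d e)))
                   (cong (λ z → ∑ (λ e → avoid c f e * A d e) - z) (∑-eq d (λ e → avoid c f e * B d e)))))))) ⟩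
        ∑ (λ d → sgn r * (avoid c f d * (∑ (λ e → avoid c f e * A d e) - avoid c f d * B d d)))
          ≡⟨ trans (∑-* (sgn r) (λ d → avoid c f d * (∑ (λ e → avoid c f e * A d e) - avoid c f d * B d d)))
               (cong (λ z → sgn r * z) (trans (sum-cong-≗ λ d → trans (lem₂ (avoid c f d) (∑ (λ e → avoid c f e * A d e)) (B d d))
                   (cong₂ (λ u v → avoid c f d * ∑ (λ e → avoid c f e * A d e) - u * v) (avoid-idem d) (cong Φ (add-+ 1 (suc r) d m))))
                 (∑-distrib-- (λ d → avoid c f d * ∑ (λ e → avoid c f e * A d e)) (λ d → avoid c f d * Φ (add a d m))))) ⟩
        sgn r * (∑ (λ d → avoid c f d * ∑ (λ e → avoid c f e * A d e)) - ∑ (λ d → avoid c f d * Φ (add a d m)))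
          ≡⟨ cong₂ (λ u v → sgn r * (u - v)) antidiagonal-part (∑-avoid (λ d → Φ (add a d m))) ⟩
        sgn r * (pos (suc r) * U + (Q + Q) - (ps a Φ m - Φ (add a c m) - Φ (add a f m)))
          ≡⟨ lem₃ (sgn r) (pos (suc r)) (Φ (add a c m)) (Φ (add a f m)) Q (ps a Φ m) ⟩
        sgn r * (pos a * U + pos 2 * Q - ps a Φ m) ∎
        where
        A B : Fin K → Fin K → ℤ
        A d e = antidiagonal r (λ i j → P i j d e)
        B d e = Φ (add 1 e (add (suc r) d m))
        U = Φ (add a c m) + Φ (add a f m)
        Q = antidiagonal r (λ i j → P i j c f)
        lem₁ : ∀ d e s x δ y → d * e * (s * (x - δ * y)) ≡ s * d * (e * x - δ * (e * y))
        lem₁ = solve-∀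
        lem₂ : ∀ d x y → d * (x - d * y) ≡ d * x - d * d * y
        lem₂ = solve-∀
        lem₃ : ∀ s n x y q p → s * (n * (x + y) + (q + q) - (p - x - y)) ≡ s * ((1ℤ + n) * (x + y) + pos 2 * q - p)
        lem₃ = solve-∀
        antidiagonal-part : ∑ (λ d → avoid c f d * ∑ (λ e → avoid c f e * A d e)) ≡ pos (suc r) * U + (Q + Q)
        antidiagonal-part = begin
          ∑ (λ d → avoid c f d * ∑ (λ e → avoid c f e * A d e))
            ≡⟨ sum-cong-≗ (λ d → trans (cong (λ z → avoid c f d * z) (trans (sum-cong-≗ λ e → sym (antidiagonal-* r (avoid c f e) (λ i j → P i j d e)))
                 (antidiagonal-∑ r (λ e i j → avoid c f e * P i j d e)))) (sym (antidiagonal-* r (avoid c f d) (λ i j → ∑ (λ e → avoid c f e * P i j d e))))) ⟩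
          ∑ (λ d → antidiagonal r (λ i j → avoid c f d * ∑ (λ e → avoid c f e * P i j d e)))
            ≡⟨ antidiagonal-∑ r (λ d i j → avoid c f d * ∑ (λ e → avoid c f e * P i j d e)) ⟩
          antidiagonal r (λ i j → ∑ (λ d → avoid c f d * ∑ (λ e → avoid c f e * P i j d e)))
            ≡⟨ antidiagonal-cong r pair-sum ⟩
          antidiagonal r (λ i j → U + (P i j c f + P j i c f))
            ≡⟨ antidiagonal-+ r (λ _ _ → U) (λ i j → P i j c f + P j i c f) ⟩
          antidiagonal r (λ _ _ → U) + antidiagonal r (λ i j → P i j c f + P j i c f)
            ≡⟨ cong₂ _+_ (antidiagonal-const r U) (trans (antidiagonal-+ r (λ i j → P i j c f) (λ i j → P j i c f))
                 (cong (λ z → Q + z) (antidiagonal-flip r (λ i j → P i j c f)))) ⟩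
          pos (suc r) * U + (Q + Q) ∎

-- Sums over ordered pairs of distinct colours

offdiag : (Fin K → Fin K → ℤ) → ℤ
offdiag g = ∑ λ c → ∑ λ f → ne c f * g c f

offdiag-cong : {g h : Fin K → Fin K → ℤ} → (∀ c f → ne c f ≡ 1ℤ → eq f c ≡ 0ℤ → g c f ≡ h c f) → offdiag g ≡ offdiag h
offdiag-cong {g = g} {h} e = sum-cong-≗ λ c → sum-cong-≗ λ f → go c f
  where
  go : ∀ c f → ne c f * g c f ≡ ne c f * h c f
  go c f with ne-cases c f
  ... | inj₁ z       = trans (cong (λ n → n * g c f) z) (cong (λ n → n * h c f) (sym z))
  ... | inj₂ (o , z) = cong (λ n → ne c f * n) (e c f o z)

offdiag-+ : (g h : Fin K → Fin K → ℤ) → offdiag (λ c f → g c f + h c f) ≡ offdiag g + offdiag h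
offdiag-+ g h = trans
  (sum-cong-≗ λ c → trans (sum-cong-≗ λ f → ℤₚ.*-distribˡ-+ (ne c f) (g c f) (h c f))
    (∑-distrib-+ (λ f → ne c f * g c f) (λ f → ne c f * h c f)))
  (∑-distrib-+ (λ c → ∑ λ f → ne c f * g c f) (λ c → ∑ λ f → ne c f * h c f))

offdiag-* : ∀ x (g : Fin K → Fin K → ℤ) → offdiag (λ c f → x * g c f) ≡ x * offdiag g
offdiag-* x g = trans
  (sum-cong-≗ λ c → trans (sum-cong-≗ λ f → lem (ne c f) x (g c f)) (∑-* x (λ f → ne c f * g c f)))
  (∑-* x (λ c → ∑ λ f → ne c f * g c f))
  where
  lem : ∀ n x y → n * (x * y) ≡ x * (n * y)
  lem = solve-∀

offdiag-antidiagonal : ∀ r (h : ℕ → ℕ → Fin K → Fin K → ℤ) →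
               offdiag (λ c f → antidiagonal r (λ i j → h i j c f)) ≡ antidiagonal r (λ i j → offdiag (h i j))
offdiag-antidiagonal r h = trans
  (sum-cong-≗ λ c → trans (sum-cong-≗ λ f → sym (antidiagonal-* r (ne c f) (λ i j → h i j c f))) (antidiagonal-∑ r (λ f i j → ne c f * h i j c f)))
  (antidiagonal-∑ r (λ c i j → ∑ λ f → ne c f * h i j c f))

offdiag-eval : (g : Fin K → Fin K → ℤ) → offdiag g ≡ ∑ (λ c → ∑ λ f → g c f) - ∑ (λ c → g c c)
offdiag-eval g = trans (sum-cong-≗ λ c → ∑-ne c (g c)) (∑-distrib-- (λ c → ∑ (g c)) (λ c → g c c))

offdiag-ps : (L : Func K) → ∀ U V → offdiag (λ c f → L (add U c (add V f zeros))) ≡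
             ps U (ps V L) zeros - ps (U ℕ.+ V) L zeros
offdiag-ps L U V = trans (offdiag-eval (λ c f → L (add U c (add V f zeros))))
  (cong₂ _-_ (sum-cong-≗ λ c → sum-cong-≗ λ f → cong L (add-comm U V c f zeros))
             (sum-cong-≗ λ c → cong L (add-+ U V c zeros)))

-- A normal form for the monomials in x_c and x_f; the loose factor x_c is the vertex v₁ itself.
collect : ∀ j s u v (c f : Fin K) m →
          add j c (add s f (add u c (add v f (add 1 c m)))) ≡ add (j ℕ.+ u ℕ.+ 1) c (add (s ℕ.+ v) f m)
collect j s u v c f m = begin
  add j c (add s f (add u c (add v f (add 1 c m))))  ≡⟨ cong (add j c) (add-comm s u f c _) ⟩
  add j c (add u c (add s f (add v f (add 1 c m))))  ≡⟨ add-+ j u c _ ⟩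
  add (j ℕ.+ u) c (add s f (add v f (add 1 c m)))    ≡⟨ cong (add (j ℕ.+ u) c) (trans (add-+ s v f _) (add-comm (s ℕ.+ v) 1 f c m)) ⟩
  add (j ℕ.+ u) c (add 1 c (add (s ℕ.+ v) f m))      ≡⟨ add-+ (j ℕ.+ u) 1 c _ ⟩
  add (j ℕ.+ u ℕ.+ 1) c (add (s ℕ.+ v) f m)          ∎

-- The weighted count of proper colourings of AS_{r+2,r'+2}: c, d, e, f are the colours
-- of v₁, v₂, v_{a+1}, v_{a+2}, and the two arcs of the cycle between them are the paths.
total : ℕ → ℕ → Func K → ℤ
total r r′ L = ∑ λ c → ∑ λ d → ∑ λ e → ∑ λ f → ne c f * (avoid c f d * avoid c f e) *
  walk r d (λ y m → ne y e * path r′ f c L (add 1 f (add 1 e m))) (add 1 d (add 1 c zeros))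

module Core {K : ℕ} (r r′ : ℕ) (L : Func K) (kill : Kill (suc (suc r)) L) (r′< : r′ < suc (suc r)) where

  private
    a : ℕ
    a = suc (suc r)

    -- What is left of L once the arc from v_{a+2} back to v₁ is summed out. It is still a
    -- functional that annihilates the ideal, so `inner-eval` applies to it for the other arc.
    Φ : Fin K → Fin K → Func K
    Φ c f m = sgn r′ * antidiagonal r′ (λ i j → L (add j c (add (suc i) f m)))

    Kill-Φ : ∀ c f → Kill a (Φ c f)
    Kill-Φ c f = Kill-* {L = λ m → antidiagonal r′ (λ i j → L (add j c (add (suc i) f m)))} (sgn r′)
      (Kill-antidiagonal r′ {λ i j m → L (add j c (add (suc i) f m))}
        λ i j → Kill-add {L = L ∘ add j c} (Kill-add {L = L} kill j c) (suc i) f)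

    -- As c ≠ f, the diagonal correction of `path-eval` disappears.
    path-Φ : ∀ c f → eq f c ≡ 0ℤ → ∀ m → path r′ f c L (add 1 f m) ≡ Φ c f m
    path-Φ c f z m = begin
      path r′ f c L (add 1 f m)
        ≡⟨ path-eval r′ f c kill r′< (add 1 f m) ⟩
      sgn r′ * (antidiagonal r′ (λ i j → L (add i f (add j c (add 1 f m)))) - eq f c * L (add r′ f (add 1 f m)))
        ≡⟨ cong₂ (λ u v → sgn r′ * (u - v * L (add r′ f (add 1 f m)))) (antidiagonal-cong r′ λ i j _ → cong L (merge i j)) z ⟩
      sgn r′ * (antidiagonal r′ (λ i j → L (add j c (add (suc i) f m))) - 0ℤ * L (add r′ f (add 1 f m)))
        ≡⟨ lem (sgn r′) _ (L (add r′ f (add 1 f m))) ⟩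
      Φ c f m ∎
      where
      lem : ∀ s x y → s * (x - 0ℤ * y) ≡ s * x
      lem = solve-∀
      merge : ∀ i j → add i f (add j c (add 1 f m)) ≡ add j c (add (suc i) f m)
      merge i j = trans (add-comm i j f c _) (cong (add j c) (trans (add-+ i 1 f m) (cong (λ n → add n f m) (ℕₚ.+-comm i 1))))

    mono : ℕ → ℕ → Fin K → Fin K → ℤ
    mono U V c f = L (add U c (add V f zeros))

    q₂ : ℕ → ℕ → ℤ
    q₂ U V = offdiag (mono U V)

    w₂ : ℕ → ℕ → ℤ
    w₂ U V = offdiag (λ c f → ps a L (add U c (add V f zeros)))

    term : ℕ → ℕ → Fin K → Fin K → ℤ
    term i j c f = pos a * (mono (j ℕ.+ a ℕ.+ 1) (suc i ℕ.+ 0) c f + mono (j ℕ.+ 0 ℕ.+ 1) (suc i ℕ.+ a) c f)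
                + pos 2 * antidiagonal r (λ k l → mono (j ℕ.+ suc k ℕ.+ 1) (suc i ℕ.+ suc l) c f)
                + - 1ℤ * ps a L (add (j ℕ.+ 0 ℕ.+ 1) c (add (suc i ℕ.+ 0) f zeros))

    inner : ∀ c f → ne c f ≡ 1ℤ →
            ∑ (λ d → ∑ λ e → avoid c f d * avoid c f e * path r d e (Φ c f ∘ add 1 e) (add 1 d (add 1 c zeros))) ≡
            sgn r * (sgn r′ * antidiagonal r′ (λ i j → term i j c f))
    inner c f o = trans (inner-eval r {Φ = Φ c f} (Kill-Φ c f) o (add 1 c zeros)) (cong (λ z → sgn r * z) (begin
      pos a * (Φ c f (add a c m) + Φ c f (add a f m)) + pos 2 * antidiagonal r (λ k l → Φ c f (add (suc k) c (add (suc l) f m))) - ps a (Φ c f) m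
        ≡⟨ cong₂ (λ u v → pos a * (Φ c f (add a c m) + Φ c f (add a f m)) + pos 2 * u - v) third fourth ⟩
      pos a * (s * A₁ + s * A₂) + pos 2 * (s * A₃) - s * A₄
        ≡⟨ lem (pos a) s A₁ A₂ A₃ A₄ ⟩
      s * (pos a * (A₁ + A₂) + pos 2 * A₃ + - 1ℤ * A₄)
        ≡⟨ cong (λ z → s * z) assemble ⟨
      s * antidiagonal r′ (λ i j → term i j c f) ∎))
      where
      m = add 1 c zeros
      s = sgn r′
      A₁ = antidiagonal r′ (λ i j → L (add j c (add (suc i) f (add a c m))))
      A₂ = antidiagonal r′ (λ i j → L (add j c (add (suc i) f (add a f m))))
      A₃ = antidiagonal r′ (λ i j → antidiagonal r (λ k l → L (add j c (add (suc i) f (add (suc k) c (add (suc l) f m))))))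
      A₄ = antidiagonal r′ (λ i j → ∑ λ d → L (add j c (add (suc i) f (add a d m))))
      lem : ∀ a s x y z w → a * (s * x + s * y) + pos 2 * (s * z) - s * w ≡ s * (a * (x + y) + pos 2 * z + - 1ℤ * w)
      lem = solve-∀
      third : antidiagonal r (λ k l → Φ c f (add (suc k) c (add (suc l) f m))) ≡ s * A₃
      third = trans (antidiagonal-* r s (λ k l → antidiagonal r′ (λ i j → L (add j c (add (suc i) f (add (suc k) c (add (suc l) f m)))))))
        (cong (λ z → s * z) (antidiagonal-swap r r′ (λ k l i j → L (add j c (add (suc i) f (add (suc k) c (add (suc l) f m)))))))
      fourth : ps a (Φ c f) m ≡ s * A₄
      fourth = trans (∑-* s (λ d → antidiagonal r′ (λ i j → L (add j c (add (suc i) f (add a d m))))))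
        (cong (λ z → s * z) (antidiagonal-∑ r′ (λ d i j → L (add j c (add (suc i) f (add a d m))))))
      t₁ : ∀ i j → L (add j c (add (suc i) f (add a c m))) ≡ mono (j ℕ.+ a ℕ.+ 1) (suc i ℕ.+ 0) c f
      t₁ i j = cong L (trans (cong (add j c ∘ add (suc i) f ∘ add a c) (sym (add-0 f m))) (collect j (suc i) a 0 c f zeros))
      t₂ : ∀ i j → L (add j c (add (suc i) f (add a f m))) ≡ mono (j ℕ.+ 0 ℕ.+ 1) (suc i ℕ.+ a) c f
      t₂ i j = cong L (trans (cong (add j c ∘ add (suc i) f) (sym (add-0 c (add a f m)))) (collect j (suc i) 0 a c f zeros))
      t₄ : ∀ i j d → L (add j c (add (suc i) f (add a d m))) ≡ L (add a d (add (j ℕ.+ 0 ℕ.+ 1) c (add (suc i ℕ.+ 0) f zeros)))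
      t₄ i j d = cong L (begin
        add j c (add (suc i) f (add a d m))  ≡⟨ cong (add j c) (add-comm (suc i) a f d m) ⟩
        add j c (add a d (add (suc i) f m))  ≡⟨ add-comm j a c d _ ⟩
        add a d (add j c (add (suc i) f m))  ≡⟨ cong (add a d ∘ add j c ∘ add (suc i) f) (trans (sym (add-0 f m)) (sym (add-0 c (add 0 f m)))) ⟩
        add a d (add j c (add (suc i) f (add 0 c (add 0 f m)))) ≡⟨ cong (add a d) (collect j (suc i) 0 0 c f zeros) ⟩
        add a d (add (j ℕ.+ 0 ℕ.+ 1) c (add (suc i ℕ.+ 0) f zeros)) ∎)
      assemble : antidiagonal r′ (λ i j → term i j c f) ≡ pos a * (A₁ + A₂) + pos 2 * A₃ + - 1ℤ * A₄
      assemble = begin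
        antidiagonal r′ (λ i j → term i j c f)
          ≡⟨ antidiagonal-cong r′ (λ i j _ → cong₂ (λ x y → x + - 1ℤ * y)
               (cong₂ (λ x y → pos a * x + pos 2 * y) (sym (cong₂ _+_ (t₁ i j) (t₂ i j)))
                 (antidiagonal-cong r λ k l _ → sym (cong L (collect j (suc i) (suc k) (suc l) c f zeros))))
               (sum-cong-≗ λ d → sym (t₄ i j d))) ⟩
        antidiagonal r′ (λ i j → pos a * (a₁ i j + a₂ i j) + pos 2 * a₃ i j + - 1ℤ * a₄ i j)
          ≡⟨ antidiagonal-+ r′ (λ i j → pos a * (a₁ i j + a₂ i j) + pos 2 * a₃ i j) (λ i j → - 1ℤ * a₄ i j) ⟩
        antidiagonal r′ (λ i j → pos a * (a₁ i j + a₂ i j) + pos 2 * a₃ i j) + antidiagonal r′ (λ i j → - 1ℤ * a₄ i j)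
          ≡⟨ cong₂ _+_ (trans (antidiagonal-+ r′ (λ i j → pos a * (a₁ i j + a₂ i j)) (λ i j → pos 2 * a₃ i j))
               (cong₂ _+_ (trans (antidiagonal-* r′ (pos a) (λ i j → a₁ i j + a₂ i j)) (cong (λ z → pos a * z) (antidiagonal-+ r′ a₁ a₂))) (antidiagonal-* r′ (pos 2) a₃)))
               (antidiagonal-* r′ (- 1ℤ) a₄) ⟩
        pos a * (A₁ + A₂) + pos 2 * A₃ + - 1ℤ * A₄ ∎
        where
        a₁ a₂ a₃ a₄ : ℕ → ℕ → ℤ
        a₁ i j = L (add j c (add (suc i) f (add a c m)))
        a₂ i j = L (add j c (add (suc i) f (add a f m)))
        a₃ i j = antidiagonal r (λ k l → L (add j c (add (suc i) f (add (suc k) c (add (suc l) f m)))))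
        a₄ i j = ∑ λ d → L (add j c (add (suc i) f (add a d m)))

  -- The sums over c and f are moved outside: for a fixed pair c ≠ f the whole inner sum is the one
  -- that `inner` evaluates.
  total-offdiag : total r r′ L ≡ offdiag (λ c f → sgn r * (sgn r′ * antidiagonal r′ (λ i j → term i j c f)))
  total-offdiag = begin
    total r r′ L
      ≡⟨ (sum-cong-≗ λ c → trans (sum-cong-≗ λ d → ∑-comm (λ e f → X c d e f)) (∑-comm (λ d f → ∑ λ e → X c d e f))) ⟩
    ∑ (λ c → ∑ λ f → ∑ λ d → ∑ λ e → X c d e f)
      ≡⟨ (sum-cong-≗ λ c → sum-cong-≗ λ f → trans (sum-cong-≗ λ d → trans (sum-cong-≗ λ e → ℤₚ.*-assoc (ne c f) (avoid c f d * avoid c f e) (W c d e f))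
           (∑-* (ne c f) (λ e → avoid c f d * avoid c f e * W c d e f)))
           (∑-* (ne c f) (λ d → ∑ λ e → avoid c f d * avoid c f e * W c d e f))) ⟩
    offdiag (λ c f → ∑ λ d → ∑ λ e → avoid c f d * avoid c f e * W c d e f)
      ≡⟨ offdiag-cong (λ c f o z → trans
           (sum-cong-≗ λ d → sum-cong-≗ λ e → cong (λ y → avoid c f d * avoid c f e * y)
             (walk-cong r d (λ y m → cong (λ v → ne y e * v) (path-Φ c f z (add 1 e m))) (add 1 d (add 1 c zeros))))
           (inner c f o)) ⟩
    offdiag (λ c f → sgn r * (sgn r′ * antidiagonal r′ (λ i j → term i j c f))) ∎
    where
    W X : Fin K → Fin K → Fin K → Fin K → ℤ
    W c d e f = walk r d (λ y m → ne y e * path r′ f c L (add 1 f (add 1 e m))) (add 1 d (add 1 c zeros))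
    X c d e f = ne c f * (avoid c f d * avoid c f e) * W c d e f

  total-eval : total r r′ L ≡ sgn r * (sgn r′ * antidiagonal r′ (λ i j →
      pos a * (q₂ (j ℕ.+ a ℕ.+ 1) (suc i ℕ.+ 0) + q₂ (j ℕ.+ 0 ℕ.+ 1) (suc i ℕ.+ a))
      + pos 2 * antidiagonal r (λ k l → q₂ (j ℕ.+ suc k ℕ.+ 1) (suc i ℕ.+ suc l))
      + - 1ℤ * w₂ (j ℕ.+ 0 ℕ.+ 1) (suc i ℕ.+ 0)))
  total-eval = begin
    total r r′ L
      ≡⟨ total-offdiag ⟩
    offdiag (λ c f → sgn r * (sgn r′ * antidiagonal r′ (λ i j → term i j c f)))
      ≡⟨ trans (offdiag-* (sgn r) (λ c f → sgn r′ * antidiagonal r′ (λ i j → term i j c f)))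
           (cong (λ z → sgn r * z) (trans (offdiag-* (sgn r′) (λ c f → antidiagonal r′ (λ i j → term i j c f)))
             (cong (λ z → sgn r′ * z) (offdiag-antidiagonal r′ term)))) ⟩
    sgn r * (sgn r′ * antidiagonal r′ (λ i j → offdiag (term i j)))
      ≡⟨ cong (λ z → sgn r * (sgn r′ * z)) (antidiagonal-cong r′ λ i j _ → split i j) ⟩
    _ ∎
    where
    split : ∀ i j → offdiag (term i j) ≡
      pos a * (q₂ (j ℕ.+ a ℕ.+ 1) (suc i ℕ.+ 0) + q₂ (j ℕ.+ 0 ℕ.+ 1) (suc i ℕ.+ a))
      + pos 2 * antidiagonal r (λ k l → q₂ (j ℕ.+ suc k ℕ.+ 1) (suc i ℕ.+ suc l))
      + - 1ℤ * w₂ (j ℕ.+ 0 ℕ.+ 1) (suc i ℕ.+ 0)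
    split i j = begin
      offdiag (λ c f → pos a * (m₁ c f + m₂ c f) + pos 2 * m₃ c f + - 1ℤ * m₄ c f)
        ≡⟨ offdiag-+ (λ c f → pos a * (m₁ c f + m₂ c f) + pos 2 * m₃ c f) (λ c f → - 1ℤ * m₄ c f) ⟩
      offdiag (λ c f → pos a * (m₁ c f + m₂ c f) + pos 2 * m₃ c f) + offdiag (λ c f → - 1ℤ * m₄ c f)
        ≡⟨ cong₂ _+_ (trans (offdiag-+ (λ c f → pos a * (m₁ c f + m₂ c f)) (λ c f → pos 2 * m₃ c f))
             (cong₂ _+_ (trans (offdiag-* (pos a) (λ c f → m₁ c f + m₂ c f)) (cong (λ z → pos a * z) (offdiag-+ m₁ m₂)))
               (trans (offdiag-* (pos 2) m₃) (cong (λ z → pos 2 * z) (offdiag-antidiagonal r (λ k l → mono (j ℕ.+ suc k ℕ.+ 1) (suc i ℕ.+ suc l)))))))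
             (offdiag-* (- 1ℤ) m₄) ⟩
      _ ∎
      where
      m₁ = mono (j ℕ.+ a ℕ.+ 1) (suc i ℕ.+ 0)
      m₂ = mono (j ℕ.+ 0 ℕ.+ 1) (suc i ℕ.+ a)
      m₃ m₄ : Fin K → Fin K → ℤ
      m₃ c f = antidiagonal r (λ k l → mono (j ℕ.+ suc k ℕ.+ 1) (suc i ℕ.+ suc l) c f)
      m₄ c f = ps a L (add (j ℕ.+ 0 ℕ.+ 1) c (add (suc i ℕ.+ 0) f zeros))

-- Evaluation of the sum through power sums

module Value {K : ℕ} (r r′ : ℕ) (L : Func K) (kill : Kill (suc (suc r)) L) (r′< : r′ < suc (suc r)) where

  private
    a b : ℕ
    a = suc (suc r)
    b = suc (suc r′)

    Q : ℕ → ℕ → ℤ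
    Q U V = ps U (ps V L) zeros

    x y : ℤ
    x = ps (a ℕ.+ b) L zeros
    y = Q a b

    Q-zeroˡ : ∀ U V → 1 ≤ U → U < a → Q U V ≡ 0ℤ
    Q-zeroˡ U V p q = Kill-ps {L = L} kill V U p q zeros

    Q-zeroʳ : ∀ U V → 1 ≤ V → V < a → Q U V ≡ 0ℤ
    Q-zeroʳ U V p q = trans (ps-comm U V L zeros) (Q-zeroˡ V U p q)

    q-eval : ∀ {U V U′ V′} → U ≡ U′ → V ≡ V′ → U ℕ.+ V ≡ a ℕ.+ b → offdiag (λ c f → L (add U c (add V f zeros))) ≡ Q U′ V′ - x
    q-eval {U} {V} refl refl e = trans (offdiag-ps L U V) (cong (λ n → Q U V - ps n L zeros) e)

    S₁ S₂ S₃ : ℤ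
    S₁ = antidiagonal r′ λ i j → Q (suc j ℕ.+ a) (suc i)
    S₂ = antidiagonal r′ λ i j → Q (suc j) (suc i ℕ.+ a)
    S₃ = antidiagonal r λ k l → antidiagonal r′ λ i j → Q (suc j ℕ.+ suc k) (suc i ℕ.+ suc l)

  -- A sum over c ≠ f of x_c^U x_f^V is L(p_U p_V) - x. Each of the r′ + 1 pairs (i, j) therefore
  -- contributes -x with multiplicity 2a from the first two monomials and 2(r + 1) from the inner
  -- antidiagonal; its term with p_a contributes +y.
  total-value : total r r′ L ≡ sgn r * (sgn r′ *
    (pos a * (S₁ + S₂) + pos 2 * S₃ + pos (suc r′) * y - pos (suc r′) * (pos 2 * pos a + pos 2 * pos (suc r)) * x))
  total-value = trans (Core.total-eval r r′ L kill r′<) (cong (λ z → sgn r * (sgn r′ * z)) (begin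
    _ ≡⟨ antidiagonal-cong r′ (λ i j e → cong₂ _+_
           (cong₂ (λ u v → pos a * u + pos 2 * v)
             (cong₂ _+_ (q-eval (lem₁ j a) (ℕₚ.+-identityʳ (suc i)) (trans (lem₂ i j a) (sum₁ {i} {j} e)))
                        (q-eval (lem₃ j) refl (trans (lem₄ i j a) (sum₁ {i} {j} e))))
             (antidiagonal-cong r λ k l e′ → q-eval (lem₅ j k) refl (trans (lem₆ i j k l) (trans (cong₂ (λ m n → m ℕ.+ 2 ℕ.+ (n ℕ.+ 2)) e′ e) (lem₇ r r′)))))
           (cong (λ z → - 1ℤ * z) (w-eval i j e))) ⟩
    antidiagonal r′ (λ i j → pos a * (f₁ i j - x + (f₂ i j - x)) + pos 2 * antidiagonal r (λ k l → f₃ i j k l - x) + - 1ℤ * (0ℤ - y))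
      ≡⟨ antidiagonal-cong r′ (λ i j _ → trans (cong (λ z → pos a * (f₁ i j - x + (f₂ i j - x)) + pos 2 * z + - 1ℤ * (0ℤ - y))
           (trans (antidiagonal-+ r (f₃ i j) (λ _ _ → - x)) (cong (λ z → antidiagonal r (f₃ i j) + z) (antidiagonal-const r (- x)))))
           (lem₈ (pos a) (f₁ i j) (f₂ i j) x (antidiagonal r (f₃ i j)) (pos (suc r)) y)) ⟩
    antidiagonal r′ (λ i j → pos a * (f₁ i j + f₂ i j) + pos 2 * antidiagonal r (f₃ i j) + (y - (pos 2 * pos a + pos 2 * pos (suc r)) * x))
      ≡⟨ trans (antidiagonal-+ r′ (λ i j → pos a * (f₁ i j + f₂ i j) + pos 2 * antidiagonal r (f₃ i j)) (λ _ _ → y - (pos 2 * pos a + pos 2 * pos (suc r)) * x))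
           (cong₂ _+_ (trans (antidiagonal-+ r′ (λ i j → pos a * (f₁ i j + f₂ i j)) (λ i j → pos 2 * antidiagonal r (f₃ i j)))
               (cong₂ _+_ (trans (antidiagonal-* r′ (pos a) (λ i j → f₁ i j + f₂ i j)) (cong (λ z → pos a * z) (antidiagonal-+ r′ f₁ f₂)))
                 (trans (antidiagonal-* r′ (pos 2) (λ i j → antidiagonal r (f₃ i j))) (cong (λ z → pos 2 * z) (antidiagonal-swap r′ r f₃)))))
             (antidiagonal-const r′ (y - (pos 2 * pos a + pos 2 * pos (suc r)) * x))) ⟩
    pos a * (S₁ + S₂) + pos 2 * S₃ + pos (suc r′) * (y - (pos 2 * pos a + pos 2 * pos (suc r)) * x)
      ≡⟨ lem₉ (pos a * (S₁ + S₂) + pos 2 * S₃) (pos (suc r′)) y (pos 2 * pos a + pos 2 * pos (suc r)) x ⟩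
    pos a * (S₁ + S₂) + pos 2 * S₃ + pos (suc r′) * y - pos (suc r′) * (pos 2 * pos a + pos 2 * pos (suc r)) * x ∎))
    where
    f₁ f₂ : ℕ → ℕ → ℤ
    f₁ i j = Q (suc j ℕ.+ a) (suc i)
    f₂ i j = Q (suc j) (suc i ℕ.+ a)
    f₃ : ℕ → ℕ → ℕ → ℕ → ℤ
    f₃ i j k l = Q (suc j ℕ.+ suc k) (suc i ℕ.+ suc l)
    lem₁ : ∀ j a → j ℕ.+ a ℕ.+ 1 ≡ suc j ℕ.+ a
    lem₁ = ℕ-solve-∀
    lem₂ : ∀ i j a → j ℕ.+ a ℕ.+ 1 ℕ.+ (suc i ℕ.+ 0) ≡ a ℕ.+ (2 ℕ.+ (i ℕ.+ j))
    lem₂ = ℕ-solve-∀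
    lem₃ : ∀ j → j ℕ.+ 0 ℕ.+ 1 ≡ suc j
    lem₃ = ℕ-solve-∀
    lem₄ : ∀ i j a → j ℕ.+ 0 ℕ.+ 1 ℕ.+ (suc i ℕ.+ a) ≡ a ℕ.+ (2 ℕ.+ (i ℕ.+ j))
    lem₄ = ℕ-solve-∀
    lem₅ : ∀ j k → j ℕ.+ suc k ℕ.+ 1 ≡ suc j ℕ.+ suc k
    lem₅ = ℕ-solve-∀
    lem₆ : ∀ i j k l → j ℕ.+ suc k ℕ.+ 1 ℕ.+ (suc i ℕ.+ suc l) ≡ k ℕ.+ l ℕ.+ 2 ℕ.+ (i ℕ.+ j ℕ.+ 2)
    lem₆ = ℕ-solve-∀
    lem₇ : ∀ r r′ → r ℕ.+ 2 ℕ.+ (r′ ℕ.+ 2) ≡ suc (suc r) ℕ.+ suc (suc r′)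
    lem₇ = ℕ-solve-∀
    lem₁₀ : ∀ i j → j ℕ.+ 0 ℕ.+ 1 ℕ.+ (suc i ℕ.+ 0) ≡ 2 ℕ.+ (i ℕ.+ j)
    lem₁₀ = ℕ-solve-∀
    lem₈ : ∀ a p q x s n y → a * (p - x + (q - x)) + pos 2 * (s + n * - x) + - 1ℤ * (0ℤ - y) ≡
           a * (p + q) + pos 2 * s + (y - (pos 2 * a + pos 2 * n) * x)
    lem₈ = solve-∀
    lem₉ : ∀ s n y z x → s + n * (y - z * x) ≡ s + n * y - n * z * x
    lem₉ = solve-∀
    sum₁ : ∀ {i j} → i ℕ.+ j ≡ r′ → a ℕ.+ (2 ℕ.+ (i ℕ.+ j)) ≡ a ℕ.+ b
    sum₁ e = cong (λ n → a ℕ.+ (2 ℕ.+ n)) e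
    w-eval : ∀ i j → i ℕ.+ j ≡ r′ → offdiag (λ c f → ps a L (add (j ℕ.+ 0 ℕ.+ 1) c (add (suc i ℕ.+ 0) f zeros))) ≡ 0ℤ - y
    w-eval i j e = trans (offdiag-ps (ps a L) (j ℕ.+ 0 ℕ.+ 1) (suc i ℕ.+ 0)) (cong₂ _-_ (triple i j e)
      (trans (cong (λ n → ps n (ps a L) zeros) (trans (lem₁₀ i j) (cong (λ n → 2 ℕ.+ n) e))) (ps-comm b a L zeros)))
      where
      -- One of the two small indices is below a: for i = 0 the factor p₁ occurs, and otherwise j +
      -- 1 ≤ r′ < a.
      triple : ∀ i j → i ℕ.+ j ≡ r′ → ps (j ℕ.+ 0 ℕ.+ 1) (ps (suc i ℕ.+ 0) (ps a L)) zeros ≡ 0ℤ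
      triple zero j e = trans (ps-comm (j ℕ.+ 0 ℕ.+ 1) 1 (ps a L) zeros)
        (Kill-ps {L = ps a L} (Kill-ps {L = L} kill a) (j ℕ.+ 0 ℕ.+ 1) 1 ℕₚ.≤-refl (s≤s (s≤s z≤n)) zeros)
      triple (suc i) j e = Kill-ps {L = ps a L} (Kill-ps {L = L} kill a) (suc (suc i) ℕ.+ 0) (j ℕ.+ 0 ℕ.+ 1)
        (subst (1 ≤_) (sym (lem₃ j)) (s≤s z≤n))
        (subst (_< a) (sym (lem₃ j)) (ℕₚ.≤-<-trans (subst (suc j ≤_) (trans (sym (ℕₚ.+-suc i j)) (trans (ℕₚ.+-suc i j) e)) (s≤s (ℕₚ.m≤n+m j i))) r′<)) zeros

module _ {K : ℕ} (r : ℕ) (L : Func K) (kill : Kill (suc (suc r)) L) where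

  private
    a : ℕ
    a = suc (suc r)

    Q : ℕ → ℕ → ℤ
    Q U V = ps U (ps V L) zeros

    Q-zeroˡ : ∀ U V → 1 ≤ U → U < a → Q U V ≡ 0ℤ
    Q-zeroˡ U V p q = Kill-ps {L = L} kill V U p q zeros

    Q-zeroʳ : ∀ U V → 1 ≤ V → V < a → Q U V ≡ 0ℤ
    Q-zeroʳ U V p q = trans (ps-comm U V L zeros) (Q-zeroˡ V U p q)

  -- In degree 2a a product of two power sums survives only as p_a p_a. So S₁ and S₂ vanish, and in
  -- S₃ each (k, l) keeps the single term i = k. With y = a x and a = r + 2 the bracket is (r +
  -- 1)(3a - 2a - 2(r + 1)) x = -(r + 1) r x.
  total-even : ps a (ps a L) zeros ≡ pos a * ps (a ℕ.+ a) L zeros →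
               total r r L ≡ - (sgn r * sgn r * (pos (suc r) * pos r * ps (a ℕ.+ a) L zeros))
  total-even rel = begin
    total r r L
      ≡⟨ Value.total-value r r L kill (s≤s (ℕₚ.n≤1+n r)) ⟩
    _ ≡⟨ cong₂ (λ u v → sgn r * (sgn r * (pos a * u + pos 2 * v + pos (suc r) * Q a a - pos (suc r) * (pos 2 * pos a + pos 2 * pos (suc r)) * x)))
           (cong₂ _+_ s₁ s₂) s₃ ⟩
    sgn r * (sgn r * (pos a * (0ℤ + 0ℤ) + pos 2 * (pos (suc r) * Q a a) + pos (suc r) * Q a a - pos (suc r) * (pos 2 * pos a + pos 2 * pos (suc r)) * x))
      ≡⟨ cong (λ z → sgn r * (sgn r * (pos a * (0ℤ + 0ℤ) + pos 2 * (pos (suc r) * z) + pos (suc r) * z - pos (suc r) * (pos 2 * pos a + pos 2 * pos (suc r)) * x))) rel ⟩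
    _ ≡⟨ lem (sgn r) (pos r) x ⟩
    - (sgn r * sgn r * (pos (suc r) * pos r * x)) ∎
    where
    x = ps (a ℕ.+ a) L zeros
    lem : ∀ s r x → s * (s * ((1ℤ + (1ℤ + r)) * (0ℤ + 0ℤ) + pos 2 * ((1ℤ + r) * ((1ℤ + (1ℤ + r)) * x)) + (1ℤ + r) * ((1ℤ + (1ℤ + r)) * x)
            - (1ℤ + r) * (pos 2 * (1ℤ + (1ℤ + r)) + pos 2 * (1ℤ + r)) * x)) ≡ - (s * s * ((1ℤ + r) * r * x))
    lem = solve-∀
    s₁ : antidiagonal r (λ i j → Q (suc j ℕ.+ a) (suc i)) ≡ 0ℤ
    s₁ = antidiagonal-zero r λ i j e → Q-zeroʳ (suc j ℕ.+ a) (suc i) (s≤s z≤n) (s≤s (s≤s (subst (i ≤_) e (ℕₚ.m≤m+n i j))))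
    s₂ : antidiagonal r (λ i j → Q (suc j) (suc i ℕ.+ a)) ≡ 0ℤ
    s₂ = antidiagonal-zero r λ i j e → Q-zeroˡ (suc j) (suc i ℕ.+ a) (s≤s z≤n) (s≤s (s≤s (subst (j ≤_) e (ℕₚ.m≤n+m j i))))
    s₃ : antidiagonal r (λ k l → antidiagonal r λ i j → Q (suc j ℕ.+ suc k) (suc i ℕ.+ suc l)) ≡ pos (suc r) * Q a a
    s₃ = trans (antidiagonal-cong r row) (antidiagonal-const r (Q a a))
      where
      row : ∀ k l → k ℕ.+ l ≡ r → antidiagonal r (λ i j → Q (suc j ℕ.+ suc k) (suc i ℕ.+ suc l)) ≡ Q a a
      row k l refl = trans (antidiagonal-single k l (λ i j → Q (suc j ℕ.+ suc k) (suc i ℕ.+ suc l)) off)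
        (cong₂ Q (trans (cong suc (ℕₚ.+-suc l k)) (cong (λ n → suc (suc n)) (ℕₚ.+-comm l k))) (cong suc (ℕₚ.+-suc k l)))
        where
        off : ∀ i j → i ℕ.+ j ≡ k ℕ.+ l → i ≢ k → Q (suc j ℕ.+ suc k) (suc i ℕ.+ suc l) ≡ 0ℤ
        off i j e i≢k with ℕₚ.<-cmp i k
        ... | tri< i<k _ _ = Q-zeroʳ (suc j ℕ.+ suc k) (suc i ℕ.+ suc l) (s≤s z≤n)
                (s≤s (subst (_< suc (k ℕ.+ l)) (sym (ℕₚ.+-suc i l)) (s≤s (ℕₚ.+-monoˡ-< l i<k))))
        ... | tri≈ _ i≡k _ = ⊥-elim (i≢k i≡k)
        ... | tri> _ _ k<i = Q-zeroˡ (suc j ℕ.+ suc k) (suc i ℕ.+ suc l) (s≤s z≤n)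
                (s≤s (subst₂ _<_ (trans (ℕₚ.+-comm (suc k) j) refl) (cong suc e) (s≤s (ℕₚ.+-monoˡ-≤ j k<i))))

  -- In degree 2a + 1 the survivors are p_a p_(a+1) in either order: one term in each of S₁ and S₂,
  -- and for each (k, l) the terms i = k and i = k + 1 of S₃. The factor deg lets the relation
  -- eliminate y without division, and the rest is a ((7a - 4)(a + 1) - (2a + 1)(4a - 2)) x = -a (a
  -- - 1)(a - 2) x.
  total-odd : pos a * pos (suc a) * ps (a ℕ.+ suc a) L zeros ≡ pos (a ℕ.+ suc a) * ps a (ps (suc a) L) zeros →
              pos (a ℕ.+ suc a) * total r (suc r) L ≡
              - (sgn r * sgn (suc r) * (pos a * pos (suc r) * pos r * ps (a ℕ.+ suc a) L zeros))
  total-odd rel = begin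
    deg * total r (suc r) L
      ≡⟨ cong (λ z → deg * z) (Value.total-value r (suc r) L kill ℕₚ.≤-refl) ⟩
    _ ≡⟨ cong₂ (λ u v → deg * (sgn r * (sgn (suc r) * (pos a * u + pos 2 * v + pos a * y - pos a * (pos 2 * pos a + pos 2 * pos (suc r)) * x))))
           (cong₂ _+_ s₁ s₂) s₃ ⟩
    deg * (sgn r * (sgn (suc r) * (pos a * (y + y) + pos 2 * (pos (suc r) * (y + y)) + pos a * y - pos a * (pos 2 * pos a + pos 2 * pos (suc r)) * x)))
      ≡⟨ lem₁ deg (sgn r) (sgn (suc r)) (pos a) (pos (suc r)) x y ⟩
    sgn r * sgn (suc r) * ((pos a * pos 3 + pos 4 * pos (suc r)) * (deg * y) - deg * (pos a * (pos 2 * pos a + pos 2 * pos (suc r)) * x))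
      ≡⟨ cong₂ (λ u v → sgn r * sgn (suc r) * ((pos a * pos 3 + pos 4 * pos (suc r)) * u - v * (pos a * (pos 2 * pos a + pos 2 * pos (suc r)) * x)))
           (sym rel) (ℤₚ.pos-+ a (suc a)) ⟩
    sgn r * sgn (suc r) * ((pos a * pos 3 + pos 4 * pos (suc r)) * (pos a * pos (suc a) * x) - (pos a + pos (suc a)) * (pos a * (pos 2 * pos a + pos 2 * pos (suc r)) * x))
      ≡⟨ lem₂ (sgn r * sgn (suc r)) (pos r) x ⟩
    - (sgn r * sgn (suc r) * (pos a * pos (suc r) * pos r * x)) ∎
    where
    deg = pos (a ℕ.+ suc a)
    x = ps (a ℕ.+ suc a) L zeros
    y = Q a (suc a)
    lem₁ : ∀ n s t a r x y → n * (s * (t * (a * (y + y) + pos 2 * (r * (y + y)) + a * y - a * (pos 2 * a + pos 2 * r) * x))) ≡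
           s * t * ((a * pos 3 + pos 4 * r) * (n * y) - n * (a * (pos 2 * a + pos 2 * r) * x))
    lem₁ = solve-∀
    lem₂ : ∀ s r x → s * (((1ℤ + (1ℤ + r)) * pos 3 + pos 4 * (1ℤ + r)) * ((1ℤ + (1ℤ + r)) * (1ℤ + (1ℤ + (1ℤ + r))) * x)
            - ((1ℤ + (1ℤ + r)) + (1ℤ + (1ℤ + (1ℤ + r)))) * ((1ℤ + (1ℤ + r)) * (pos 2 * (1ℤ + (1ℤ + r)) + pos 2 * (1ℤ + r)) * x)) ≡
           - (s * ((1ℤ + (1ℤ + r)) * (1ℤ + r) * r * x))
    lem₂ = solve-∀
    s₁ : antidiagonal (suc r) (λ i j → Q (suc j ℕ.+ a) (suc i)) ≡ y
    s₁ = trans (cong (λ n → antidiagonal n (λ i j → Q (suc j ℕ.+ a) (suc i))) (sym (ℕₚ.+-identityʳ (suc r))))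
      (trans (antidiagonal-single (suc r) 0 (λ i j → Q (suc j ℕ.+ a) (suc i)) off) (ps-comm (suc a) a L zeros))
      where
      off : ∀ i j → i ℕ.+ j ≡ suc r ℕ.+ 0 → i ≢ suc r → Q (suc j ℕ.+ a) (suc i) ≡ 0ℤ
      off i j e i≢ = Q-zeroʳ (suc j ℕ.+ a) (suc i) (s≤s z≤n)
        (s≤s (ℕₚ.≤∧≢⇒< (subst (i ≤_) (trans e (ℕₚ.+-identityʳ (suc r))) (ℕₚ.m≤m+n i j)) i≢))
    s₂ : antidiagonal (suc r) (λ i j → Q (suc j) (suc i ℕ.+ a)) ≡ y
    s₂ = antidiagonal-single 0 (suc r) (λ i j → Q (suc j) (suc i ℕ.+ a)) off
      where
      off : ∀ i j → i ℕ.+ j ≡ suc r → i ≢ 0 → Q (suc j) (suc i ℕ.+ a) ≡ 0ℤ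
      off zero    j e i≢ = ⊥-elim (i≢ refl)
      off (suc i) j e i≢ = Q-zeroˡ (suc j) (suc (suc i) ℕ.+ a) (s≤s z≤n) (s≤s (s≤s (subst (j ≤_) (ℕₚ.suc-injective e) (ℕₚ.m≤n+m j i))))
    s₃ : antidiagonal r (λ k l → antidiagonal (suc r) λ i j → Q (suc j ℕ.+ suc k) (suc i ℕ.+ suc l)) ≡ pos (suc r) * (y + y)
    s₃ = trans (antidiagonal-cong r row) (antidiagonal-const r (y + y))
      where
      row : ∀ k l → k ℕ.+ l ≡ r → antidiagonal (suc r) (λ i j → Q (suc j ℕ.+ suc k) (suc i ℕ.+ suc l)) ≡ y + y
      row k l refl = trans (antidiagonal-double k l (λ i j → Q (suc j ℕ.+ suc k) (suc i ℕ.+ suc l)) off)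
        (cong₂ _+_ (trans (cong₂ Q (lem₃ k l) (lem₄ k l)) (ps-comm (suc a) a L zeros)) (cong₂ Q (lem₅ k l) (lem₆ k l)))
        where
        lem₃ : ∀ k l → suc (suc l) ℕ.+ suc k ≡ suc (suc (suc (k ℕ.+ l)))
        lem₃ = ℕ-solve-∀
        lem₄ : ∀ k l → suc k ℕ.+ suc l ≡ suc (suc (k ℕ.+ l))
        lem₄ = ℕ-solve-∀
        lem₅ : ∀ k l → suc l ℕ.+ suc k ≡ suc (suc (k ℕ.+ l))
        lem₅ = ℕ-solve-∀
        lem₆ : ∀ k l → suc (suc k) ℕ.+ suc l ≡ suc (suc (suc (k ℕ.+ l)))
        lem₆ = ℕ-solve-∀
        off : ∀ i j → i ℕ.+ j ≡ suc (k ℕ.+ l) → i ≢ k → i ≢ suc k → Q (suc j ℕ.+ suc k) (suc i ℕ.+ suc l) ≡ 0ℤ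
        off i j e i≢k i≢k+1 with ℕₚ.<-cmp i k
        ... | tri< i<k _ _ = Q-zeroʳ (suc j ℕ.+ suc k) (suc i ℕ.+ suc l) (s≤s z≤n)
                (s≤s (subst (_< suc (k ℕ.+ l)) (sym (ℕₚ.+-suc i l)) (s≤s (ℕₚ.+-monoˡ-< l i<k))))
        ... | tri≈ _ i≡k _ = ⊥-elim (i≢k i≡k)
        ... | tri> _ _ k<i = Q-zeroˡ (suc j ℕ.+ suc k) (suc i ℕ.+ suc l) (s≤s z≤n)
                (s≤s (subst₂ _≤_ (cong suc (ℕₚ.+-comm (suc k) j)) e (ℕₚ.+-monoˡ-≤ j (ℕₚ.≤∧≢⇒< k<i (i≢k+1 ∘ sym)))))

-- Construction of the functional

zc nz : Vec ℕ K → ℕ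
zc []          = 0
zc (zero  ∷ γ) = suc (zc γ)
zc (suc n ∷ γ) = zc γ
nz []          = 0
nz (zero  ∷ γ) = nz γ
nz (suc n ∷ γ) = suc (nz γ)

zc+nz : (γ : Vec ℕ K) → zc γ ℕ.+ nz γ ≡ K
zc+nz []          = refl
zc+nz (zero  ∷ γ) = cong suc (zc+nz γ)
zc+nz (suc n ∷ γ) = trans (ℕₚ.+-suc (zc γ) (nz γ)) (cong suc (zc+nz γ))

nz≤sum : (γ : Vec ℕ K) → nz γ ≤ Vec.sum γ
nz≤sum []          = z≤n
nz≤sum (zero  ∷ γ) = nz≤sum γ
nz≤sum (suc n ∷ γ) = s≤s (ℕₚ.≤-trans (nz≤sum γ) (ℕₚ.m≤n+m _ n))

nz≡0⇒sum≡0 : (γ : Vec ℕ K) → nz γ ≡ 0 → Vec.sum γ ≡ 0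
nz≡0⇒sum≡0 []         e = refl
nz≡0⇒sum≡0 (zero ∷ γ) e = nz≡0⇒sum≡0 γ e

-- Raising a coordinate either turns a zero entry into a nonzero one or keeps both counts, so on
-- functions of the degree and the counts p_(i+1) acts by a two-term recursion. `G` is arbitrary
-- because the induction absorbs the first coordinate into it.
ps-count : ∀ i (G : ℕ → ℕ → ℕ → ℤ) (γ : Vec ℕ K) →
           ps (suc i) (λ γ → G (Vec.sum γ) (zc γ) (nz γ)) γ ≡
           pos (zc γ) * G (suc i ℕ.+ Vec.sum γ) (ℕ.pred (zc γ)) (suc (nz γ))
           + pos (nz γ) * G (suc i ℕ.+ Vec.sum γ) (zc γ) (nz γ)
ps-count i G [] = refl
ps-count i G (zero ∷ γ) = begin
  G (suc i ℕ.+ 0 ℕ.+ Vec.sum γ) (zc γ) (suc (nz γ)) + ps (suc i) (λ γ → G (Vec.sum γ) (suc (zc γ)) (nz γ)) γ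
    ≡⟨ cong₂ (λ n z → G (n ℕ.+ Vec.sum γ) (zc γ) (suc (nz γ)) + z) (ℕₚ.+-identityʳ (suc i)) (ps-count i (λ s z l → G s (suc z) l) γ) ⟩
  A + (pos (zc γ) * G s (suc (ℕ.pred (zc γ))) (suc (nz γ)) + B)
    ≡⟨ cong (λ z → A + (z + B)) (suc-pred (zc γ)) ⟩
  A + (pos (zc γ) * A + B)
    ≡⟨ lem A (pos (zc γ)) B ⟩
  pos (suc (zc γ)) * A + B ∎
  where
  s = suc i ℕ.+ Vec.sum γ
  A = G s (zc γ) (suc (nz γ))
  B = pos (nz γ) * G s (suc (zc γ)) (nz γ)
  suc-pred : ∀ z → pos z * G s (suc (ℕ.pred z)) (suc (nz γ)) ≡ pos z * G s z (suc (nz γ))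
  suc-pred zero    = refl
  suc-pred (suc z) = refl
  lem : ∀ x z y → x + (z * x + y) ≡ (1ℤ + z) * x + y
  lem = solve-∀
ps-count i G (suc n ∷ γ) = begin
  G (suc i ℕ.+ suc n ℕ.+ Vec.sum γ) (zc γ) (suc (nz γ)) + ps (suc i) (λ γ → G (suc n ℕ.+ Vec.sum γ) (zc γ) (suc (nz γ))) γ
    ≡⟨ cong (λ z → G (suc i ℕ.+ suc n ℕ.+ Vec.sum γ) (zc γ) (suc (nz γ)) + z) (ps-count i (λ s z l → G (suc n ℕ.+ s) z (suc l)) γ) ⟩
  G (suc i ℕ.+ suc n ℕ.+ Vec.sum γ) (zc γ) (suc (nz γ)) + (pos (zc γ) * G s′ (ℕ.pred (zc γ)) (suc (suc (nz γ))) + pos (nz γ) * G s′ (zc γ) (suc (nz γ)))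
    ≡⟨ cong₂ (λ s t → G s (zc γ) (suc (nz γ)) + (pos (zc γ) * G t (ℕ.pred (zc γ)) (suc (suc (nz γ))) + pos (nz γ) * G t (zc γ) (suc (nz γ))))
         (ℕₚ.+-assoc (suc i) (suc n) (Vec.sum γ)) (shuffle i n (Vec.sum γ)) ⟩
  A + (B + pos (nz γ) * A)
    ≡⟨ lem A B (pos (nz γ)) ⟩
  B + pos (suc (nz γ)) * A ∎
  where
  s = suc i ℕ.+ (suc n ℕ.+ Vec.sum γ)
  s′ = suc n ℕ.+ (suc i ℕ.+ Vec.sum γ)
  A = G s (zc γ) (suc (nz γ))
  B = pos (zc γ) * G s (ℕ.pred (zc γ)) (suc (suc (nz γ)))
  shuffle : ∀ i n s → suc n ℕ.+ (suc i ℕ.+ s) ≡ suc i ℕ.+ (suc n ℕ.+ s)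
  shuffle = ℕ-solve-∀
  lem : ∀ x y z → x + (y + z * x) ≡ y + (1ℤ + z) * x
  lem = solve-∀

weight : ℕ → ℕ → ℤ
weight z zero    = 0ℤ
weight z (suc l) = sgn l * pos (z ! ℕ.* l !)

-- Both terms are (z + 1)! (l + 1)! up to sign, and the signs are opposite.
weight-balance : ∀ z l → pos (suc z) * weight z (suc (suc l)) + pos (suc l) * weight (suc z) (suc l) ≡ 0ℤ
weight-balance z l = begin
  pos (suc z) * (- sgn l * pos (z ! ℕ.* (suc l ℕ.* l !))) + pos (suc l) * (sgn l * pos (suc z ℕ.* z ! ℕ.* l !))
    ≡⟨ cong₂ (λ u v → pos (suc z) * (- sgn l * u) + pos (suc l) * (sgn l * v))
         (trans (ℤₚ.pos-* (z !) (suc l ℕ.* l !)) (cong (λ w → pos (z !) * w) (ℤₚ.pos-* (suc l) (l !))))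
         (trans (ℤₚ.pos-* (suc z ℕ.* z !) (l !)) (cong (λ w → w * pos (l !)) (ℤₚ.pos-* (suc z) (z !)))) ⟩
  pos (suc z) * (- sgn l * (pos (z !) * (pos (suc l) * pos (l !)))) + pos (suc l) * (sgn l * (pos (suc z) * pos (z !) * pos (l !)))
    ≡⟨ lem (pos (suc z)) (sgn l) (pos (z !)) (pos (suc l)) (pos (l !)) ⟩
  0ℤ ∎
  where
  lem : ∀ z s p l q → z * (- s * (p * (l * q))) + l * (s * (z * p * q)) ≡ 0ℤ
  lem = solve-∀

-- The augmented monomial symmetric function with l parts is a sum of K!/z! monomials, where
-- z = K - l, so lev d takes the value K! (-1)^(l-1) (l-1)! on it: K! times its coefficient of p_d.
lev : ℕ → Func K
lev d γ = 𝟙 (Vec.sum γ ≡ᵇ d) * weight (zc γ) (nz γ)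

≡ᵇ-refl : ∀ n → (n ≡ᵇ n) ≡ true
≡ᵇ-refl zero    = refl
≡ᵇ-refl (suc n) = ≡ᵇ-refl n

≢⇒≡ᵇ-false : ∀ {m n} → m ≢ n → (m ≡ᵇ n) ≡ false
≢⇒≡ᵇ-false {zero}  {zero}  p = ⊥-elim (p refl)
≢⇒≡ᵇ-false {zero}  {suc n} p = refl
≢⇒≡ᵇ-false {suc m} {zero}  p = refl
≢⇒≡ᵇ-false {suc m} {suc n} p = ≢⇒≡ᵇ-false (p ∘ cong suc)

Supp-lev : ∀ d → Supp {K} d (lev d)
Supp-lev d γ p = trans (cong (λ b → 𝟙 b * weight (zc γ) (nz γ)) (≢⇒≡ᵇ-false p)) (ℤₚ.*-zeroˡ (weight (zc γ) (nz γ)))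

ps-lev : ∀ i d (γ : Vec ℕ K) → ps (suc i) (lev d) γ ≡ 𝟙 (suc i ℕ.+ Vec.sum γ ≡ᵇ d) *
         (pos (zc γ) * weight (ℕ.pred (zc γ)) (suc (nz γ)) + pos (nz γ) * weight (zc γ) (nz γ))
ps-lev i d γ = trans (ps-count i (λ s z l → 𝟙 (s ≡ᵇ d) * weight z l) γ)
  (lem (𝟙 (suc i ℕ.+ Vec.sum γ ≡ᵇ d)) (pos (zc γ)) (weight (ℕ.pred (zc γ)) (suc (nz γ))) (pos (nz γ)) (weight (zc γ) (nz γ)))
  where
  lem : ∀ b z x l y → z * (b * x) + l * (b * y) ≡ b * (z * x + l * y)
  lem = solve-∀

-- `weight-balance` applies unless one of the counts is zero. No nonzero entry would force i = d,
-- against i < a ≤ d for the index i of the power sum. No zero entry would give γ degree at least K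
-- ≥ d, although that degree is d - i.
Kill-lev : ∀ {a} d → a ≤ d → d ≤ K → Kill {K} a (lev d)
Kill-lev {K} d a≤d d≤K (suc i) _ i<a γ = trans (ps-lev i d γ) (go (suc i ℕ.+ Vec.sum γ ℕ.≟ d))
  where
  s = pos (zc γ) * weight (ℕ.pred (zc γ)) (suc (nz γ)) + pos (nz γ) * weight (zc γ) (nz γ)
  go : _ → 𝟙 (suc i ℕ.+ Vec.sum γ ≡ᵇ d) * s ≡ 0ℤ
  go (no  p) = trans (cong (λ b → 𝟙 b * s) (≢⇒≡ᵇ-false p)) (ℤₚ.*-zeroˡ s)
  go (yes p) = trans (cong (λ z → 𝟙 (suc i ℕ.+ Vec.sum γ ≡ᵇ d) * z) (balance (zc γ) (nz γ) refl refl)) (ℤₚ.*-zeroʳ (𝟙 (suc i ℕ.+ Vec.sum γ ≡ᵇ d)))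
    where
    balance : ∀ z l → zc γ ≡ z → nz γ ≡ l → pos z * weight (ℕ.pred z) (suc l) + pos l * weight z l ≡ 0ℤ
    balance z zero e e′ = ⊥-elim (ℕₚ.n≮n (suc i) (subst (suc i <_) (trans (sym p)
      (trans (cong (λ n → suc i ℕ.+ n) (nz≡0⇒sum≡0 γ e′)) (ℕₚ.+-identityʳ (suc i)))) (ℕₚ.<-≤-trans i<a a≤d)))
    balance zero (suc l) e e′ = ⊥-elim (ℕₚ.n≮n d (ℕₚ.≤-<-trans (ℕₚ.≤-trans d≤K
      (subst (_≤ Vec.sum γ) (trans (sym (cong (ℕ._+ nz γ) e)) (zc+nz γ)) (nz≤sum γ))) (subst (Vec.sum γ <_) p (s≤s (ℕₚ.m≤n+m _ i)))))
    balance (suc z) (suc l) e e′ = weight-balance z l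

zc-zeros : ∀ K → zc (zeros {K}) ≡ K
zc-zeros zero    = refl
zc-zeros (suc K) = cong suc (zc-zeros K)

nz-zeros : ∀ K → nz (zeros {K}) ≡ 0
nz-zeros zero    = refl
nz-zeros (suc K) = nz-zeros K

ps-lev-zeros : ∀ K i → ps (suc i) (lev (suc i)) (zeros {suc K}) ≡ pos (suc K !)
ps-lev-zeros K i = begin
  ps (suc i) (lev (suc i)) (zeros {suc K})
    ≡⟨ ps-lev i (suc i) (zeros {suc K}) ⟩
  𝟙 (suc i ℕ.+ Vec.sum (zeros {K}) ≡ᵇ suc i) * (pos (suc (zc (zeros {K}))) * weight (zc (zeros {K})) (suc (nz (zeros {K}))) + pos (nz (zeros {K})) * weight (suc (zc (zeros {K}))) (nz (zeros {K})))
    ≡⟨ cong₂ (λ z l → 𝟙 (suc i ℕ.+ Vec.sum (zeros {K}) ≡ᵇ suc i) * (pos (suc z) * weight z (suc l) + pos l * weight (suc z) l)) (zc-zeros K) (nz-zeros K) ⟩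
  𝟙 (suc i ℕ.+ Vec.sum (zeros {K}) ≡ᵇ suc i) * (pos (suc K) * weight K 1 + 0ℤ)
    ≡⟨ cong (λ b → 𝟙 b * (pos (suc K) * weight K 1 + 0ℤ))
         (trans (cong (_≡ᵇ i) (trans (cong (i ℕ.+_) (sum-zeros K)) (ℕₚ.+-identityʳ i))) (≡ᵇ-refl i)) ⟩
  1ℤ * (pos (suc K) * (1ℤ * pos (K ! ℕ.* 1)) + 0ℤ)
    ≡⟨ lem (pos (suc K)) _ ⟩
  pos (suc K) * pos (K ! ℕ.* 1)
    ≡⟨ cong (λ n → pos (suc K) * pos n) (ℕₚ.*-identityʳ (K !)) ⟩
  pos (suc K) * pos (K !)
    ≡⟨ ℤₚ.pos-* (suc K) (K !) ⟨
  pos (suc K !) ∎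
  where
  lem : ∀ x y → 1ℤ * (x * (1ℤ * y) + 0ℤ) ≡ x * y
  lem = solve-∀

ps-lev-other : ∀ K i d → suc i ≢ d → ps (suc i) (lev d) (zeros {K}) ≡ 0ℤ
ps-lev-other K i d p = trans (ps-lev i d (zeros {K}))
  (trans (cong (λ b → 𝟙 b * s) (≢⇒≡ᵇ-false (p ∘ trans (sym (trans (cong (suc i ℕ.+_) (sum-zeros K)) (ℕₚ.+-identityʳ (suc i))))))) (ℤₚ.*-zeroˡ s))
  where
  s = pos (zc (zeros {K})) * weight (ℕ.pred (zc (zeros {K}))) (suc (nz (zeros {K}))) + pos (nz (zeros {K})) * weight (zc (zeros {K})) (nz (zeros {K}))

-- Products of functionals on two disjoint blocks of variables

infixl 7 _⊗_
_⊗_ : Func K₁ → Func K₂ → Func (K₁ ℕ.+ K₂)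
_⊗_ {zero}   L₁ L₂ γ       = L₁ [] * L₂ γ
_⊗_ {suc K₁} L₁ L₂ (n ∷ γ) = ((L₁ ∘ (n ∷_)) ⊗ L₂) γ

⊗-zeroˡ : {L₁ : Func K₁} (L₂ : Func K₂) → (∀ γ → L₁ γ ≡ 0ℤ) → ∀ γ → (L₁ ⊗ L₂) γ ≡ 0ℤ
⊗-zeroˡ {zero}   L₂ e γ       = trans (cong (λ z → z * L₂ γ) (e [])) (ℤₚ.*-zeroˡ (L₂ γ))
⊗-zeroˡ {suc K₁} L₂ e (n ∷ γ) = ⊗-zeroˡ L₂ (e ∘ (n ∷_)) γ

⊗-zeroʳ : (L₁ : Func K₁) {L₂ : Func K₂} → (∀ γ → L₂ γ ≡ 0ℤ) → ∀ γ → (L₁ ⊗ L₂) γ ≡ 0ℤ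
⊗-zeroʳ {zero}   L₁ e γ       = trans (cong (λ z → L₁ [] * z) (e γ)) (ℤₚ.*-zeroʳ (L₁ []))
⊗-zeroʳ {suc K₁} L₁ e (n ∷ γ) = ⊗-zeroʳ (L₁ ∘ (n ∷_)) e γ

⊗-+ˡ : (L₁ L₁′ : Func K₁) (L₂ : Func K₂) → ∀ γ → ((λ δ → L₁ δ + L₁′ δ) ⊗ L₂) γ ≡ (L₁ ⊗ L₂) γ + (L₁′ ⊗ L₂) γ
⊗-+ˡ {zero}   L₁ L₁′ L₂ γ       = ℤₚ.*-distribʳ-+ (L₂ γ) (L₁ []) (L₁′ [])
⊗-+ˡ {suc K₁} L₁ L₁′ L₂ (n ∷ γ) = ⊗-+ˡ (L₁ ∘ (n ∷_)) (L₁′ ∘ (n ∷_)) L₂ γ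

⊗-zeros : (L₁ : Func K₁) (L₂ : Func K₂) → (L₁ ⊗ L₂) zeros ≡ L₁ zeros * L₂ zeros
⊗-zeros {zero}   L₁ L₂ = refl
⊗-zeros {suc K₁} L₁ L₂ = ⊗-zeros (L₁ ∘ (0 ∷_)) L₂

-- A power sum is the sum of the power sums of the two blocks, so it acts as a derivation.
ps-⊗ : ∀ i (L₁ : Func K₁) (L₂ : Func K₂) γ → ps i (L₁ ⊗ L₂) γ ≡ (ps i L₁ ⊗ L₂) γ + (L₁ ⊗ ps i L₂) γ
ps-⊗ {zero} i L₁ L₂ γ = trans (∑-* (L₁ []) (λ c → L₂ (add i c γ))) (lem (L₁ [] * ps i L₂ γ) (L₂ γ))
  where
  lem : ∀ x y → x ≡ 0ℤ * y + x
  lem = solve-∀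
ps-⊗ {suc K₁} i L₁ L₂ (n ∷ γ) = begin
  A + ps i ((L₁ ∘ (n ∷_)) ⊗ L₂) γ
    ≡⟨ cong (λ z → A + z) (ps-⊗ i (L₁ ∘ (n ∷_)) L₂ γ) ⟩
  A + ((ps i (L₁ ∘ (n ∷_)) ⊗ L₂) γ + ((L₁ ∘ (n ∷_)) ⊗ ps i L₂) γ)
    ≡⟨ ℤₚ.+-assoc A _ _ ⟨
  A + (ps i (L₁ ∘ (n ∷_)) ⊗ L₂) γ + ((L₁ ∘ (n ∷_)) ⊗ ps i L₂) γ
    ≡⟨ cong (λ z → z + ((L₁ ∘ (n ∷_)) ⊗ ps i L₂) γ) (⊗-+ˡ (L₁ ∘ ((i ℕ.+ n) ∷_)) (ps i (L₁ ∘ (n ∷_))) L₂ γ) ⟨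
  (ps i L₁ ⊗ L₂) (n ∷ γ) + (L₁ ⊗ ps i L₂) (n ∷ γ) ∎
  where
  A = ((L₁ ∘ ((i ℕ.+ n) ∷_)) ⊗ L₂) γ

⊗-vanish : ∀ s d₁ d₂ (L₁ : Func K₁) (L₂ : Func K₂) → (∀ γ → s ℕ.+ Vec.sum γ ≢ d₁ → L₁ γ ≡ 0ℤ) → Supp d₂ L₂ →
           ∀ γ → s ℕ.+ Vec.sum γ ≢ d₁ ℕ.+ d₂ → (L₁ ⊗ L₂) γ ≡ 0ℤ
⊗-vanish {zero} s d₁ d₂ L₁ L₂ h₁ h₂ γ p with s ℕ.+ 0 ℕ.≟ d₁
... | no  s≢ = trans (cong (λ z → z * L₂ γ) (h₁ [] s≢)) (ℤₚ.*-zeroˡ (L₂ γ))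
... | yes refl = trans (cong (λ z → L₁ [] * z) (h₂ γ λ e → p (cong₂ ℕ._+_ (sym (ℕₚ.+-identityʳ s)) e))) (ℤₚ.*-zeroʳ (L₁ []))
⊗-vanish {suc K₁} s d₁ d₂ L₁ L₂ h₁ h₂ (n ∷ γ) p = ⊗-vanish (s ℕ.+ n) d₁ d₂ (L₁ ∘ (n ∷_)) L₂
  (λ δ q → h₁ (n ∷ δ) (q ∘ trans (ℕₚ.+-assoc s n _))) h₂ γ (p ∘ trans (sym (ℕₚ.+-assoc s n _)))

Kill-⊗ : ∀ {a} {L₁ : Func K₁} {L₂ : Func K₂} → Kill a L₁ → Kill a L₂ → Kill a (L₁ ⊗ L₂)
Kill-⊗ {L₁ = L₁} {L₂} k₁ k₂ i p q γ = trans (ps-⊗ i L₁ L₂ γ)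
  (cong₂ _+_ (⊗-zeroˡ L₂ (k₁ i p q) γ) (⊗-zeroʳ L₁ (k₂ i p q) γ))

Kill-+ : ∀ {a} {L L′ : Func K} → Kill a L → Kill a L′ → Kill a (λ γ → L γ + L′ γ)
Kill-+ {L = L} {L′} k k′ i p q γ = trans (∑-distrib-+ (λ c → L (add i c γ)) (λ c → L′ (add i c γ))) (cong₂ _+_ (k i p q γ) (k′ i p q γ))

ps-+ : ∀ i (L L′ : Func K) γ → ps i (λ γ → L γ + L′ γ) γ ≡ ps i L γ + ps i L′ γ
ps-+ i L L′ γ = ∑-distrib-+ (λ c → L (add i c γ)) (λ c → L′ (add i c γ))

ps-* : ∀ i x (L : Func K) γ → ps i (λ γ → x * L γ) γ ≡ x * ps i L γ
ps-* i x L γ = ∑-* x (λ c → L (add i c γ))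

Supp-zeros : ∀ d (L : Func K) → Supp (suc d) L → L zeros ≡ 0ℤ
Supp-zeros {K} d L s = s zeros λ e → ℕₚ.1+n≢0 (trans (sym e) (sum-zeros K))

-- If both power sums act on the same block, the other functional is evaluated at 1, where it
-- vanishes for reasons of degree.
ps-ps-⊗ : ∀ i j d₁ d₂ (L₁ : Func K₁) (L₂ : Func K₂) → Supp (suc d₁) L₁ → Supp (suc d₂) L₂ →
          ps i (ps j (L₁ ⊗ L₂)) zeros ≡ ps j L₁ zeros * ps i L₂ zeros + ps i L₁ zeros * ps j L₂ zeros
ps-ps-⊗ i j d₁ d₂ L₁ L₂ s₁ s₂ = begin
  ps i (ps j (L₁ ⊗ L₂)) zeros
    ≡⟨ ps-cong i (ps-⊗ j L₁ L₂) zeros ⟩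
  ps i (λ γ → (ps j L₁ ⊗ L₂) γ + (L₁ ⊗ ps j L₂) γ) zeros
    ≡⟨ ps-+ i (ps j L₁ ⊗ L₂) (L₁ ⊗ ps j L₂) zeros ⟩
  ps i (ps j L₁ ⊗ L₂) zeros + ps i (L₁ ⊗ ps j L₂) zeros
    ≡⟨ cong₂ _+_ (ps-⊗ i (ps j L₁) L₂ zeros) (ps-⊗ i L₁ (ps j L₂) zeros) ⟩
  (ps i (ps j L₁) ⊗ L₂) zeros + (ps j L₁ ⊗ ps i L₂) zeros + ((ps i L₁ ⊗ ps j L₂) zeros + (L₁ ⊗ ps i (ps j L₂)) zeros)
    ≡⟨ cong₂ _+_ (cong₂ _+_ (trans (⊗-zeros (ps i (ps j L₁)) L₂) (cong (λ z → ps i (ps j L₁) zeros * z) (Supp-zeros d₂ L₂ s₂))) (⊗-zeros (ps j L₁) (ps i L₂)))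
                 (cong₂ _+_ (⊗-zeros (ps i L₁) (ps j L₂)) (trans (⊗-zeros L₁ (ps i (ps j L₂))) (cong (λ z → z * ps i (ps j L₂) zeros) (Supp-zeros d₁ L₁ s₁)))) ⟩
  ps i (ps j L₁) zeros * 0ℤ + ps j L₁ zeros * ps i L₂ zeros + (ps i L₁ zeros * ps j L₂ zeros + 0ℤ * ps i (ps j L₂) zeros)
    ≡⟨ lem (ps i (ps j L₁) zeros) (ps j L₁ zeros * ps i L₂ zeros) (ps i L₁ zeros * ps j L₂ zeros) (ps i (ps j L₂) zeros) ⟩
  ps j L₁ zeros * ps i L₂ zeros + ps i L₁ zeros * ps j L₂ zeros ∎
  where
  lem : ∀ x y z w → x * 0ℤ + y + (z + 0ℤ * w) ≡ y + z
  lem = solve-∀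

-- P extracts p_a from the first a variables and p_b from the last b, whereas lev deg extracts p_(a+b);
-- functional-even and functional-odd choose u and v such that the combination vanishes on e_(a+b).
module Mixed (a′ b′ : ℕ) (a≤b : a′ ≤ b′) (u v : ℤ) where

  private
    a b deg : ℕ
    a = suc a′
    b = suc b′
    deg = a ℕ.+ b

    P : Func deg
    P = _⊗_ {a} {b} (lev a) (lev b)

  mixed : Func deg
  mixed γ = u * P γ + v * lev deg γ

  Kill-mixed : Kill a mixed
  Kill-mixed = Kill-+ {L = λ γ → u * P γ} {λ γ → v * lev deg γ} (Kill-* {L = P} u (Kill-⊗ {L₁ = lev a} {lev b} (Kill-lev a ℕₚ.≤-refl ℕₚ.≤-refl) (Kill-lev b (s≤s a≤b) ℕₚ.≤-refl)))
    (Kill-* {L = lev deg} v (Kill-lev deg (ℕₚ.m≤m+n a b) ℕₚ.≤-refl))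

  Supp-mixed : Supp deg mixed
  Supp-mixed γ p = trans
    (cong₂ (λ x y → u * x + v * y) (⊗-vanish {a} {b} 0 a b (lev a) (lev b) (Supp-lev a) (Supp-lev b) γ p) (Supp-lev deg γ p))
    (lem u v)
    where
    lem : ∀ u v → u * 0ℤ + v * 0ℤ ≡ 0ℤ
    lem = solve-∀

  ps-mixed : ∀ i γ → ps i mixed γ ≡ u * ps i P γ + v * ps i (lev deg) γ
  ps-mixed i γ = trans (ps-+ i (λ γ → u * P γ) (λ γ → v * lev deg γ) γ) (cong₂ _+_ (ps-* i u P γ) (ps-* i v (lev deg) γ))

  top-mixed : ps deg mixed zeros ≡ v * pos (deg !)
  top-mixed = begin
    ps deg mixed zeros                           ≡⟨ ps-mixed deg (zeros {deg}) ⟩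
    u * ps deg P zeros + v * ps deg (lev deg) (zeros {deg})  ≡⟨ cong₂ (λ x y → u * x + v * y) P-zero (ps-lev-zeros (a′ ℕ.+ b) (a′ ℕ.+ b)) ⟩
    u * 0ℤ + v * pos (deg !)                     ≡⟨ lem u (v * pos (deg !)) ⟩
    v * pos (deg !)                              ∎
    where
    lem : ∀ u x → u * 0ℤ + x ≡ x
    lem = solve-∀
    P-zero : ps deg P zeros ≡ 0ℤ
    P-zero = begin
      ps deg P zeros
        ≡⟨ ps-⊗ {a} {b} deg (lev a) (lev b) zeros ⟩
      (_⊗_ {a} {b} (ps deg (lev a)) (lev b)) zeros + (_⊗_ {a} {b} (lev a) (ps deg (lev b))) zeros
        ≡⟨ cong₂ _+_ (⊗-zeros {a} {b} (ps deg (lev a)) (lev b)) (⊗-zeros {a} {b} (lev a) (ps deg (lev b))) ⟩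
      ps deg (lev a) (zeros {a}) * lev b (zeros {b}) + lev a (zeros {a}) * ps deg (lev b) (zeros {b})
        ≡⟨ cong₂ (λ x y → ps deg (lev a) (zeros {a}) * x + y * ps deg (lev b) (zeros {b}))
             (Supp-zeros b′ (lev b) (Supp-lev {b} b)) (Supp-zeros a′ (lev a) (Supp-lev {a} a)) ⟩
      ps deg (lev a) (zeros {a}) * 0ℤ + 0ℤ * ps deg (lev b) (zeros {b})
        ≡⟨ lem′ (ps deg (lev a) (zeros {a})) (ps deg (lev b) (zeros {b})) ⟩
      0ℤ ∎
      where
      lem′ : ∀ x y → x * 0ℤ + 0ℤ * y ≡ 0ℤ
      lem′ = solve-∀

  -- `lev deg` is killed by p_b because b < deg. The first product inside the bracket is a! a! for a
  -- = b and zero for a ≠ b, which is why the two parities need different constants.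
  pair-mixed : ps a (ps b mixed) zeros ≡
               u * (ps b (lev a) (zeros {a}) * ps a (lev b) (zeros {b}) + pos (a !) * pos (b !))
  pair-mixed = begin
    ps a (ps b mixed) zeros
      ≡⟨ ps-cong a (λ γ → trans (ps-mixed b γ) (cong (λ z → u * ps b P γ + v * z)
           (Kill-lev deg ℕₚ.≤-refl ℕₚ.≤-refl b (s≤s z≤n) (s≤s (ℕₚ.m≤n+m b a′)) γ))) zeros ⟩
    ps a (λ γ → u * ps b P γ + v * 0ℤ) zeros
      ≡⟨ ps-cong a (λ γ → lem u v (ps b P γ)) zeros ⟩
    ps a (λ γ → u * ps b P γ) zeros
      ≡⟨ ps-* a u (ps b P) zeros ⟩
    u * ps a (ps b P) zeros
      ≡⟨ cong (λ z → u * z) (trans (ps-ps-⊗ {a} {b} a b a′ b′ (lev a) (lev b) (Supp-lev a) (Supp-lev b))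
           (cong₂ (λ x y → ps b (lev a) (zeros {a}) * ps a (lev b) (zeros {b}) + x * y) (ps-lev-zeros a′ a′) (ps-lev-zeros b′ b′))) ⟩
    u * (ps b (lev a) (zeros {a}) * ps a (lev b) (zeros {b}) + pos (a !) * pos (b !)) ∎
    where
    lem : ∀ u v x → u * x + v * 0ℤ ≡ u * x
    lem = solve-∀

positive : ∀ {m n} → 1 ≤ m → 1 ≤ n → 1 ≤ m ℕ.* n
positive = ℕₚ.*-mono-≤

EvenFunctional : ℕ → Set
EvenFunctional a = Σ (Func (a ℕ.+ a)) λ L → Kill a L × Supp (a ℕ.+ a) L ×
  (ps a (ps a L) zeros ≡ pos a * ps (a ℕ.+ a) L zeros) × (0ℤ ℤ.< ps (a ℕ.+ a) L zeros)

-- Here y = 2 u a! a! and x = v deg!; `u` and `v` solve y = a x by cross-multiplication, which keeps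
-- everything integral and positive.
functional-even : ∀ a′ → EvenFunctional (suc a′)
functional-even a′ = mixed , Kill-mixed , Supp-mixed , rel , subst (0ℤ ℤ.<_) (sym x-eq)
    (ℤ.+<+ (positive {2 ℕ.* (a ! ℕ.* a !)} (positive {2} (s≤s z≤n) (positive (ℕₚ.1≤n! a) (ℕₚ.1≤n! a))) (ℕₚ.1≤n! deg)))
  where
  a = suc a′
  deg = a ℕ.+ a
  u v : ℤ
  u = pos (a ℕ.* deg !)
  v = pos (2 ℕ.* (a ! ℕ.* a !))
  open Mixed a′ a′ ℕₚ.≤-refl u v
  x-eq : ps deg mixed zeros ≡ pos (2 ℕ.* (a ! ℕ.* a !) ℕ.* deg !)
  x-eq = trans top-mixed (sym (ℤₚ.pos-* (2 ℕ.* (a ! ℕ.* a !)) (deg !)))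
  rel : ps a (ps a mixed) zeros ≡ pos a * ps deg mixed zeros
  rel = begin
    ps a (ps a mixed) zeros
      ≡⟨ pair-mixed ⟩
    u * (ps a (lev a) (zeros {a}) * ps a (lev a) (zeros {a}) + pos (a !) * pos (a !))
      ≡⟨ cong₂ (λ w z → w * (z * z + pos (a !) * pos (a !))) (ℤₚ.pos-* a (deg !)) (ps-lev-zeros a′ a′) ⟩
    pos a * pos (deg !) * (pos (a !) * pos (a !) + pos (a !) * pos (a !))
      ≡⟨ lem (pos a) (pos (deg !)) (pos (a !)) ⟩
    pos a * (pos 2 * (pos (a !) * pos (a !)) * pos (deg !))
      ≡⟨ cong (λ z → pos a * (z * pos (deg !))) (trans (ℤₚ.pos-* 2 (a ! ℕ.* a !)) (cong (λ z → pos 2 * z) (ℤₚ.pos-* (a !) (a !)))) ⟨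
    pos a * (v * pos (deg !))
      ≡⟨ cong (λ z → pos a * z) top-mixed ⟨
    pos a * ps deg mixed zeros ∎
    where
    lem : ∀ a n f → a * n * (f * f + f * f) ≡ a * (pos 2 * (f * f) * n)
    lem = solve-∀

OddFunctional : ℕ → ℕ → Set
OddFunctional a b = Σ (Func (a ℕ.+ b)) λ L → Kill a L × Supp (a ℕ.+ b) L ×
  (pos a * pos b * ps (a ℕ.+ b) L zeros ≡ pos (a ℕ.+ b) * ps a (ps b L) zeros) ×
  (0ℤ ℤ.< ps (a ℕ.+ b) L zeros) × (0ℤ ℤ.≤ ps a (ps b L) zeros)

-- Here y = u a! b! and x = v deg!, and `u` and `v` are read off from a b x = deg y in the same way.
functional-odd : ∀ a′ → OddFunctional (suc a′) (suc (suc a′))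
functional-odd a′ = mixed , Kill-mixed , Supp-mixed , rel , subst (0ℤ ℤ.<_) (sym x-eq)
    (ℤ.+<+ (positive {deg ℕ.* (a ! ℕ.* b !)} (positive {deg} (s≤s z≤n) (positive (ℕₚ.1≤n! a) (ℕₚ.1≤n! b))) (ℕₚ.1≤n! deg)))
    , subst (0ℤ ℤ.≤_) (sym y-eq) (ℤ.+≤+ z≤n)
  where
  a = suc a′
  b = suc a
  deg = a ℕ.+ b
  u v : ℤ
  u = pos (a ℕ.* b ℕ.* deg !)
  v = pos (deg ℕ.* (a ! ℕ.* b !))
  open Mixed a′ a (ℕₚ.n≤1+n a′) u v
  x-eq : ps deg mixed zeros ≡ pos (deg ℕ.* (a ! ℕ.* b !) ℕ.* deg !)
  x-eq = trans top-mixed (sym (ℤₚ.pos-* (deg ℕ.* (a ! ℕ.* b !)) (deg !)))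
  y-eq : ps a (ps b mixed) zeros ≡ pos (a ℕ.* b ℕ.* deg ! ℕ.* (a ! ℕ.* b !))
  y-eq = begin
    ps a (ps b mixed) zeros
      ≡⟨ pair-mixed ⟩
    u * (ps b (lev a) (zeros {a}) * ps a (lev b) (zeros {b}) + pos (a !) * pos (b !))
      ≡⟨ cong₂ (λ w z → u * (w * ps a (lev b) (zeros {b}) + z)) (ps-lev-other a a a (ℕₚ.1+n≢n)) (sym (ℤₚ.pos-* (a !) (b !))) ⟩
    u * (0ℤ * ps a (lev b) (zeros {b}) + pos (a ! ℕ.* b !))
      ≡⟨ lem u (ps a (lev b) (zeros {b})) (pos (a ! ℕ.* b !)) ⟩
    u * pos (a ! ℕ.* b !)
      ≡⟨ ℤₚ.pos-* (a ℕ.* b ℕ.* deg !) (a ! ℕ.* b !) ⟨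
    pos (a ℕ.* b ℕ.* deg ! ℕ.* (a ! ℕ.* b !)) ∎
    where
    lem : ∀ u x y → u * (0ℤ * x + y) ≡ u * y
    lem = solve-∀
  rel : pos a * pos b * ps deg mixed zeros ≡ pos deg * ps a (ps b mixed) zeros
  rel = begin
    pos a * pos b * ps deg mixed zeros
      ≡⟨ cong₂ _*_ (sym (ℤₚ.pos-* a b)) x-eq ⟩
    pos (a ℕ.* b) * pos (deg ℕ.* (a ! ℕ.* b !) ℕ.* deg !)
      ≡⟨ ℤₚ.pos-* (a ℕ.* b) (deg ℕ.* (a ! ℕ.* b !) ℕ.* deg !) ⟨
    pos (a ℕ.* b ℕ.* (deg ℕ.* (a ! ℕ.* b !) ℕ.* deg !))
      ≡⟨ cong pos (lem (a ℕ.* b) deg (a ! ℕ.* b !) (deg !)) ⟩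
    pos (deg ℕ.* (a ℕ.* b ℕ.* deg ! ℕ.* (a ! ℕ.* b !)))
      ≡⟨ ℤₚ.pos-* deg (a ℕ.* b ℕ.* deg ! ℕ.* (a ! ℕ.* b !)) ⟩
    pos deg * pos (a ℕ.* b ℕ.* deg ! ℕ.* (a ! ℕ.* b !))
      ≡⟨ cong (λ z → pos deg * z) y-eq ⟨
    pos deg * ps a (ps b mixed) zeros ∎
    where
    lem : ∀ c n f weight → c ℕ.* (n ℕ.* f ℕ.* weight) ≡ n ℕ.* (c ℕ.* weight ℕ.* f)
    lem = ℕ-solve-∀

-- Coefficients of the chromatic symmetric function as colourings

∑List : {A : Set} → (A → ℤ) → List A → ℤ
∑List f []       = 0ℤ
∑List f (x ∷ xs) = f x + ∑List f xs

∑List-++ : {A : Set} (f : A → ℤ) (xs ys : List A) → ∑List f (xs List.++ ys) ≡ ∑List f xs + ∑List f ys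
∑List-++ f []       ys = sym (ℤₚ.+-identityˡ _)
∑List-++ f (x ∷ xs) ys = trans (cong (λ z → f x + z) (∑List-++ f xs ys)) (sym (ℤₚ.+-assoc (f x) _ _))

∑List-map : {A B : Set} (f : B → ℤ) (g : A → B) (xs : List A) → ∑List f (map g xs) ≡ ∑List (f ∘ g) xs
∑List-map f g []       = refl
∑List-map f g (x ∷ xs) = cong (λ z → f (g x) + z) (∑List-map f g xs)

∑List-concatMap : {A B : Set} (f : B → ℤ) (g : A → List B) (xs : List A) →
                  ∑List f (concatMap g xs) ≡ ∑List (λ x → ∑List f (g x)) xs
∑List-concatMap f g []       = refl
∑List-concatMap f g (x ∷ xs) = trans (∑List-++ f (g x) (concatMap g xs)) (cong (λ z → ∑List f (g x) + z) (∑List-concatMap f g xs))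

∑List-tabulate : ∀ {n} {A : Set} (f : A → ℤ) (g : Fin n → A) → ∑List f (tabulate g) ≡ ∑ (f ∘ g)
∑List-tabulate {zero}  f g = refl
∑List-tabulate {suc n} f g = cong (λ z → f (g zero) + z) (∑List-tabulate f (g ∘ suc))

length-filterᵇ : {A : Set} (p : A → Bool) (xs : List A) → pos (length (filterᵇ p xs)) ≡ ∑List (𝟙 ∘ p) xs
length-filterᵇ p []       = refl
length-filterᵇ p (x ∷ xs) with p x
... | true  = cong (λ z → 1ℤ + z) (length-filterᵇ p xs)
... | false = trans (length-filterᵇ p xs) (sym (ℤₚ.+-identityˡ _))

∑Vec : ∀ n → (Vec (Fin K) n → ℤ) → ℤ
∑Vec zero    f = f []
∑Vec (suc n) f = ∑ λ c → ∑Vec n (f ∘ (c ∷_))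

∑Vec-cong : ∀ n {f g : Vec (Fin K) n → ℤ} → (∀ κ → f κ ≡ g κ) → ∑Vec n f ≡ ∑Vec n g
∑Vec-cong zero    e = e []
∑Vec-cong (suc n) e = sum-cong-≗ λ c → ∑Vec-cong n (e ∘ (c ∷_))

∑Vec-* : ∀ n x (f : Vec (Fin K) n → ℤ) → ∑Vec n (λ κ → x * f κ) ≡ x * ∑Vec n f
∑Vec-* zero    x f = refl
∑Vec-* (suc n) x f = trans (sum-cong-≗ λ c → ∑Vec-* n x (f ∘ (c ∷_))) (∑-* x (λ c → ∑Vec n (f ∘ (c ∷_))))

∑Vec-∑ : ∀ {M} n (f : Fin M → Vec (Fin K) n → ℤ) → ∑Vec n (λ κ → ∑ λ e → f e κ) ≡ ∑ λ e → ∑Vec n (f e)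
∑Vec-∑ zero    f = refl
∑Vec-∑ (suc n) f = trans (sum-cong-≗ λ c → ∑Vec-∑ n (λ e → f e ∘ (c ∷_))) (∑-comm (λ c e → ∑Vec n (f e ∘ (c ∷_))))

∑Vec-++ : ∀ m {n} (f : Vec (Fin K) (m ℕ.+ n) → ℤ) → ∑Vec (m ℕ.+ n) f ≡ ∑Vec m (λ xs → ∑Vec n (λ ys → f (xs Vec.++ ys)))
∑Vec-++ zero    f = refl
∑Vec-++ (suc m) f = sum-cong-≗ λ c → ∑Vec-++ m (f ∘ (c ∷_))

∑List-allFuns : ∀ n k (f : Vec (Fin k) n → ℤ) → ∑List f (allFuns n k) ≡ ∑Vec n f
∑List-allFuns zero    k f = ℤₚ.+-identityʳ (f [])
∑List-allFuns (suc n) k f = begin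
  ∑List f (concatMap (λ c → map (c Vec.∷_) (allFuns n k)) (allFin k))  ≡⟨ ∑List-concatMap f (λ c → map (c Vec.∷_) (allFuns n k)) (allFin k) ⟩
  ∑List (λ c → ∑List f (map (c Vec.∷_) (allFuns n k))) (allFin k)      ≡⟨ ∑List-tabulate (λ c → ∑List f (map (c Vec.∷_) (allFuns n k))) id ⟩
  ∑ (λ c → ∑List f (map (c Vec.∷_) (allFuns n k)))
    ≡⟨ (sum-cong-≗ λ c → trans (∑List-map f (c Vec.∷_) (allFuns n k)) (∑List-allFuns n k (f ∘ (c ∷_)))) ⟩
  ∑Vec (suc n) f                                                       ∎

all-cong : {A : Set} {p q : A → Bool} → (∀ x → p x ≡ q x) → ∀ xs → all p xs ≡ all q xs
all-cong e []       = refl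
all-cong e (x ∷ xs) = cong₂ _∧_ (e x) (all-cong e xs)

nth : List ℕ → ℕ → ℕ
nth []       i       = 0
nth (x ∷ xs) zero    = x
nth (x ∷ xs) (suc i) = nth xs i

lookup-nth : ∀ α i → List.lookup α i ≡ nth α (toℕ i)
lookup-nth (x ∷ α) zero    = refl
lookup-nth (x ∷ α) (suc i) = lookup-nth α i

nth-toList : (v : Vec ℕ K) → ∀ i → nth (toList v) (toℕ i) ≡ lookup v i
nth-toList (x ∷ v) zero    = refl
nth-toList (x ∷ v) (suc i) = nth-toList v i

length-toList : (v : Vec ℕ K) → length (toList v) ≡ K
length-toList []      = refl
length-toList (x ∷ v) = cong suc (length-toList v)

-- The fibre condition with the number of colours no longer tied to the length of the list.
fibres : List ℕ → ∀ {n} → Vec (Fin K) n → Bool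
fibres {K} α κ = all (λ i → countᵇ (λ u → finEq (lookup κ u) i) ≡ᵇ nth α (toℕ i)) (allFin K)

coefX-∑Vec : ∀ G α K → length α ≡ K → pos (coefX G α) ≡ ∑Vec {K} (N G) (λ κ → 𝟙 (properᵇ G κ ∧ fibres α κ))
coefX-∑Vec G α .(length α) refl = begin
  pos (coefX G α)
    ≡⟨ length-filterᵇ (λ κ → properᵇ G κ ∧ fibresᵇ α κ) (allFuns (N G) (length α)) ⟩
  ∑List (λ κ → 𝟙 (properᵇ G κ ∧ fibresᵇ α κ)) (allFuns (N G) (length α))
    ≡⟨ ∑List-allFuns (N G) (length α) (λ κ → 𝟙 (properᵇ G κ ∧ fibresᵇ α κ)) ⟩
  ∑Vec (N G) (λ κ → 𝟙 (properᵇ G κ ∧ fibresᵇ α κ))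
    ≡⟨ ∑Vec-cong (N G) (λ κ → cong (λ z → 𝟙 (properᵇ G κ ∧ z)) (all-cong (λ i →
         cong (countᵇ (λ u → finEq (lookup κ u) i) ≡ᵇ_) (lookup-nth α i)) (allFin (length α)))) ⟩
  ∑Vec (N G) (λ κ → 𝟙 (properᵇ G κ ∧ fibres α κ)) ∎

content : ∀ {n} → Vec ℕ K → Vec (Fin K) n → Vec ℕ K
content m []      = m
content m (c ∷ κ) = content (add 1 c m) κ

content-++ : ∀ {m n} γ (xs : Vec (Fin K) m) (ys : Vec (Fin K) n) → content γ (xs Vec.++ ys) ≡ content (content γ xs) ys
content-++ γ []       ys = refl
content-++ γ (c ∷ xs) ys = content-++ (add 1 c γ) xs ys

sum-add : ∀ i (c : Fin K) m → Vec.sum (add i c m) ≡ i ℕ.+ Vec.sum m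
sum-add i zero    (n ∷ m) = ℕₚ.+-assoc i n (Vec.sum m)
sum-add i (suc c) (n ∷ m) = begin
  n ℕ.+ Vec.sum (add i c m)    ≡⟨ cong (n ℕ.+_) (sum-add i c m) ⟩
  n ℕ.+ (i ℕ.+ Vec.sum m)      ≡⟨ ℕₚ.+-assoc n i _ ⟨
  n ℕ.+ i ℕ.+ Vec.sum m        ≡⟨ cong (ℕ._+ Vec.sum m) (ℕₚ.+-comm n i) ⟩
  i ℕ.+ n ℕ.+ Vec.sum m        ≡⟨ ℕₚ.+-assoc i n _ ⟩
  i ℕ.+ (n ℕ.+ Vec.sum m)      ∎

sum-content : ∀ {n} m (κ : Vec (Fin K) n) → Vec.sum (content m κ) ≡ n ℕ.+ Vec.sum m
sum-content {n = zero}  m []      = refl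
sum-content {n = suc n} m (c ∷ κ) = trans (sum-content (add 1 c m) κ)
  (trans (cong (n ℕ.+_) (sum-add 1 c m)) (ℕₚ.+-suc n _))

lookup-add : (c i : Fin K) (m : Vec ℕ K) → pos (lookup (add 1 c m) i) ≡ 𝟙 (finEq c i) + pos (lookup m i)
lookup-add zero    zero    (n ∷ m) = refl
lookup-add zero    (suc i) (n ∷ m) = refl
lookup-add (suc c) zero    (n ∷ m) = refl
lookup-add (suc c) (suc i) (n ∷ m) = lookup-add c i m

lookup-content : ∀ {n} m (κ : Vec (Fin K) n) i →
                 pos (lookup (content m κ) i) ≡ ∑ (λ u → 𝟙 (finEq (lookup κ u) i)) + pos (lookup m i)
lookup-content m []      i = refl
lookup-content m (c ∷ κ) i = begin
  pos (lookup (content (add 1 c m) κ) i)                             ≡⟨ lookup-content (add 1 c m) κ i ⟩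
  ∑ (λ u → 𝟙 (finEq (lookup κ u) i)) + pos (lookup (add 1 c m) i)    ≡⟨ cong (λ z → ∑ (λ u → 𝟙 (finEq (lookup κ u) i)) + z) (lookup-add c i m) ⟩
  ∑ (λ u → 𝟙 (finEq (lookup κ u) i)) + (𝟙 (finEq c i) + pos (lookup m i)) ≡⟨ lem (∑ (λ u → 𝟙 (finEq (lookup κ u) i))) (𝟙 (finEq c i)) (pos (lookup m i)) ⟩
  ∑ (λ u → 𝟙 (finEq (lookup (c ∷ κ) u) i)) + pos (lookup m i)        ∎
  where
  lem : ∀ s e x → s + (e + x) ≡ e + s + x
  lem = solve-∀

lookup-zeros : (i : Fin K) → lookup (zeros {K}) i ≡ 0
lookup-zeros zero    = refl
lookup-zeros (suc i) = lookup-zeros i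

count-content : ∀ {n} (κ : Vec (Fin K) n) i → countᵇ (λ u → finEq (lookup κ u) i) ≡ lookup (content zeros κ) i
count-content {n = n} κ i = ℤₚ.+-injective (begin
  pos (countᵇ (λ u → finEq (lookup κ u) i))              ≡⟨ length-filterᵇ (λ u → finEq (lookup κ u) i) (allFin n) ⟩
  ∑List (λ u → 𝟙 (finEq (lookup κ u) i)) (allFin n)      ≡⟨ ∑List-tabulate (λ u → 𝟙 (finEq (lookup κ u) i)) id ⟩
  ∑ (λ u → 𝟙 (finEq (lookup κ u) i))                     ≡⟨ ℤₚ.+-identityʳ _ ⟨
  ∑ (λ u → 𝟙 (finEq (lookup κ u) i)) + 0ℤ                ≡⟨ cong (λ z → ∑ (λ u → 𝟙 (finEq (lookup κ u) i)) + pos z) (sym (lookup-zeros i)) ⟩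
  ∑ (λ u → 𝟙 (finEq (lookup κ u) i)) + pos (lookup zeros i) ≡⟨ lookup-content zeros κ i ⟨
  pos (lookup (content zeros κ) i)                       ∎)

eqVec : Vec ℕ K → Vec ℕ K → Bool
eqVec []      []      = true
eqVec (x ∷ w) (y ∷ v) = (x ≡ᵇ y) ∧ eqVec w v

all-eqVec : ∀ {n} (w v : Vec ℕ n) (p : Fin K → Bool) (g : Fin n → Fin K) →
            (∀ i → p (g i) ≡ (lookup w i ≡ᵇ lookup v i)) → all p (tabulate g) ≡ eqVec w v
all-eqVec []      []      p g e = refl
all-eqVec (x ∷ w) (y ∷ v) p g e = cong₂ _∧_ (e zero) (all-eqVec w v p (g ∘ suc) (e ∘ suc))

fibres-content : ∀ {n} (v : Vec ℕ K) (κ : Vec (Fin K) n) → fibres (toList v) κ ≡ eqVec (content zeros κ) v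
fibres-content v κ = all-eqVec (content zeros κ) v _ id λ i → cong₂ _≡ᵇ_ (count-content κ i) (nth-toList v i)

𝟙-∧ : ∀ p q → 𝟙 (p ∧ q) ≡ 𝟙 p * 𝟙 q
𝟙-∧ true  q = sym (ℤₚ.*-identityˡ (𝟙 q))
𝟙-∧ false q = sym (ℤₚ.*-zeroˡ (𝟙 q))

box-∑Vec : ∀ {M} B n (f : Vec (Fin M) n → Func K) → box K B (λ α → ∑Vec n (λ κ → f κ α)) ≡ ∑Vec n (λ κ → box K B (f κ))
box-∑Vec {zero}  B n f = refl
box-∑Vec {suc K} B n f = trans (sum-cong-≗ {B} λ i → box-∑Vec B n (λ κ → f κ ∘ (toℕ i ∷_)))
  (sym (∑Vec-∑ {M = B} n (λ i κ → box K B (f κ ∘ (toℕ i ∷_)))))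

box-eqVec : ∀ B (w : Vec ℕ K) (f : Func K) → Vec.sum w < B → box K B (λ v → f v * 𝟙 (eqVec w v)) ≡ f w
box-eqVec B []      f p = ℤₚ.*-identityʳ (f [])
box-eqVec {suc K} B (x ∷ w) f p = begin
  ∑ {B} (λ n → box K B (λ v → f (toℕ n ∷ v) * 𝟙 ((x ≡ᵇ toℕ n) ∧ eqVec w v)))
    ≡⟨ (sum-cong-≗ {B} λ n → trans (box-cong B (λ v → trans (cong (λ z → f (toℕ n ∷ v) * z) (𝟙-∧ (x ≡ᵇ toℕ n) (eqVec w v)))
         (lem (f (toℕ n ∷ v)) (𝟙 (x ≡ᵇ toℕ n)) (𝟙 (eqVec w v))))) (box-* B (𝟙 (x ≡ᵇ toℕ n)) (λ v → f (toℕ n ∷ v) * 𝟙 (eqVec w v)))) ⟩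
  ∑ {B} (λ n → 𝟙 (x ≡ᵇ toℕ n) * box K B (λ v → f (toℕ n ∷ v) * 𝟙 (eqVec w v)))
    ≡⟨ (sum-cong-≗ {B} λ n → cong₂ _*_ (cong (λ z → 𝟙 (z ≡ᵇ toℕ n)) (sym (toℕ-fromℕ< x<B)))
         (box-eqVec B w (f ∘ (toℕ n ∷_)) (ℕₚ.≤-<-trans (ℕₚ.m≤n+m (Vec.sum w) x) p))) ⟩
  ∑ {B} (λ n → eq (fromℕ< x<B) n * f (toℕ n ∷ w))
    ≡⟨ ∑-eq (fromℕ< x<B) (λ n → f (toℕ n ∷ w)) ⟩
  f (toℕ (fromℕ< x<B) ∷ w)
    ≡⟨ cong (λ z → f (z ∷ w)) (toℕ-fromℕ< x<B) ⟩
  f (x ∷ w) ∎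
  where
  x<B : x < B
  x<B = ℕₚ.≤-<-trans (ℕₚ.m≤m+n x (Vec.sum w)) p
  lem : ∀ x y z → x * (y * z) ≡ y * (x * z)
  lem = solve-∀

-- After exchanging the sums, each colouring κ is met at exactly one exponent vector, its content.
-- That vector has degree `N G`, so a box with exponents up to `N G` contains it.
pair-coefX : ∀ G (L : Func K) → pair (suc (N G)) L (pos ∘ coefX G) ≡ ∑Vec (N G) (λ κ → 𝟙 (properᵇ G κ) * L (content zeros κ))
pair-coefX {K} G L = begin
  box K B (λ α → L α * pos (coefX G (toList α)))
    ≡⟨ box-cong B (λ α → trans (cong (λ z → L α * z) (coefX-∑Vec G (toList α) K (length-toList α)))
         (sym (∑Vec-* (N G) (L α) (λ κ → 𝟙 (properᵇ G κ ∧ fibres (toList α) κ))))) ⟩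
  box K B (λ α → ∑Vec (N G) (λ κ → L α * 𝟙 (properᵇ G κ ∧ fibres (toList α) κ)))
    ≡⟨ box-∑Vec B (N G) (λ κ α → L α * 𝟙 (properᵇ G κ ∧ fibres (toList α) κ)) ⟩
  ∑Vec (N G) (λ κ → box K B (λ α → L α * 𝟙 (properᵇ G κ ∧ fibres (toList α) κ)))
    ≡⟨ ∑Vec-cong (N G) (λ κ → trans (trans
         (box-cong B λ α → trans (cong (λ z → L α * z) (trans (𝟙-∧ (properᵇ G κ) (fibres (toList α) κ)) (cong (λ z → 𝟙 (properᵇ G κ) * 𝟙 z) (fibres-content α κ))))
           (lem (L α) (𝟙 (properᵇ G κ)) (𝟙 (eqVec (content zeros κ) α))))
         (box-* B (𝟙 (properᵇ G κ)) (λ α → L α * 𝟙 (eqVec (content zeros κ) α))))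
         (cong (λ z → 𝟙 (properᵇ G κ) * z) (box-eqVec B (content zeros κ) L
           (s≤s (ℕₚ.≤-reflexive (trans (sum-content zeros κ) (trans (cong (N G ℕ.+_) (sum-zeros K)) (ℕₚ.+-identityʳ (N G))))))))) ⟩
  ∑Vec (N G) (λ κ → 𝟙 (properᵇ G κ) * L (content zeros κ)) ∎
  where
  B = suc (N G)
  lem : ∀ x y z → x * (y * z) ≡ y * (x * z)
  lem = solve-∀

-- Proper colourings of AS_{a,b} as two walks between four special vertices

-- The edges of AS_{a,b}, with vertices numbered from 0.
data Edge (a b : ℕ) : ℕ → ℕ → Set where
  next    : ∀ {i} → Edge a b i (suc i)
  close   : ∀ {i} → suc i ≡ a ℕ.+ b → Edge a b i 0
  chord₁  : Edge a b 0 a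
  chord₂  : Edge a b 1 (suc a)
  chord₁₂ : Edge a b 0 (suc a)

edge-sound : ∀ a b i j → T (ASedge a b (suc i) (suc j)) → Edge a b i j
edge-sound a b i j t with to T-∨ t
... | inj₁ p = subst (Edge a b i) (sym (ℕₚ.≡ᵇ⇒≡ j (suc i) p)) next
... | inj₂ t with to T-∨ t
...   | inj₁ p = let p₁ , p₂ = to T-∧ p in
        subst (Edge a b i) (sym (ℕₚ.≡ᵇ⇒≡ j 0 p₂)) (close (ℕₚ.≡ᵇ⇒≡ (suc i) (a ℕ.+ b) p₁))
...   | inj₂ t with to T-∨ t
...     | inj₁ p = let p₁ , p₂ = to T-∧ p in
          subst₂ (Edge a b) (sym (ℕₚ.≡ᵇ⇒≡ i 0 p₁)) (sym (ℕₚ.suc-injective (trans (ℕₚ.≡ᵇ⇒≡ (suc j) (a ℕ.+ 1) p₂) (ℕₚ.+-comm a 1)))) chord₁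
...     | inj₂ t with to T-∨ t
...       | inj₁ p = let p₁ , p₂ = to T-∧ p in
            subst₂ (Edge a b) (sym (ℕₚ.≡ᵇ⇒≡ i 1 p₁)) (sym (ℕₚ.suc-injective (trans (ℕₚ.≡ᵇ⇒≡ (suc j) (a ℕ.+ 2) p₂) (ℕₚ.+-comm a 2)))) chord₂
...       | inj₂ p = let p₁ , p₂ = to T-∧ p in
            subst₂ (Edge a b) (sym (ℕₚ.≡ᵇ⇒≡ i 0 p₁)) (sym (ℕₚ.suc-injective (trans (ℕₚ.≡ᵇ⇒≡ (suc j) (a ℕ.+ 2) p₂) (ℕₚ.+-comm a 2)))) chord₁₂

T-∨ʳ : ∀ x {y} → T y → T (x ∨ y)
T-∨ʳ x t = from T-∨ (inj₂ t)

T-∨ˡ : ∀ {x y} → T x → T (x ∨ y)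
T-∨ˡ t = from T-∨ (inj₁ t)

edge-complete : ∀ a b {i j} → Edge a b i j → T (ASedge a b (suc i) (suc j))
edge-complete a b {i} next = T-∨ˡ (ℕₚ.≡⇒≡ᵇ i i refl)
edge-complete a b {i} (close e) = T-∨ʳ (1 ≡ᵇ suc (suc i)) (T-∨ˡ (from T-∧ (ℕₚ.≡⇒≡ᵇ (suc i) (a ℕ.+ b) e , tt)))
edge-complete a b chord₁ = T-∨ʳ (suc a ≡ᵇ 2) (T-∨ʳ ((1 ≡ᵇ a ℕ.+ b) ∧ (suc a ≡ᵇ 1))
  (T-∨ˡ (ℕₚ.≡⇒≡ᵇ (suc a) (a ℕ.+ 1) (ℕₚ.+-comm 1 a))))
edge-complete a b chord₂ = T-∨ʳ (suc (suc a) ≡ᵇ 3) (T-∨ʳ ((2 ≡ᵇ a ℕ.+ b) ∧ (suc (suc a) ≡ᵇ 1))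
  (T-∨ˡ (ℕₚ.≡⇒≡ᵇ (suc (suc a)) (a ℕ.+ 2) (ℕₚ.+-comm 2 a))))
edge-complete a b chord₁₂ = T-∨ʳ (suc (suc a) ≡ᵇ 2) (T-∨ʳ ((1 ≡ᵇ a ℕ.+ b) ∧ (suc (suc a) ≡ᵇ 1))
  (T-∨ʳ (suc (suc a) ≡ᵇ a ℕ.+ 1) (ℕₚ.≡⇒≡ᵇ (suc (suc a)) (a ℕ.+ 2) (ℕₚ.+-comm 2 a))))

adj-sound : ∀ a b (u v : Fin (a ℕ.+ b)) → T (adj (AS a b) u v) → Edge a b (toℕ u) (toℕ v) ⊎ Edge a b (toℕ v) (toℕ u)
adj-sound a b u v t = Sum.map (edge-sound a b (toℕ u) (toℕ v)) (edge-sound a b (toℕ v) (toℕ u))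
  (to T-∨ (proj₂ (to (T-∧ {x = not (finEq u v)}) t)))

T-not : ∀ {x} → ¬ T x → T (not x)
T-not {true}  p = p tt
T-not {false} p = tt

adj-complete : ∀ a b (u v : Fin (a ℕ.+ b)) → toℕ u ≢ toℕ v → Edge a b (toℕ u) (toℕ v) → T (adj (AS a b) u v)
adj-complete a b u v p e = from T-∧ (T-not (p ∘ ℕₚ.≡ᵇ⇒≡ (toℕ u) (toℕ v)) , T-∨ˡ (edge-complete a b e))

all-sound : ∀ {n} {A : Set} (p : A → Bool) (g : Fin n → A) → T (all p (tabulate g)) → ∀ i → T (p (g i))
all-sound p g t zero    = proj₁ (to T-∧ t)
all-sound p g t (suc i) = all-sound p (g ∘ suc) (proj₂ (to (T-∧ {x = p (g zero)}) t)) i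

all-complete : ∀ {n} {A : Set} (p : A → Bool) (g : Fin n → A) → (∀ i → T (p (g i))) → T (all p (tabulate g))
all-complete {zero}  p g h = tt
all-complete {suc n} p g h = from T-∧ (h zero , all-complete p (g ∘ suc) (h ∘ suc))

differ : Fin K → Fin K → Bool
differ c d = not (finEq c d)

differ-sym : (c d : Fin K) → T (differ c d) → T (differ d c)
differ-sym (suc c) zero    t = tt
differ-sym zero    (suc d) t = tt
differ-sym (suc c) (suc d) t = differ-sym c d t

proper-sound : ∀ G (κ : Vec (Fin K) (N G)) → T (properᵇ G κ) → ∀ u v → T (adj G u v) → T (differ (lookup κ u) (lookup κ v))
proper-sound G κ t u v e with to (T-∨ {x = not (adj G u v)}) (all-sound _ id (all-sound _ id t u) v)
... | inj₂ p = p
... | inj₁ p with adj G u v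
...   | true = ⊥-elim p

proper-complete : ∀ G (κ : Vec (Fin K) (N G)) → (∀ u v → T (adj G u v) → T (differ (lookup κ u) (lookup κ v))) → T (properᵇ G κ)
proper-complete G κ h = all-complete _ id λ u → all-complete _ id λ v → go u v (h u v)
  where
  go : ∀ u v → (T (adj G u v) → T (differ (lookup κ u) (lookup κ v))) → T (not (adj G u v) ∨ not (finEq (lookup κ u) (lookup κ v)))
  go u v h with adj G u v
  ... | true  = h tt
  ... | false = tt

final : ∀ {n} → Fin K → Vec (Fin K) n → Fin K
final c []      = c
final c (d ∷ κ) = final d κ

chain : ∀ {n} → Fin K → Vec (Fin K) n → Bool
chain c []      = true
chain c (d ∷ κ) = differ c d ∧ chain d κ

chain-sound : ∀ {n} (c : Fin K) (κ : Vec (Fin K) n) → T (chain c κ) → ∀ i j → toℕ j ≡ suc (toℕ i) →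
              T (differ (lookup (c ∷ κ) i) (lookup (c ∷ κ) j))
chain-sound c (d ∷ κ) t zero    (suc zero)    e = proj₁ (to T-∧ t)
chain-sound c (d ∷ κ) t (suc i) (suc j)       e = chain-sound d κ (proj₂ (to (T-∧ {x = differ c d}) t)) i j (ℕₚ.suc-injective e)

chain-complete : ∀ {n} (c : Fin K) (κ : Vec (Fin K) n) →
                 (∀ i j → toℕ j ≡ suc (toℕ i) → T (differ (lookup (c ∷ κ) i) (lookup (c ∷ κ) j))) → T (chain c κ)
chain-complete c []      h = tt
chain-complete c (d ∷ κ) h = from T-∧ (h zero (suc zero) refl , chain-complete d κ (λ i j e → h (suc i) (suc j) (cong suc e)))

lookup-fromℕ : ∀ {n} (c : Fin K) (κ : Vec (Fin K) n) → lookup (c ∷ κ) (fromℕ n) ≡ final c κ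
lookup-fromℕ c []      = refl
lookup-fromℕ c (d ∷ κ) = lookup-fromℕ d κ

final-++ : ∀ {m n} (c : Fin K) (xs : Vec (Fin K) m) e (ys : Vec (Fin K) n) → final c (xs Vec.++ e ∷ ys) ≡ final e ys
final-++ c []       e ys = refl
final-++ c (x ∷ xs) e ys = final-++ x xs e ys

chain-++ : ∀ {m n} (c : Fin K) (xs : Vec (Fin K) m) e (ys : Vec (Fin K) n) →
           chain c (xs Vec.++ e ∷ ys) ≡ chain c xs ∧ differ (final c xs) e ∧ chain e ys
chain-++ c []       e ys = refl
chain-++ c (x ∷ xs) e ys = trans (cong (differ c x ∧_) (chain-++ x xs e ys)) (sym (∧-assoc (differ c x) (chain x xs) _))

T-ext : ∀ {x y} → (T x → T y) → (T y → T x) → x ≡ y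
T-ext {true}  {true}  f g = refl
T-ext {true}  {false} f g = ⊥-elim (f tt)
T-ext {false} {true}  f g = ⊥-elim (g tt)
T-ext {false} {false} f g = refl

module _ (r r′ : ℕ) where

  private
    a b : ℕ
    a = suc (suc r)
    b = suc (suc r′)

  module _ (c d : Fin K) (ys : Vec (Fin K) r) (e f : Fin K) (zs : Vec (Fin K) r′) where

    private
      κ′ : Vec (Fin K) (suc (r ℕ.+ b))
      κ′ = d ∷ ys Vec.++ e ∷ f ∷ zs

      κ : Vec (Fin K) (a ℕ.+ b)
      κ = c ∷ κ′

      iₑ i_f i_l : Fin (a ℕ.+ b)
      iₑ = suc (suc (r ↑ʳ zero))
      i_f = suc (suc (r ↑ʳ suc zero))
      i_l = fromℕ (suc (r ℕ.+ b))

      toℕ-e : toℕ iₑ ≡ a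
      toℕ-e = cong (λ n → suc (suc n)) (trans (toℕ-↑ʳ r zero) (ℕₚ.+-identityʳ r))

      toℕ-f : toℕ i_f ≡ suc a
      toℕ-f = cong (λ n → suc (suc n)) (trans (toℕ-↑ʳ r (suc zero)) (ℕₚ.+-comm r 1))

      toℕ-l : suc (toℕ i_l) ≡ a ℕ.+ b
      toℕ-l = cong suc (toℕ-fromℕ (suc (r ℕ.+ b)))

      at-e : lookup κ iₑ ≡ e
      at-e = lookup-++ʳ ys (e ∷ f ∷ zs) zero

      at-f : lookup κ i_f ≡ f
      at-f = lookup-++ʳ ys (e ∷ f ∷ zs) (suc zero)

      at-l : lookup κ i_l ≡ final f zs
      at-l = trans (lookup-fromℕ c κ′) (final-++ d ys e (f ∷ zs))

    -- The chain and the edge back to v₁ form the Hamiltonian cycle; the last three factors are the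
    -- chords. An equality of Booleans is what can be rewritten under the indicator `𝟙`.
    proper-AS : properᵇ (AS a b) κ ≡ chain c κ′ ∧ differ (final f zs) c ∧ differ c e ∧ differ d f ∧ differ c f
    proper-AS = T-ext sound complete
      where
      sound : T (properᵇ (AS a b) κ) → T (chain c κ′ ∧ differ (final f zs) c ∧ differ c e ∧ differ d f ∧ differ c f)
      sound t = from T-∧ (chain-complete c κ′ (λ i j eq → ok i j (λ p → ℕₚ.1+n≢n (trans (sym eq) (sym p))) (subst (Edge a b (toℕ i)) (sym eq) next))
        , from T-∧ (subst (λ z → T (differ z c)) at-l (ok i_l zero (λ ()) (close toℕ-l))
        , from T-∧ (subst (λ z → T (differ c z)) at-e (ok zero iₑ (λ ()) (subst (Edge a b 0) (sym toℕ-e) chord₁))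
        , from T-∧ (subst (λ z → T (differ d z)) at-f (ok (suc zero) i_f (λ ()) (subst (Edge a b 1) (sym toℕ-f) chord₂))
        , subst (λ z → T (differ c z)) at-f (ok zero i_f (λ ()) (subst (Edge a b 0) (sym toℕ-f) chord₁₂))))))
        where
        ok : ∀ u v → toℕ u ≢ toℕ v → Edge a b (toℕ u) (toℕ v) → T (differ (lookup κ u) (lookup κ v))
        ok u v p eg = proper-sound (AS a b) κ t u v (adj-complete a b u v p eg)
      complete : T (chain c κ′ ∧ differ (final f zs) c ∧ differ c e ∧ differ d f ∧ differ c f) → T (properᵇ (AS a b) κ)
      complete t with to T-∧ t
      ... | t₁ , t with to T-∧ t
      ...   | t₂ , t with to T-∧ t
      ...     | t₃ , t with to T-∧ t
      ...       | t₄ , t₅ = proper-complete (AS a b) κ λ u v h → go u v (adj-sound a b u v h)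
        where
        by-index : ∀ {x y} (u v i j : Fin (a ℕ.+ b)) → toℕ u ≡ toℕ i → toℕ v ≡ toℕ j → lookup κ i ≡ x → lookup κ j ≡ y →
                   T (differ x y) → T (differ (lookup κ u) (lookup κ v))
        by-index u v i j p q refl refl t = subst₂ (λ u v → T (differ (lookup κ u) (lookup κ v)))
          (sym (toℕ-injective p)) (sym (toℕ-injective q)) t
        edge : ∀ u v i j → toℕ u ≡ i → toℕ v ≡ j → Edge a b i j → T (differ (lookup κ u) (lookup κ v))
        edge u v i j p q next       = chain-sound c κ′ t₁ u v (trans q (cong suc (sym p)))
        edge u v i j p q (close eq) = by-index u v i_l zero (trans p (ℕₚ.suc-injective (trans eq (sym toℕ-l)))) q at-l refl t₂
        edge u v i j p q chord₁     = by-index u v zero iₑ p (trans q (sym toℕ-e)) refl at-e t₃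
        edge u v i j p q chord₂     = by-index u v (suc zero) i_f p (trans q (sym toℕ-f)) refl at-f t₄
        edge u v i j p q chord₁₂    = by-index u v zero i_f p (trans q (sym toℕ-f)) refl at-f t₅
        go : ∀ u v → Edge a b (toℕ u) (toℕ v) ⊎ Edge a b (toℕ v) (toℕ u) → T (differ (lookup κ u) (lookup κ v))
        go u v (inj₁ eg) = edge u v _ _ refl refl eg
        go u v (inj₂ eg) = differ-sym (lookup κ v) (lookup κ u) (edge v u _ _ refl refl eg)

𝟙-differ : (c d : Fin K) → 𝟙 (differ c d) ≡ ne c d
𝟙-differ c d with finEq c d
... | true  = refl
... | false = refl

∑Vec-walk : ∀ r (d : Fin K) (g : Fin K → Func K) m →
            ∑Vec r (λ ys → 𝟙 (chain d ys) * g (final d ys) (content m ys)) ≡ walk r d g m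
∑Vec-walk zero    d g m = ℤₚ.*-identityˡ (g d m)
∑Vec-walk (suc r) d g m = sum-cong-≗ λ y → trans
  (∑Vec-cong r λ ys → trans (cong (λ z → z * g (final y ys) (content (add 1 y m) ys))
      (trans (𝟙-∧ (differ d y) (chain y ys)) (cong (λ z → z * 𝟙 (chain y ys)) (𝟙-differ d y))))
    (ℤₚ.*-assoc (ne d y) (𝟙 (chain y ys)) _))
  (trans (∑Vec-* r (ne d y) (λ ys → 𝟙 (chain y ys) * g (final y ys) (content (add 1 y m) ys)))
    (cong (λ z → ne d y * z) (∑Vec-walk r y g (add 1 y m))))

-- Cutting the chain at v_{a+1} and v_{a+2} separates the two arcs. The factor in front collects the
-- five edges v₁v₂, v₁v_{a+1}, v₁v_{a+2}, v₂v_{a+2} and v_{a+1}v_{a+2}.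
𝟙-proper-AS : ∀ r r′ (c d : Fin K) (ys : Vec (Fin K) r) e f (zs : Vec (Fin K) r′) →
  𝟙 (properᵇ (AS (suc (suc r)) (suc (suc r′))) (c ∷ d ∷ ys Vec.++ e ∷ f ∷ zs)) ≡
  ne c f * (avoid c f d * avoid c f e) * (𝟙 (chain d ys) * (ne (final d ys) e * (𝟙 (chain f zs) * ne (final f zs) c)))
𝟙-proper-AS r r′ c d ys e f zs = begin
  𝟙 (properᵇ (AS (suc (suc r)) (suc (suc r′))) (c ∷ d ∷ ys Vec.++ e ∷ f ∷ zs))
    ≡⟨ cong 𝟙 (trans (proper-AS r r′ c d ys e f zs) (cong (λ z → (differ c d ∧ z) ∧ differ (final f zs) c ∧ differ c e ∧ differ d f ∧ differ c f) (chain-++ d ys e (f ∷ zs)))) ⟩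
  𝟙 ((differ c d ∧ chain d ys ∧ differ (final d ys) e ∧ differ e f ∧ chain f zs) ∧ differ (final f zs) c ∧ differ c e ∧ differ d f ∧ differ c f)
    ≡⟨ trans (𝟙-∧ (differ c d ∧ chain d ys ∧ differ (final d ys) e ∧ differ e f ∧ chain f zs) _)
         (cong₂ _*_
           (product (𝟙-differ c d) (product {chain d ys} refl (product (𝟙-differ (final d ys) e) (product {q = chain f zs} (𝟙-differ e f) refl))))
           (product (𝟙-differ (final f zs) c) (product (𝟙-differ c e) (product (𝟙-differ d f) (𝟙-differ c f))))) ⟩
  ne c d * (𝟙 (chain d ys) * (ne (final d ys) e * (ne e f * 𝟙 (chain f zs)))) * (ne (final f zs) c * (ne c e * (ne d f * ne c f)))
    ≡⟨ lem (ne c d) (𝟙 (chain d ys)) (ne (final d ys) e) (ne e f) (𝟙 (chain f zs)) (ne (final f zs) c) (ne c e) (ne d f) (ne c f) ⟩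
  ne c f * (avoid c f d * avoid c f e) * (𝟙 (chain d ys) * (ne (final d ys) e * (𝟙 (chain f zs) * ne (final f zs) c))) ∎
  where
  product : ∀ {p q x y} → 𝟙 p ≡ x → 𝟙 q ≡ y → 𝟙 (p ∧ q) ≡ x * y
  product {p} {q} refl refl = 𝟙-∧ p q
  lem : ∀ cd ys y-e ef zs z-c ce df cf → cd * (ys * (y-e * (ef * zs))) * (z-c * (ce * (df * cf))) ≡
        cf * (cd * df * (ce * ef)) * (ys * (y-e * (zs * z-c)))
  lem = solve-∀

∑Vec-AS : ∀ r r′ (L : Func K) → let G = AS (suc (suc r)) (suc (suc r′)) in
          ∑Vec (N G) (λ κ → 𝟙 (properᵇ G κ) * L (content zeros κ)) ≡ total r r′ L
∑Vec-AS {K} r r′ L = sum-cong-≗ λ c → sum-cong-≗ λ d → begin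
  ∑Vec (r ℕ.+ suc (suc r′)) (λ κ → F (c ∷ d ∷ κ))
    ≡⟨ ∑Vec-++ r (λ κ → F (c ∷ d ∷ κ)) ⟩
  ∑Vec r (λ ys → ∑ λ e → ∑ λ f → ∑Vec r′ λ zs → F (c ∷ d ∷ ys Vec.++ e ∷ f ∷ zs))
    ≡⟨ trans (∑Vec-∑ r (λ e ys → ∑ λ f → ∑Vec r′ λ zs → F (c ∷ d ∷ ys Vec.++ e ∷ f ∷ zs)))
         (sum-cong-≗ λ e → ∑Vec-∑ r (λ f ys → ∑Vec r′ λ zs → F (c ∷ d ∷ ys Vec.++ e ∷ f ∷ zs))) ⟩
  ∑ (λ e → ∑ λ f → ∑Vec r λ ys → ∑Vec r′ λ zs → F (c ∷ d ∷ ys Vec.++ e ∷ f ∷ zs))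
    ≡⟨ (sum-cong-≗ λ e → sum-cong-≗ λ f → fixed c d e f) ⟩
  ∑ (λ e → ∑ λ f → W c d e f * walk r d (λ y m → ne y e * path r′ f c L (add 1 f (add 1 e m))) (add 1 d (add 1 c zeros))) ∎
  where
  G = AS (suc (suc r)) (suc (suc r′))
  F : Vec (Fin K) (N G) → ℤ
  F κ = 𝟙 (properᵇ G κ) * L (content zeros κ)
  W : Fin K → Fin K → Fin K → Fin K → ℤ
  W c d e f = ne c f * (avoid c f d * avoid c f e)
  lem : ∀ w y n z k l → w * (y * (n * (z * k))) * l ≡ w * (y * (n * (z * (k * l))))
  lem = solve-∀
  fixed : ∀ c d e f → ∑Vec r (λ ys → ∑Vec r′ λ zs → F (c ∷ d ∷ ys Vec.++ e ∷ f ∷ zs)) ≡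
          W c d e f * walk r d (λ y m → ne y e * path r′ f c L (add 1 f (add 1 e m))) (add 1 d (add 1 c zeros))
  fixed c d e f = begin
    ∑Vec r (λ ys → ∑Vec r′ λ zs → F (c ∷ d ∷ ys Vec.++ e ∷ f ∷ zs))
      ≡⟨ ∑Vec-cong r (λ ys → begin
           ∑Vec r′ (λ zs → F (c ∷ d ∷ ys Vec.++ e ∷ f ∷ zs))
             ≡⟨ ∑Vec-cong r′ (λ zs → trans (cong₂ (λ x y → x * L y) (𝟙-proper-AS r r′ c d ys e f zs) (content-++ m₀ ys (e ∷ f ∷ zs)))
                  (lem (W c d e f) (𝟙 (chain d ys)) (ne (final d ys) e) (𝟙 (chain f zs)) (ne (final f zs) c) (L (content (m₁ ys) zs)))) ⟩
           ∑Vec r′ (λ zs → W c d e f * (𝟙 (chain d ys) * (ne (final d ys) e * (𝟙 (chain f zs) * (ne (final f zs) c * L (content (m₁ ys) zs))))))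
             ≡⟨ trans (∑Vec-* r′ (W c d e f) _) (cong (λ z → W c d e f * z) (trans (∑Vec-* r′ (𝟙 (chain d ys)) _)
                  (cong (λ z → 𝟙 (chain d ys) * z) (trans (∑Vec-* r′ (ne (final d ys) e) _)
                    (cong (λ z → ne (final d ys) e * z) (∑Vec-walk r′ f (λ z m → ne z c * L m) (m₁ ys))))))) ⟩
           W c d e f * (𝟙 (chain d ys) * (ne (final d ys) e * path r′ f c L (m₁ ys))) ∎) ⟩
    ∑Vec r (λ ys → W c d e f * (𝟙 (chain d ys) * (ne (final d ys) e * path r′ f c L (m₁ ys))))
      ≡⟨ ∑Vec-* r (W c d e f) (λ ys → 𝟙 (chain d ys) * (ne (final d ys) e * path r′ f c L (m₁ ys))) ⟩
    W c d e f * ∑Vec r (λ ys → 𝟙 (chain d ys) * (ne (final d ys) e * path r′ f c L (m₁ ys)))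
      ≡⟨ cong (λ z → W c d e f * z) (∑Vec-walk r d (λ y m → ne y e * path r′ f c L (add 1 f (add 1 e m))) m₀) ⟩
    W c d e f * walk r d (λ y m → ne y e * path r′ f c L (add 1 f (add 1 e m))) m₀ ∎
    where
    m₀ = add 1 d (add 1 c zeros)
    m₁ : Vec (Fin K) r → Vec ℕ K
    m₁ ys = add 1 f (add 1 e (content m₀ ys))

-- Failure of e-positivity

toℚᵘ-toℚ : ∀ n → ℚ.toℚᵘ (toℚ n) ℚᵘ.≃ mkℚᵘ (pos n) 0
toℚᵘ-toℚ n = ℚₚ.toℚᵘ-fromℚᵘ (mkℚᵘ (pos n) 0)

toℚ-injective : ∀ {m n} → toℚ m ≡ toℚ n → m ≡ n
toℚ-injective {m} {n} e with ℚᵘₚ.≃-trans (ℚᵘₚ.≃-sym (toℚᵘ-toℚ m)) (ℚᵘₚ.≃-trans (ℚᵘₚ.≃-reflexive (cong ℚ.toℚᵘ e)) (toℚᵘ-toℚ n))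
... | *≡* p = ℤₚ.+-injective (trans (sym (ℤₚ.*-identityʳ (pos m))) (trans p (ℤₚ.*-identityʳ (pos n))))

toℚ-* : ∀ m n → toℚ (m ℕ.* n) ≡ toℚ m ℚ.* toℚ n
toℚ-* m n = ℚₚ.toℚᵘ-injective (ℚᵘₚ.≃-trans (toℚᵘ-toℚ (m ℕ.* n)) (ℚᵘₚ.≃-trans (*≡* (cong (λ z → z * 1ℤ) (ℤₚ.pos-* m n)))
  (ℚᵘₚ.≃-sym (ℚᵘₚ.≃-trans (ℚₚ.toℚᵘ-homo-* (toℚ m) (toℚ n)) (ℚᵘₚ.*-cong (toℚᵘ-toℚ m) (toℚᵘ-toℚ n))))))

toℚ-+ : ∀ m n → toℚ (m ℕ.+ n) ≡ toℚ m ℚ.+ toℚ n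
toℚ-+ m n = ℚₚ.toℚᵘ-injective (ℚᵘₚ.≃-trans (toℚᵘ-toℚ (m ℕ.+ n)) (ℚᵘₚ.≃-trans
  (*≡* (cong (λ z → z * 1ℤ) (trans (ℤₚ.pos-+ m n) (sym (cong₂ _+_ (ℤₚ.*-identityʳ (pos m)) (ℤₚ.*-identityʳ (pos n)))))))
  (ℚᵘₚ.≃-sym (ℚᵘₚ.≃-trans (ℚₚ.toℚᵘ-homo-+ (toℚ m) (toℚ n)) (ℚᵘₚ.+-cong (toℚᵘ-toℚ m) (toℚᵘ-toℚ n))))))

clear-denominator : ∀ c → 0ℚ ℚ.≤ c → Σ ℕ λ d → Σ ℕ λ n → toℚ (suc d) ℚ.* c ≡ toℚ n
clear-denominator (mkℚ (pos n) d co) _ = d , n , ℚₚ.toℚᵘ-injective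
  (ℚᵘₚ.≃-trans (ℚₚ.toℚᵘ-homo-* (toℚ (suc d)) (mkℚ (pos n) d co))
  (ℚᵘₚ.≃-trans (ℚᵘₚ.*-cong (toℚᵘ-toℚ (suc d)) (ℚᵘₚ.≃-refl {mkℚᵘ (pos n) d}))
  (ℚᵘₚ.≃-trans (*≡* eqn) (ℚᵘₚ.≃-sym (toℚᵘ-toℚ n)))))
  where
  eqn : pos (suc d) * pos n * 1ℤ ≡ pos n * pos (suc (d ℕ.+ 0))
  eqn = trans (ℤₚ.*-identityʳ _) (trans (ℤₚ.*-comm (pos (suc d)) (pos n)) (cong (λ z → pos n * pos (suc z)) (sym (ℕₚ.+-identityʳ d))))
clear-denominator (mkℚ -[1+ n ] d co) le with ℚₚ.drop-*≤* le
... | ()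

combℕ : List (List ℕ × ℕ) → List ℕ → ℕ
combℕ []            α = 0
combℕ ((μ , n) ∷ M) α = n ℕ.* coefE μ α ℕ.+ combℕ M α

scale : ℕ → List ℕ × ℕ → List ℕ × ℕ
scale k (μ , n) = μ , k ℕ.* n

combℕ-scale : ∀ k M α → combℕ (map (scale k) M) α ≡ k ℕ.* combℕ M α
combℕ-scale k []            α = sym (ℕₚ.*-zeroʳ k)
combℕ-scale k ((μ , n) ∷ M) α = trans (cong₂ ℕ._+_ (ℕₚ.*-assoc k n (coefE μ α)) (combℕ-scale k M α))
  (sym (ℕₚ.*-distribˡ-+ k (n ℕ.* coefE μ α) (combℕ M α)))

distribute-denominators : ∀ D d c x y → D ℚ.* d ℚ.* (c ℚ.* x ℚ.+ y) ≡ D ℚ.* (d ℚ.* c) ℚ.* x ℚ.+ d ℚ.* (D ℚ.* y)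
distribute-denominators = solve 5 (λ D d c x y → D :* d :* (c :* x :+ y) := D :* (d :* c) :* x :+ d :* (D :* y)) refl
  where open +-*-Solver

-- Stated for an arbitrary embedding ι, so that conversion checking never unfolds
-- the normalisation of fractions inside toℚ.
module Denominators (ι : ℕ → ℚ) (ι-0 : ι 0 ≡ 0ℚ) (ι-+ : ∀ m n → ι (m ℕ.+ n) ≡ ι m ℚ.+ ι n)
  (ι-* : ∀ m n → ι (m ℕ.* n) ≡ ι m ℚ.* ι n)
  (ι-clear : ∀ c → 0ℚ ℚ.≤ c → Σ ℕ λ d → Σ ℕ λ n → ι (suc d) ℚ.* c ≡ ι n) where

  comb : List (List ℕ × ℚ) → List ℕ → ℚ
  comb L α = foldr (λ p acc → proj₂ p ℚ.* ι (coefE (proj₁ p) α) ℚ.+ acc) 0ℚ L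

  clear-all : ∀ L → All (λ p → IsPartition (proj₁ p) × (0ℚ ℚ.≤ proj₂ p)) L →
    Σ ℕ λ d → Σ (List (List ℕ × ℕ)) λ M → All (IsPartition ∘ proj₁) M × (∀ α → ι (suc d) ℚ.* comb L α ≡ ι (combℕ M α))
  clear-all [] [] = 0 , [] , [] , λ α → trans (ℚₚ.*-zeroʳ (ι 1)) (sym ι-0)
  clear-all ((μ , c) ∷ L) ((part , c≥0) ∷ ps) with ι-clear c c≥0 | clear-all L ps
  -- The witness `d ℕ.+ D ℕ.* suc d` is the predecessor of `suc D ℕ.* suc d`, the product of the two
  -- denominators.
  ... | d , n , e | D , M , parts , E = d ℕ.+ D ℕ.* suc d , (μ , suc D ℕ.* n) ∷ map (scale (suc d)) M
        , part ∷ Allₚ.map⁺ (All.map (λ {p} z → z) parts) , λ α → begin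
    ι (suc D ℕ.* suc d) ℚ.* (c ℚ.* ι (coefE μ α) ℚ.+ comb L α)
      ≡⟨ cong (ℚ._* (c ℚ.* ι (coefE μ α) ℚ.+ comb L α)) (ι-* (suc D) (suc d)) ⟩
    ι (suc D) ℚ.* ι (suc d) ℚ.* (c ℚ.* ι (coefE μ α) ℚ.+ comb L α)
      ≡⟨ distribute-denominators (ι (suc D)) (ι (suc d)) c (ι (coefE μ α)) (comb L α) ⟩
    ι (suc D) ℚ.* (ι (suc d) ℚ.* c) ℚ.* ι (coefE μ α) ℚ.+ ι (suc d) ℚ.* (ι (suc D) ℚ.* comb L α)
      ≡⟨ cong₂ (λ u v → ι (suc D) ℚ.* u ℚ.* ι (coefE μ α) ℚ.+ ι (suc d) ℚ.* v) e (E α) ⟩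
    ι (suc D) ℚ.* ι n ℚ.* ι (coefE μ α) ℚ.+ ι (suc d) ℚ.* ι (combℕ M α)
      ≡⟨ cong₂ ℚ._+_ (trans (cong (ℚ._* ι (coefE μ α)) (sym (ι-* (suc D) n))) (sym (ι-* (suc D ℕ.* n) (coefE μ α))))
           (trans (sym (ι-* (suc d) (combℕ M α))) (cong ι (sym (combℕ-scale (suc d) M α)))) ⟩
    ι (suc D ℕ.* n ℕ.* coefE μ α) ℚ.+ ι (combℕ (map (scale (suc d)) M) α)
      ≡⟨ ι-+ (suc D ℕ.* n ℕ.* coefE μ α) _ ⟨
    ι (combℕ ((μ , suc D ℕ.* n) ∷ map (scale (suc d)) M) α) ∎

  ℕ-expansion : (ι-injective : ∀ {m n} → ι m ≡ ι n → m ≡ n) → (f : List ℕ → ℕ) →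
    ∀ L → All (λ p → IsPartition (proj₁ p) × (0ℚ ℚ.≤ proj₂ p)) L → (∀ α → ι (f α) ≡ comb L α) →
    Σ ℕ λ d → Σ (List (List ℕ × ℕ)) λ M → All (IsPartition ∘ proj₁) M × (∀ α → suc d ℕ.* f α ≡ combℕ M α)
  ℕ-expansion inj f L nonneg expansion with clear-all L nonneg
  ... | d , M , parts , E = d , M , parts , λ α →
    inj (trans (ι-* (suc d) (f α)) (trans (cong (ι (suc d) ℚ.*_) (expansion α)) (E α)))

-- With the denominators cleared the rest of the argument stays in ℤ, where the functional takes its
-- values.
EPositive⇒ℕ : ∀ G → EPositive G →
  Σ ℕ λ d → Σ (List (List ℕ × ℕ)) λ M → All (IsPartition ∘ proj₁) M × (∀ α → suc d ℕ.* coefX G α ≡ combℕ M α)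
EPositive⇒ℕ G (L , nonneg , expansion) =
  Denominators.ℕ-expansion toℚ refl toℚ-+ toℚ-* clear-denominator toℚ-injective (coefX G) L nonneg expansion

pair-combℕ : ∀ B (L : Func K) s M → All (λ p → 0ℤ ℤ.≤ s * pair B L (pos ∘ coefE (proj₁ p))) M →
             0ℤ ℤ.≤ s * pair B L (pos ∘ combℕ M)
pair-combℕ B L s [] [] = ℤₚ.≤-reflexive (sym (trans (cong (λ z → s * z) (box-zero B λ α → ℤₚ.*-zeroʳ (L α))) (ℤₚ.*-zeroʳ s)))
pair-combℕ {K} B L s ((μ , n) ∷ M) (p ∷ ps) = subst (0ℤ ℤ.≤_) (sym split)
  (ℤₚ.+-mono-≤ (subst (ℤ._≤ pos n * (s * pair B L (pos ∘ coefE μ))) (ℤₚ.*-zeroʳ (pos n)) (ℤₚ.*-monoˡ-≤-nonNeg (pos n) p)) (pair-combℕ B L s M ps))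
  where
  lem : ∀ x n e r → x * (n * e + r) ≡ n * (x * e) + x * r
  lem = solve-∀
  split : s * pair B L (pos ∘ combℕ ((μ , n) ∷ M)) ≡ pos n * (s * pair B L (pos ∘ coefE μ)) + s * pair B L (pos ∘ combℕ M)
  split = begin
    s * pair B L (pos ∘ combℕ ((μ , n) ∷ M))
      ≡⟨ cong (λ z → s * z) (box-cong B λ α → trans (cong (λ z → L α * z)
           (trans (ℤₚ.pos-+ (n ℕ.* coefE μ (toList α)) _) (cong (λ z → z + pos (combℕ M (toList α))) (ℤₚ.pos-* n (coefE μ (toList α))))))
           (lem (L α) (pos n) (pos (coefE μ (toList α))) (pos (combℕ M (toList α))))) ⟩
    s * box K B (λ α → pos n * (L α * pos (coefE μ (toList α))) + L α * pos (combℕ M (toList α)))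
      ≡⟨ cong (λ z → s * z) (trans (box-+ B (λ α → pos n * (L α * pos (coefE μ (toList α)))) (λ α → L α * pos (combℕ M (toList α))))
           (cong (λ z → z + pair B L (pos ∘ combℕ M)) (box-* B (pos n) (λ α → L α * pos (coefE μ (toList α)))))) ⟩
    s * (pos n * pair B L (pos ∘ coefE μ) + pair B L (pos ∘ combℕ M))
      ≡⟨ lem s (pos n) (pair B L (pos ∘ coefE μ)) (pair B L (pos ∘ combℕ M)) ⟩
    pos n * (s * pair B L (pos ∘ coefE μ)) + s * pair B L (pos ∘ combℕ M) ∎

pair-scaled : ∀ B (L : Func K) s d (f : List ℕ → ℕ) M → (∀ α → suc d ℕ.* f α ≡ combℕ M α) →
              All (λ p → 0ℤ ℤ.≤ s * pair B L (pos ∘ coefE (proj₁ p))) M → 0ℤ ℤ.≤ s * pair B L (pos ∘ f)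
pair-scaled {K} B L s d f M clear h = ℤₚ.*-cancelˡ-≤-pos 0ℤ (s * pair B L (pos ∘ f)) (pos (suc d))
  (subst (ℤ._≤ pos (suc d) * (s * pair B L (pos ∘ f))) (sym (ℤₚ.*-zeroʳ (pos (suc d))))
    (subst (0ℤ ℤ.≤_) (sym scaled) (pair-combℕ B L s M h)))
  where
  lem : ∀ x y z → x * (y * z) ≡ y * (x * z)
  lem = solve-∀
  scaled : pos (suc d) * (s * pair B L (pos ∘ f)) ≡ s * pair B L (pos ∘ combℕ M)
  scaled = begin
    pos (suc d) * (s * pair B L (pos ∘ f))
      ≡⟨ lem (pos (suc d)) s (pair B L (pos ∘ f)) ⟩
    s * (pos (suc d) * pair B L (pos ∘ f))
      ≡⟨ cong (λ z → s * z) (box-* B (pos (suc d)) (λ α → L α * pos (f (toList α)))) ⟨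
    s * box K B (λ α → pos (suc d) * (L α * pos (f (toList α))))
      ≡⟨ cong (λ z → s * z) (box-cong B λ α → trans (lem (pos (suc d)) (L α) (pos (f (toList α))))
           (cong (λ z → L α * z) (trans (sym (ℤₚ.pos-* (suc d) (f (toList α)))) (cong pos (clear (toList α)))))) ⟩
    s * pair B L (pos ∘ combℕ M) ∎

pair-EPositive : ∀ {G} → EPositive G → ∀ B (L : Func K) s →
                 (∀ μ → IsPartition μ → 0ℤ ℤ.≤ s * pair B L (pos ∘ coefE μ)) →
                 0ℤ ℤ.≤ s * pair B L (pos ∘ coefX G)
pair-EPositive {G = G} epos B L s h =
  let d , M , parts , clear = EPositive⇒ℕ G epos
  in pair-scaled B L s d (coefX G) M clear (All.map (λ {p} → h (proj₁ p)) parts)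

Supp⇒Low : ∀ d (L : Func K) → Supp d L → Low (suc d) L
Supp⇒Low d L s γ p = s γ (ℕₚ.>⇒≢ p)

-- `X` is the value of L on the chromatic symmetric function, so the cases b = a and b = a + 1
-- differ only in how its sign is found.
not-EPositive : ∀ a b → 1 ≤ a → a ≤ b → b ≤ suc a → (L : Func (suc a ℕ.+ suc b)) →
                Kill (suc a) L → Supp (suc a ℕ.+ suc b) L →
                es (suc a ℕ.+ suc b) L zeros ≡ 0ℤ → 0ℤ ℤ.≤ ps (suc a) (ps (suc b) L) zeros →
                ∀ X → ∑Vec (suc a ℕ.+ suc b) (λ κ → 𝟙 (properᵇ (AS (suc a) (suc b)) κ) * L (content zeros κ)) ≡ X →
                sgn (suc a ℕ.+ suc b) * X ℤ.< 0ℤ → ¬ EPositive (AS (suc a) (suc b))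
not-EPositive a b 1≤a a≤b b≤ L kill supp top Y≥0 X X-eq neg epos = ℤₚ.<⇒≱ neg
  (subst (λ z → 0ℤ ℤ.≤ sgn (suc a ℕ.+ suc b) * z) (trans (pair-coefX (AS (suc a) (suc b)) L) X-eq)
    (pair-EPositive {G = AS (suc a) (suc b)} epos (suc (suc a ℕ.+ suc b)) L (sgn (suc a ℕ.+ suc b)) λ μ part →
      subst (λ z → 0ℤ ℤ.≤ sgn (suc a ℕ.+ suc b) * z) (sym (pair-coefE (suc a ℕ.+ suc b) μ L (Supp⇒Low (suc a ℕ.+ suc b) L supp)))
        (esAll-nonneg a 1≤a L kill b a≤b b≤ supp top Y≥0 μ part)))

positive-* : ∀ m {x} → 0ℤ ℤ.< x → 0ℤ ℤ.< pos (suc m) * x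
positive-* m {x} x>0 = subst (ℤ._< pos (suc m) * x) (ℤₚ.*-zeroʳ (pos (suc m))) (ℤₚ.*-monoˡ-<-pos (pos (suc m)) x>0)

negative : ∀ m {x} → 0ℤ ℤ.< x → - (pos (suc m) * x) ℤ.< 0ℤ
negative m x>0 = ℤₚ.neg-mono-< (positive-* m x>0)

nonneg-* : ∀ m {x} → 0ℤ ℤ.≤ x → 0ℤ ℤ.≤ pos m * x
nonneg-* m {x} x≥0 = subst (ℤ._≤ pos m * x) (ℤₚ.*-zeroʳ (pos m)) (ℤₚ.*-monoˡ-≤-nonNeg (pos m) x≥0)

-- `sa` is (-1)^a while `s` is the sign (-1)^(a-2) coming from an arc with a - 2 inner vertices;
-- hence the double negation.
even-negative : ∀ {sa S X x s m n} → S ≡ sa * sa → sa ≡ - (- s) → s * s ≡ 1ℤ → X ≡ - (s * s * (pos (suc m) * pos (suc n) * x)) →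
                0ℤ ℤ.< x → S * X ℤ.< 0ℤ
even-negative {x = x} {s} {m} {n} refl refl s² refl x>0 = subst (ℤ._< 0ℤ) (sym (begin
  - (- s) * - (- s) * - (s * s * (pos (suc m) * pos (suc n) * x))    ≡⟨ lem s (pos (suc m)) (pos (suc n)) x ⟩
  s * s * (s * s) * - (pos (suc m) * (pos (suc n) * x))              ≡⟨ cong (λ u → u * u * - (pos (suc m) * (pos (suc n) * x))) s² ⟩
  1ℤ * - (pos (suc m) * (pos (suc n) * x))                           ≡⟨ ℤₚ.*-identityˡ _ ⟩
  - (pos (suc m) * (pos (suc n) * x))                                ∎)) (negative m (positive-* n x>0))
  where
  lem : ∀ s m n x → - (- s) * - (- s) * - (s * s * (m * n * x)) ≡ s * s * (s * s) * - (m * (n * x))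
  lem = solve-∀

odd-negative : ∀ {sa sb S X x s t k l m n} → S ≡ sa * sb → sa ≡ - (- s) → sb ≡ - (- t) → s * s ≡ 1ℤ → t * t ≡ 1ℤ →
               pos (suc k) * X ≡ - (s * t * (pos (suc l) * pos (suc m) * pos (suc n) * x)) → 0ℤ ℤ.< x → S * X ℤ.< 0ℤ
odd-negative {X = X} {x} {s} {t} {k} {l} {m} {n} refl refl refl s² t² e x>0 =
  -- The factor `suc k`, which is deg in the application, was introduced by `total-odd` and is
  -- cancelled here.
  ℤₚ.*-cancelˡ-<-nonNeg (pos (suc k)) (subst₂ ℤ._<_ (sym (begin
    pos (suc k) * (- (- s) * - (- t) * X)                                  ≡⟨ lem₁ (pos (suc k)) s t X ⟩
    s * t * (pos (suc k) * X)                                              ≡⟨ cong (λ z → s * t * z) e ⟩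
    s * t * - (s * t * (pos (suc l) * pos (suc m) * pos (suc n) * x))      ≡⟨ lem₂ s t (pos (suc l)) (pos (suc m)) (pos (suc n)) x ⟩
    s * s * (t * t) * - (pos (suc l) * (pos (suc m) * (pos (suc n) * x)))  ≡⟨ cong₂ (λ u v → u * v * - (pos (suc l) * (pos (suc m) * (pos (suc n) * x)))) s² t² ⟩
    1ℤ * - (pos (suc l) * (pos (suc m) * (pos (suc n) * x)))               ≡⟨ ℤₚ.*-identityˡ _ ⟩
    - (pos (suc l) * (pos (suc m) * (pos (suc n) * x)))                    ∎))
    (sym (ℤₚ.*-zeroʳ (pos (suc k)))) (negative l (positive-* m (positive-* n x>0))))
  where
  lem₁ : ∀ k s t x → k * (- (- s) * - (- t) * x) ≡ s * t * (k * x)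
  lem₁ = solve-∀
  lem₂ : ∀ s t l m n x → s * t * - (s * t * (l * m * n * x)) ≡ s * s * (t * t) * - (l * (m * (n * x)))
  lem₂ = solve-∀

-- This is where n ≥ 3 enters: `total-even` is used at `suc r`, so its factor that vanishes for a =
-- 2 is now positive.
AS-even : ∀ r → EvenFunctional (suc (suc (suc r))) → ¬ EPositive (AS (suc (suc (suc r))) (suc (suc (suc r))))
AS-even r (L , kill , supp , rel , x>0) = not-EPositive (suc (suc r)) (suc (suc r)) (s≤s z≤n) ℕₚ.≤-refl (ℕₚ.n≤1+n _) L kill supp
  (es-top-even (suc (suc r)) (s≤s z≤n) L kill rel)
  (subst (0ℤ ℤ.≤_) (sym rel) (nonneg-* (suc (suc (suc r))) (ℤₚ.<⇒≤ x>0)))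
  (total (suc r) (suc r) L) (∑Vec-AS (suc r) (suc r) L)
  (even-negative {s = sgn (suc r)} {suc r} {r} (sgn-+ (suc (suc (suc r))) (suc (suc (suc r)))) refl (sgn-square (suc r)) (total-even (suc r) L kill rel) x>0)

AS-odd : ∀ r → OddFunctional (suc (suc (suc r))) (suc (suc (suc (suc r)))) → ¬ EPositive (AS (suc (suc (suc r))) (suc (suc (suc (suc r)))))
AS-odd r (L , kill , supp , rel , x>0 , y≥0) = not-EPositive (suc (suc r)) (suc (suc (suc r))) (s≤s z≤n) (ℕₚ.n≤1+n _) ℕₚ.≤-refl L kill supp
  (es-top-odd (suc (suc r)) (s≤s z≤n) L kill rel) y≥0
  (total (suc r) (suc (suc r)) L) (∑Vec-AS (suc r) (suc (suc r)) L)
  (odd-negative {s = sgn (suc r)} {sgn (suc (suc r))} {suc (suc r) ℕ.+ suc (suc (suc (suc r)))} {suc (suc r)} {suc r} {r}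
    (sgn-+ (suc (suc (suc r))) (suc (suc (suc (suc r))))) refl refl (sgn-square (suc r)) (sgn-square (suc (suc r))) (total-odd (suc r) L kill rel) x>0)

AS-even-not-EPositive : ∀ r → ¬ EPositive (AS (suc (suc (suc r))) (suc (suc (suc r))))
AS-even-not-EPositive r = AS-even r (functional-even (suc (suc r)))

AS-odd-not-EPositive : ∀ r → ¬ EPositive (AS (suc (suc (suc r))) (suc (suc (suc (suc r)))))
AS-odd-not-EPositive r = AS-odd r (functional-odd (suc (suc r)))

-- Claw contractions

<ᵇ-true : ∀ {m n} → m < n → (m <ᵇ n) ≡ true
<ᵇ-true {m} {n} p with m <ᵇ n | ℕₚ.<⇒<ᵇ p
... | true | _ = refl

<ᵇ-false : ∀ {m n} → n ≤ m → (m <ᵇ n) ≡ false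
<ᵇ-false {m} {n} p with m <ᵇ n | ℕₚ.<ᵇ⇒< m n
... | true  | f = ⊥-elim (ℕₚ.<⇒≱ (f tt) p)
... | false | _ = refl

<ᵇ-suc : ∀ i {x} → suc i ≢ x → (i <ᵇ x) ≡ (suc i <ᵇ x)
<ᵇ-suc i {x} p = T-ext (λ t → ℕₚ.<⇒<ᵇ (ℕₚ.≤∧≢⇒< (ℕₚ.<ᵇ⇒< i x t) p)) (λ t → ℕₚ.<⇒<ᵇ (ℕₚ.<⇒≤ (ℕₚ.<ᵇ⇒< (suc i) x t)))

data Sector : Set where
  outer lower upper : Sector

third : ∀ p q → Σ Sector λ s → p ≢ s × q ≢ s
third outer outer = lower , (λ ()) , (λ ())
third outer lower = upper , (λ ()) , (λ ())
third outer upper = lower , (λ ()) , (λ ())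
third lower outer = upper , (λ ()) , (λ ())
third lower lower = outer , (λ ()) , (λ ())
third lower upper = outer , (λ ()) , (λ ())
third upper outer = lower , (λ ()) , (λ ())
third upper lower = outer , (λ ()) , (λ ())
third upper upper = outer , (λ ()) , (λ ())

leaf-claw : ∀ j j′ → j ≢ zero → j′ ≢ zero → ¬ clawAdj j j′
leaf-claw zero    _       p q t = p refl
leaf-claw (suc j) zero    p q t = q refl
leaf-claw (suc j) (suc k) p q ()

-- Three leaves x < y < z cut the Hamiltonian cycle into three sectors, each containing centre
-- vertices. Chords only join {v₁, v₂} to {v_{a+1}, v_{a+2}}, and centre vertices among v₁, v₂
-- (or among v_{a+1}, v_{a+2}) share a sector, so the third sector is cut off from the others.
module ClawFree (a b : ℕ) (1≤a : 1 ≤ a) (2≤b : 2 ≤ b)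
  (S : Fin (a ℕ.+ b) → Fin (a ℕ.+ b) → Bool) (c : Fin (a ℕ.+ b) → Fin 4)
  (S⊆adj : ∀ u v → T (S u v) → T (adj (AS a b) u v))
  (S-class : ∀ u v → T (S u v) → c u ≡ c v)
  (connected : ∀ u v → c u ≡ c v → Reach S u v)
  (apart : ∀ u v → T (adj (AS a b) u v) → c u ≢ c v → clawAdj (c u) (c v)) where

  private
    M : ℕ
    M = a ℕ.+ b

    2≤M : 2 ≤ M
    2≤M = ℕₚ.≤-trans 2≤b (ℕₚ.m≤n+m b a)

    a+1<M : suc a < M
    a+1<M = subst (_≤ M) (ℕₚ.+-comm a 2) (ℕₚ.+-monoʳ-≤ a 2≤b)

    M≡ : suc (ℕ.pred M) ≡ M
    M≡ = ℕₚ.suc-pred M ⦃ ℕ.>-nonZero (ℕₚ.<-trans (s≤s z≤n) 2≤M) ⦄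

    l<M : ℕ.pred M < M
    l<M = ℕₚ.≤-reflexive M≡

    vₗ v₀ : Fin M
    vₗ = fromℕ< l<M
    v₀ = fromℕ< (ℕₚ.<-trans (s≤s z≤n) 2≤M)

    toℕ-v₀ : toℕ v₀ ≡ 0
    toℕ-v₀ = toℕ-fromℕ< (ℕₚ.<-trans (s≤s z≤n) 2≤M)

    l≢0 : toℕ vₗ ≢ toℕ v₀
    l≢0 e = ℕₚ.<⇒≢ (ℕₚ.≤-pred (subst (2 ≤_) (sym M≡) 2≤M)) (sym (trans (sym (toℕ-fromℕ< l<M)) (trans e toℕ-v₀)))

    -- Two leaves of the claw are not adjacent.
    same : ∀ u v → toℕ u ≢ toℕ v → Edge a b (toℕ u) (toℕ v) → c u ≢ zero → c v ≢ zero → c u ≡ c v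
    same u v p e u≢ v≢ with c u Fin.≟ c v
    ... | yes eq = eq
    ... | no  ne = ⊥-elim (leaf-claw (c u) (c v) u≢ v≢ (apart u v (adj-complete a b u v p e) ne))

    -- Along the cycle the class cannot pass from one leaf to another without meeting the centre, by
    -- `same` applied edge by edge.
    run : ∀ k (u v : Fin M) → toℕ v ≡ k ℕ.+ toℕ u → c u ≢ zero →
          (Σ (Fin M) λ w → toℕ u < toℕ w × toℕ w ≤ toℕ v × c w ≡ zero) ⊎ c v ≡ c u
    run zero    u v e u≢ = inj₂ (cong c (toℕ-injective e))
    run (suc k) u v e u≢ = advance (run k u v′ (toℕ-fromℕ< k<M) u≢)
      where
      k<M : k ℕ.+ toℕ u < M
      k<M = ℕₚ.<-trans (subst (k ℕ.+ toℕ u <_) (sym e) (ℕₚ.n<1+n _)) (toℕ<n v)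
      v′ : Fin M
      v′ = fromℕ< k<M
      v≡1+v′ : toℕ v ≡ suc (toℕ v′)
      v≡1+v′ = trans e (cong suc (sym (toℕ-fromℕ< k<M)))
      advance : (Σ (Fin M) λ w → toℕ u < toℕ w × toℕ w ≤ toℕ v′ × c w ≡ zero) ⊎ c v′ ≡ c u →
             (Σ (Fin M) λ w → toℕ u < toℕ w × toℕ w ≤ toℕ v × c w ≡ zero) ⊎ c v ≡ c u
      advance (inj₁ (w , p , q , r)) = inj₁ (w , p , ℕₚ.≤-trans q (subst (toℕ v′ ≤_) (sym v≡1+v′) (ℕₚ.n≤1+n _)) , r)
      advance (inj₂ eq) with c v Fin.≟ zero
      ... | yes r = inj₁ (v , subst (toℕ u <_) (sym e) (s≤s (ℕₚ.m≤n+m (toℕ u) k)) , ℕₚ.≤-refl , r)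
      ... | no  r = inj₂ (trans (sym (same v′ v (λ p → ℕₚ.1+n≢n (trans (sym v≡1+v′) (sym p)))
                      (subst (Edge a b (toℕ v′)) (sym v≡1+v′) next) (λ z → u≢ (trans (sym eq) z)) r)) eq)

    between : ∀ u v → toℕ u < toℕ v → c u ≢ zero → c v ≢ zero → c u ≢ c v →
              Σ (Fin M) λ w → toℕ u < toℕ w × toℕ w < toℕ v × c w ≡ zero
    between u v p u≢ v≢ ne with run (toℕ v ℕ.∸ toℕ u) u v (sym (ℕₚ.m∸n+n≡m (ℕₚ.<⇒≤ p))) u≢
    ... | inj₁ (w , q , r , e) = w , q , ℕₚ.≤∧≢⇒< r (λ eq → v≢ (trans (cong c (sym (toℕ-injective eq))) e)) , e
    ... | inj₂ eq = ⊥-elim (ne (sym eq))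

    module _ (x y z : Fin M) (x<y : toℕ x < toℕ y) (y<z : toℕ y < toℕ z)
      (x≢ : c x ≢ zero) (y≢ : c y ≢ zero) (z≢ : c z ≢ zero) (xy : c x ≢ c y) (yz : c y ≢ c z) (xz : c x ≢ c z) where

      -- The vertices x, y and z are counted in the sector after them, so `σ` changes only on
      -- entering one of them. That is why `σ-next` needs the later vertex alone to be in the
      -- centre.
      σ : ℕ → Sector
      σ i = if i <ᵇ toℕ x then outer else if i <ᵇ toℕ y then lower else if i <ᵇ toℕ z then upper else outer

      σ-below : ∀ {i} → i < toℕ x → σ i ≡ outer
      σ-below p rewrite <ᵇ-true p = refl

      σ-lower : ∀ {i} → toℕ x < i → i < toℕ y → σ i ≡ lower
      σ-lower p q rewrite <ᵇ-false (ℕₚ.<⇒≤ p) | <ᵇ-true q = refl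

      σ-upper : ∀ {i} → toℕ y < i → i < toℕ z → σ i ≡ upper
      σ-upper p q rewrite <ᵇ-false (ℕₚ.<⇒≤ (ℕₚ.<-trans x<y p)) | <ᵇ-false (ℕₚ.<⇒≤ p) | <ᵇ-true q = refl

      σ-above : ∀ {i} → toℕ z ≤ i → σ i ≡ outer
      σ-above p rewrite <ᵇ-false (ℕₚ.≤-trans (ℕₚ.<⇒≤ (ℕₚ.<-trans x<y y<z)) p) | <ᵇ-false (ℕₚ.≤-trans (ℕₚ.<⇒≤ y<z) p) | <ᵇ-false p = refl

      avoids : ∀ {v w : Fin M} → c v ≡ zero → c w ≢ zero → toℕ v ≢ toℕ w
      avoids p q e = q (trans (cong c (sym (toℕ-injective e))) p)

      σ-next : ∀ i v → toℕ v ≡ suc i → c v ≡ zero → σ i ≡ σ (suc i)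
      σ-next i v e r rewrite <ᵇ-suc i (avoids r x≢ ∘ trans e) | <ᵇ-suc i (avoids r y≢ ∘ trans e) | <ᵇ-suc i (avoids r z≢ ∘ trans e) = refl

      σ-close : ∀ (u v : Fin M) → suc (toℕ u) ≡ M → toℕ v ≡ 0 → c v ≡ zero → σ (toℕ u) ≡ σ (toℕ v)
      σ-close u v e e′ r = trans (σ-above (ℕₚ.≤-pred (subst (toℕ z <_) (sym e) (toℕ<n z))))
        (sym (σ-below (ℕₚ.≤∧≢⇒< (subst (_≤ toℕ x) (sym e′) z≤n) (avoids r x≢))))

      vₐ : Fin M
      vₐ = fromℕ< (ℕₚ.<-trans (ℕₚ.n<1+n a) a+1<M)

      toℕ-vₐ : toℕ vₐ ≡ a
      toℕ-vₐ = toℕ-fromℕ< (ℕₚ.<-trans (ℕₚ.n<1+n a) a+1<M)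

      is : ∀ {i} (u w : Fin M) → toℕ w ≡ i → toℕ u ≡ i → c u ≡ zero → c w ≡ zero
      is u w e e′ r = trans (cong c (toℕ-injective (trans e (sym e′)))) r

      -- With u at position i, this is the common sector of the centre vertices among positions i
      -- and i + 1. If there are none the value is a default, and no chord between centre vertices
      -- ends there.
      side : ℕ → Fin M → Sector
      side i u with c u Fin.≟ zero
      ... | yes _ = σ i
      ... | no  _ = σ (suc i)

      side-first : ∀ i u → c u ≡ zero → side i u ≡ σ i
      side-first i u r with c u Fin.≟ zero
      ... | yes _ = refl
      ... | no  p = ⊥-elim (p r)

      side-second : ∀ i u v → toℕ v ≡ suc i → c v ≡ zero → side i u ≡ σ (suc i)
      side-second i u v e r with c u Fin.≟ zero
      ... | yes _ = σ-next i v e r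
      ... | no  _ = refl

      near far s : Sector
      near = side 0 v₀
      far  = side a vₐ
      s = proj₁ (third near far)

      near≢s : near ≢ s
      near≢s = proj₁ (proj₂ (third near far))

      far≢s : far ≢ s
      far≢s = proj₂ (proj₂ (third near far))

      -- Cycle edges between centre vertices stay inside a sector, and a chord between them runs
      -- from `near` to `far`, neither of which is `s`.
      keeps : ∀ u v {i j} → toℕ u ≡ i → toℕ v ≡ j → c u ≡ zero → c v ≡ zero → Edge a b i j →
              σ i ≡ σ j ⊎ (σ i ≢ s × σ j ≢ s)
      keeps u v {i} p q r t next      = inj₁ (σ-next i v q t)
      keeps u v p q r t (close e)     = inj₁ (subst₂ (λ i j → σ i ≡ σ j) p q (σ-close u v (trans (cong suc p) e) q t))
      keeps u v p q r t chord₁        = inj₂ (near≢s ∘ trans (side-first 0 v₀ (is u v₀ toℕ-v₀ p r)) , far≢s ∘ trans (side-first a vₐ (is v vₐ toℕ-vₐ q t)))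
      keeps u v p q r t chord₂        = inj₂ (near≢s ∘ trans (side-second 0 v₀ u p r) , far≢s ∘ trans (side-second a vₐ v q t))
      keeps u v p q r t chord₁₂       = inj₂ (near≢s ∘ trans (side-first 0 v₀ (is u v₀ toℕ-v₀ p r)) , far≢s ∘ trans (side-second a vₐ v q t))

      stays : ∀ u v → c u ≡ zero → c v ≡ zero → Edge a b (toℕ u) (toℕ v) ⊎ Edge a b (toℕ v) (toℕ u) →
              σ (toℕ u) ≡ s → σ (toℕ v) ≡ s
      stays u v r t (inj₁ g) e = Sum.[ (λ eq → trans (sym eq) e) , (λ ne → ⊥-elim (proj₁ ne e)) ] (keeps u v refl refl r t g)
      stays u v r t (inj₂ g) e = Sum.[ (λ eq → trans eq e) , (λ ne → ⊥-elim (proj₂ ne e)) ] (keeps v u refl refl t r g)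

      reach-stays : ∀ {u v} → Reach S u v → c u ≡ zero → σ (toℕ u) ≡ s → σ (toℕ v) ≡ s
      reach-stays here r e = e
      reach-stays (step {u} {v} (inj₁ t) q) r e =
        let r′ = trans (sym (S-class u v t)) r in reach-stays q r′ (stays u v r r′ (adj-sound a b u v (S⊆adj u v t)) e)
      reach-stays (step {u} {v} (inj₂ t) q) r e =
        let r′ = trans (S-class v u t) r in reach-stays q r′ (stays u v r r′ (Sum.swap (adj-sound a b v u (S⊆adj v u t))) e)

      -- The outer sector contains the closing edge. Without a centre vertex there, x would be in
      -- the class of v₁ and z in that of the last vertex, and the closing edge would make these
      -- classes equal.
      around : Σ (Fin M) λ w → c w ≡ zero × σ (toℕ w) ≡ outer
      around with c v₀ Fin.≟ zero
      ... | yes r = v₀ , r , σ-below (ℕₚ.≤∧≢⇒< (subst (_≤ toℕ x) (sym toℕ-v₀) z≤n) (avoids r x≢))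
      ... | no  p with run (toℕ x) v₀ x (sym (trans (cong (toℕ x ℕ.+_) toℕ-v₀) (ℕₚ.+-identityʳ _))) p
      ...   | inj₁ (w , _ , q , r) = w , r , σ-below (ℕₚ.≤∧≢⇒< q (avoids r x≢))
      ...   | inj₂ x~0 with run (ℕ.pred M ℕ.∸ toℕ z) z vₗ (trans (toℕ-fromℕ< l<M) (sym (ℕₚ.m∸n+n≡m (ℕₚ.≤-pred (subst (toℕ z <_) (sym M≡) (toℕ<n z)))))) z≢
      ...     | inj₁ (w , q , _ , r) = w , r , σ-above (ℕₚ.<⇒≤ q)
      ...     | inj₂ z~l = ⊥-elim (xz (trans x~0 (trans (sym (same vₗ v₀ l≢0
                  (subst₂ (Edge a b) (sym (toℕ-fromℕ< l<M)) (sym toℕ-v₀) (close M≡)) (z≢ ∘ trans (sym z~l)) p)) z~l)))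

      witness : ∀ t → Σ (Fin M) λ w → c w ≡ zero × σ (toℕ w) ≡ t
      witness outer = around
      witness lower = let w , p , q , r = between x y x<y x≢ y≢ xy in w , r , σ-lower p q
      witness upper = let w , p , q , r = between y z y<z y≢ z≢ yz in w , r , σ-upper p q

      contradiction : ⊥
      contradiction =
        let w , r , e = witness s
            w′ , r′ , e′ = witness near
        -- Connectedness of the centre carries membership in `s` from `w` to `w′`, which lies in
        -- `near`.
        in near≢s (trans (sym e′) (reach-stays (connected w w′ (trans r (sym r′))) r e))

  no-three-leaves : ∀ x y z → c x ≢ zero → c y ≢ zero → c z ≢ zero → c x ≢ c y → c y ≢ c z → c x ≢ c z → ⊥
  no-three-leaves x y z x≢ y≢ z≢ xy yz xz
    with ℕₚ.<-cmp (toℕ x) (toℕ y) | ℕₚ.<-cmp (toℕ y) (toℕ z) | ℕₚ.<-cmp (toℕ x) (toℕ z)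
  ... | tri≈ _ e _ | _ | _ = xy (cong c (toℕ-injective e))
  ... | _ | tri≈ _ e _ | _ = yz (cong c (toℕ-injective e))
  ... | _ | _ | tri≈ _ e _ = xz (cong c (toℕ-injective e))
  ... | tri< p _ _ | tri< q _ _ | _          = contradiction x y z p q x≢ y≢ z≢ xy yz xz
  ... | tri< p _ _ | tri> _ _ q | tri< r _ _ = contradiction x z y r q x≢ z≢ y≢ xz (yz ∘ sym) xy
  ... | tri< p _ _ | tri> _ _ q | tri> _ _ r = contradiction z x y r p z≢ x≢ y≢ (xz ∘ sym) xy (yz ∘ sym)
  ... | tri> _ _ p | tri< q _ _ | tri< r _ _ = contradiction y x z p r y≢ x≢ z≢ (xy ∘ sym) xz yz
  ... | tri> _ _ p | tri< q _ _ | tri> _ _ r = contradiction y z x q r y≢ z≢ x≢ yz (xz ∘ sym) (xy ∘ sym)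
  ... | tri> _ _ p | tri> _ _ q | _          = contradiction z y x q p z≢ y≢ x≢ (yz ∘ sym) (xy ∘ sym) (xz ∘ sym)

AS-clawContractibleFree : ∀ a b → 1 ≤ a → 2 ≤ b → ClawContractibleFree (AS a b)
AS-clawContractibleFree a b 1≤a 2≤b (S , c , S⊆adj , onto , S-class , connected , quotient) =
  let x , cx = onto (suc zero)
      y , cy = onto (suc (suc zero))
      z , cz = onto (suc (suc (suc zero)))
  in ClawFree.no-three-leaves a b 1≤a 2≤b S c S⊆adj S-class connected
       (λ u v t ne → to (quotient (c u) (c v) ne) (u , v , refl , refl , t)) x y z
       (leaf cx λ ()) (leaf cy λ ()) (leaf cz λ ())
       (λ e → distinct cx cy (λ ()) e) (λ e → distinct cy cz (λ ()) e) (λ e → distinct cx cz (λ ()) e)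
  where
  leaf : ∀ {u j} → c u ≡ j → j ≢ zero → c u ≢ zero
  leaf p q r = q (trans (sym p) r)
  distinct : ∀ {u v j k} → c u ≡ j → c v ≡ k → j ≢ k → c u ≢ c v
  distinct p q ne e = ne (trans (sym p) (trans e q))

theorem3p10 : (n : ℕ) → 3 ≤ n →
    (ClawContractibleFree (AS n n) × ¬ EPositive (AS n n))
    × (ClawContractibleFree (AS n (suc n)) × ¬ EPositive (AS n (suc n)))
theorem3p10 (suc (suc (suc r))) _ =
    (AS-clawContractibleFree n n (s≤s z≤n) (s≤s (s≤s z≤n)) , AS-even-not-EPositive r)
  , (AS-clawContractibleFree n (suc n) (s≤s z≤n) (s≤s (s≤s z≤n)) , AS-odd-not-EPositive r)
  where
  n = suc (suc (suc r))
theorem3p10 (suc zero)       (s≤s ())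
theorem3p10 (suc (suc zero)) (s≤s (s≤s ()))
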